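{- For all integers $\alpha \geq 1$ and $n \geq 0$, \[a_3\left(5^{2\alpha}n +\gamma_{\alpha} \right) \equiv 0 \pmod{5^\alpha},\] where $\gamma_{\alpha}$ is the integer \[\gamma_{\alpha} = 20 + \frac{19 \cdot 25 \,(25^{\alpha-1}-1)}{24}.\]
   Context: For a positive integer $d$, $a_d(n)$ denotes the number of partitions of $n$ in which the odd parts are unrestricted and each even part may independently be assigned one of $d$ colors (generalized cubic partitions). Equivalently, $\sum_{n\ge 0} a_3(n)q^n = \prod_{k\ge1}\frac{1}{(1-q^k)(1-q^{2k})^2}$. -}

module Defs where

open import Data.Nat using (ℕ; zero; suc; _+_; _*_; _∸_; _^_; _/_; _≤_; _<_)
open import Data.Nat.Properties using (_<?_)
open import Data.List using (List; []; _∷_; _++_; replicate; upTo; map)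
open import Data.Nat.ListAction using (sum)
open import Relation.Nullary using (yes; no)
open import Data.Nat using (_%_)
open import Data.Nat.Properties using (_≟_)

colorsOf : ℕ → ℕ → ℕ
colorsOf d k with k % 2 ≟ 0
... | yes _ = d
... | no  _ = 1

partTypes : ℕ → ℕ → List ℕ
partTypes d zero    = []
partTypes d (suc m) = replicate (colorsOf d (suc m)) (suc m) ++ partTypes d m

-- countMultisets ts n : number of multisets of entries of the list ts
-- (entries are distinguished by position; their values are part sizes, all ≥ 1)
-- whose sizes sum to n.  For the first entry t we sum over its multiplicity
-- m = 0, 1, ..., n (those with m·t ≤ n).
countMultisets : List ℕ → ℕ → ℕ
countMultisets []       zero    = 1
countMultisets []       (suc n) = 0
countMultisets (t ∷ ts) n = sum (map term (upTo (suc n)))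
  where
  term : ℕ → ℕ
  term m with n <? m * t
  ... | yes _ = 0
  ... | no  _ = countMultisets ts (n ∸ m * t)

-- a_d(n): number of partitions of n in which odd parts are unrestricted and
-- each even part is assigned one of d colors.
a : ℕ → ℕ → ℕ
a d n = countMultisets (partTypes d n) n

-- γ_α = 20 + 19·25·(25^(α-1) - 1)/24   (the division is exact)
γ : ℕ → ℕ
γ α = 20 + (19 * 25 * (25 ^ (α ∸ 1) ∸ 1)) / 24

-- Let η = ∏ (1 - qᵏ), ψ = η(q²)² / η = Σ q^(n (n + 1) / 2), s = q ψ(q⁵)² / ψ(q)², S = s(q⁵) and
-- Z = q⁵ η(q²⁵) η(q⁵⁰)² / (η η(q²)²), and let U keep the terms q^(5n) and replace them by qⁿ.
-- For D_α = Σ a₃(5^(2α) n + γ_α) qⁿ and E_α = q η η(q²)² D_α one has E₁ = U (U Z) and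
-- E_{α+1} = U (U (Z E_α)).
--
-- Comparing the 5-dissections of both sides of η ψ = η(q²)² determines the ratios of their components
-- as functions of the single series q η(q²⁵) / e, where e collects the exponents of η divisible by 5.
-- The product of ψ(ζ q) over the fifth roots of unity ζ identifies S among these functions.  It follows
-- that y with s y² = S satisfies a quintic equation over ℤ[S] and that (1 - 5 S)⁴ Z is a polynomial in
-- y over ℤ[S, s], which makes U computable on ℤ[s] and on Z ℤ[s].
--
-- By the degree 5 recurrence, U (sʲ (1 - s)) is a combination of terms (1 - s) 5ᵛ sⁱ with
-- 5 i ≤ 6 v + j + const, and similarly with a factor Z.  Hence the q-adic closures L₀ and L₁ of the
-- spans of the 5ᵛ s^(j+1) (1 - s) with j ≤ 3 v + 2 and with j ≤ 3 v + 1 satisfy U (Z L₀) ⊆ L₁ and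
-- U L₁ ⊆ 5 L₀, so that E_α lies in 5^α L₀.

module Submission where

open import Algebra using (CommutativeRing)
open import Algebra.Solver.Ring.AlmostCommutativeRing
open import Algebra.Structures using (IsCommutativeRing)
open import Data.Bool as Bool using (Bool; true; _∧_)
open import Data.Bool.Properties using (T-∧)
open import Data.Fin using (zero; suc)
open import Data.Integer as ℤ using (ℤ; +_)
open import Data.List using (List; []; _∷_; _++_; applyUpTo; map; replicate; upTo)
open import Data.List.Properties using (map-upTo)
open import Data.Maybe using (Maybe; just; nothing; is-just; to-witness-T)
open import Data.Nat as ℕ using (ℕ; zero; suc; NonZero; s≤s; z≤n; _∸_; _<?_; _%_; _/_)
open import Data.Nat.Divisibility using (∣-refl; divides)
open import Data.Nat.DivMod using (+-distrib-/-∣ˡ; [m+kn]%n≡m%n; [m+n]%n≡m%n; m*n%n≡0; m*n/n≡m; m/n≤m; m<n⇒m%n≡m; m<n⇒m/n≡0; n/n≡1)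
open import Data.Nat.ListAction using (sum)
open import Data.Nat.Tactic.RingSolver using (solve-∀)
open import Data.Product using (_,_; _×_; ∃; proj₁; proj₂)
open import Data.Sum using (_⊎_; inj₁; inj₂)
open import Data.Vec using (Vec; []; _∷_; tabulate)
open import Data.Vec.N-ary using (N-ary; _$ⁿ_; curryⁿ; ∀ⁿ)
open import Data.Vec.Relation.Binary.Pointwise.Inductive as PointwiseProperties using (Pointwise; []; _∷_)
open import Function using (_⟨_⟩_)
open import Function.Bundles using (Equivalence)
open import Level using (0ℓ)
open import Relation.Binary using (Setoid)
open import Relation.Binary.Definitions using (tri<; tri≈; tri>)
open import Relation.Binary.PropositionalEquality as ≡ using (_≡_; _≢_)
open import Relation.Nullary using (yes; no; contradiction)
open import Relation.Nullary.Decidable using (True; False; toWitness; toWitnessFalse)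
import Data.Integer.Properties as ℤₚ
import Data.Nat.Properties as ℕₚ

-- In modular terms s is the eta quotient η(τ)² η(10τ)⁴ / (η(2τ)⁴ η(5τ)²), a Hauptmodul of Γ₀(10):
-- its zero lies at the cusp ∞, its pole at 1/2, and its values at the cusps 1/5 and 0 are 1 and
-- 1/5. The proof uses no modular forms; what a valence argument would give is derived from product
-- identities. The factor 1 - s makes the gain of 5 possible. As U s ≡ s modulo 5, nothing is gained
-- on s itself, whereas U (s (1 - s)) and U (s² (1 - s)) are divisible by 5. The same does not
-- follow for U (s³ (1 - s)), so the lattice to which the plain U is applied must exclude j = 2 at v
-- = 0. This is the difference between L₁ and L₀. The denominator (1 - 5 s)⁴ of U Z belongs to the
-- cusp 0. Its inverse is a power series in 5 s, harmless for the bounds but no polynomial; hence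
-- the lattices are closed q-adically and all membership is stated by approximation. The powers of s
-- obey a recurrence of order five, so five initial values of U have to be known. They are taken
-- from s⁻⁴ to s⁰, made integral by the factor S⁴, since there they are traces of small powers of y.

-- Polynomial identities and certificates of ideal membership

module Solver (R : CommutativeRing 0ℓ 0ℓ)
  (hom : CommutativeRing.rawRing ℤₚ.+-*-commutativeRing -Raw-AlmostCommutative⟶ fromCommutativeRing R) where
  open CommutativeRing R
  open import Algebra.Properties.Semiring.Exp semiring using (^-congˡ)
  open _-Raw-AlmostCommutative⟶_ hom renaming (⟦_⟧ to ι)
  coeff≟ : ∀ x y → Maybe (ι x ≈ ι y)
  coeff≟ x y with x ℤ.≟ y
  ... | yes ≡.refl = just refl
  ... | no _ = nothing
  open import Algebra.Solver.Ring (CommutativeRing.rawRing ℤₚ.+-*-commutativeRing) (fromCommutativeRing R) hom coeff≟ public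
    hiding (solve; prove)
  vars : ∀ n → Vec (Polynomial n) n
  vars n = tabulate var

  private
    Goal : ∀ {n} → Polynomial n × Polynomial n → Env n → Set
    Goal (p , q) ρ = ⟦ p ⟧ ρ ≈ ⟦ q ⟧ ρ

    -- The certificate is a Boolean about the normal form of the difference, so that checking an
    -- identity only computes with integer coefficients and needs no proof term at the call.
    decide : ∀ {n} (e : Polynomial n × Polynomial n) → Bool.T (is-just (normalise (proj₁ e :- proj₂ e) ≟N 0N)) → ∀ ρ → Goal e ρ
    decide (p , q) w ρ = begin
        ⟦ p ⟧ ρ                         ≈⟨ +-identityʳ _ ⟨
        ⟦ p ⟧ ρ + 0#                    ≈⟨ +-congˡ (-‿inverseˡ (⟦ q ⟧ ρ)) ⟨
        ⟦ p ⟧ ρ + (- ⟦ q ⟧ ρ + ⟦ q ⟧ ρ) ≈⟨ +-assoc _ _ _ ⟨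
        ⟦ p ⟧ ρ + - ⟦ q ⟧ ρ + ⟦ q ⟧ ρ   ≈⟨ +-congʳ difference≈0 ⟩
        0# + ⟦ q ⟧ ρ                    ≈⟨ +-identityˡ _ ⟩
        ⟦ q ⟧ ρ                         ∎
      where
      open import Relation.Binary.Reasoning.Setoid setoid
      0N-sem : ∀ {m} (σ : Env m) → ⟦ 0N ⟧N σ ≈ 0#
      0N-sem []      = 0-homo
      0N-sem (_ ∷ _) = refl
      difference≈0 : ⟦ p :- q ⟧ ρ ≈ 0#
      difference≈0 = trans (sym (correct (p :- q) ρ)) (trans (⟦ to-witness-T _ w ⟧N-cong ρ) (0N-sem ρ))

  close : ∀ n {A : Set} → N-ary n (Polynomial n) A → A
  close n f = f $ⁿ vars n

  by : ∀ n (e : N-ary n (Polynomial n) (Polynomial n × Polynomial n)) →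
       {_ : Bool.T (is-just (normalise (proj₁ (close n e) :- proj₂ (close n e)) ≟N 0N))} →
       ∀ⁿ n (curryⁿ (Goal (close n e)))
  by n e {w} = curryⁿ′ n (Goal (close n e)) (decide (close n e) w)
    where
    curryⁿ′ : ∀ m (B : Vec Carrier m → Set) → (∀ ρ → B ρ) → ∀ⁿ m (curryⁿ B)
    curryⁿ′ zero    B h = h []
    curryⁿ′ (suc m) B h = λ x → curryⁿ′ m (λ ρ → B (x ∷ ρ)) (λ ρ → h (x ∷ ρ))

  κ : ∀ {n} → ℕ → Polynomial n
  κ n = con (+ n)

  difference : ∀ {l r} → l ≈ r → l - r ≈ 0#
  difference p = trans (+-congʳ p) (-‿inverseʳ _)

  equal : ∀ {l r} → l - r ≈ 0# → l ≈ r
  equal {l} {r} p = trans (by 2 (λ l r → l , (l :- r) :+ r) l r) (trans (+-congʳ p) (+-identityˡ r))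

  -- A certificate of ideal membership: L ≈ R follows from the relation l ≈ r once L - R = c (l - r)
  -- is a polynomial identity. The cofactor c is the quotient of a polynomial division.
  combine₁ : ∀ {L R c l r} → L ≈ R + c * (l - r) → l ≈ r → L ≈ R
  combine₁ p q = trans p (trans (+-congˡ (trans (*-congˡ (difference q)) (zeroʳ _))) (+-identityʳ _))

  combine₂ : ∀ {L R c l r c′ l′ r′} → L ≈ R + c * (l - r) + c′ * (l′ - r′) → l ≈ r → l′ ≈ r′ → L ≈ R
  combine₂ p q q′ = combine₁ (combine₁ p q′) q

  combine₃ : ∀ {L R c l r c′ l′ r′ c″ l″ r″} →
    L ≈ R + c * (l - r) + c′ * (l′ - r′) + c″ * (l″ - r″) → l ≈ r → l′ ≈ r′ → l″ ≈ r″ → L ≈ R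
  combine₃ p q q′ q″ = combine₂ (combine₁ p q″) q q′

  ⟦_⟧-cong : ∀ {n} (p : Polynomial n) {ρ σ : Env n} → Pointwise _≈_ ρ σ → ⟦ p ⟧ ρ ≈ ⟦ p ⟧ σ
  ⟦ op [+] p q ⟧-cong e = +-cong (⟦ p ⟧-cong e) (⟦ q ⟧-cong e)
  ⟦ op [*] p q ⟧-cong e = *-cong (⟦ p ⟧-cong e) (⟦ q ⟧-cong e)
  ⟦ con c ⟧-cong      e = refl
  ⟦ var i ⟧-cong      e = PointwiseProperties.lookup e i
  ⟦ p :^ k ⟧-cong     e = ^-congˡ k (⟦ p ⟧-cong e)
  ⟦ :- p ⟧-cong       e = -‿cong (⟦ p ⟧-cong e)

  -- Saves a tower of congruence steps when several subexpressions of a long polynomial change at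
  -- once.
  replace : ∀ n (e : Vec (Polynomial n) n → Polynomial n) {ρ σ : Env n} → Pointwise _≈_ ρ σ → ⟦ e (vars n) ⟧ ρ ≈ ⟦ e (vars n) ⟧ σ
  replace n e = ⟦ e (vars n) ⟧-cong

ℤ-ring : CommutativeRing 0ℓ 0ℓ
ℤ-ring = ℤₚ.+-*-commutativeRing

-- Formal power series over a commutative ring

module Series (R : CommutativeRing 0ℓ 0ℓ)
  (ι : CommutativeRing.rawRing ℤ-ring -Raw-AlmostCommutative⟶ fromCommutativeRing R) where
  private module R = CommutativeRing R
  open R using (Carrier; 0#; 1#) renaming (_≈_ to _≈ᵣ_)
  import Relation.Binary.Reasoning.Setoid as SetoidReasoning
  private module RR = SetoidReasoning R.setoid

  Series : Set
  Series = ℕ → Carrier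

  infix 4 _≋_
  -- A record instead of a bare function type, so that unification can recover both series from the
  -- type of a proof.
  record _≋_ (f g : Series) : Set where
    constructor pointwise
    field at : ∀ n → f n ≈ᵣ g n
  open _≋_ public

  tail : Series → Series
  tail f n = f (suc n)

  infixl 6 _⊕_
  infixl 7 _⊛_
  opaque
    -- Opaque, because sums and negatives would unfold to functions of the index during unification;
    -- `_⊛_` is stuck anyway until its index is a constructor.
    _⊕_ : Series → Series → Series
    (f ⊕ g) n = f n R.+ g n

    ⊝_ : Series → Series
    (⊝ f) n = R.- f n

    ⊕-at : ∀ f g n → (f ⊕ g) n ≡ f n R.+ g n
    ⊕-at f g n = ≡.refl

    ⊝-at : ∀ f n → (⊝ f) n ≡ R.- f n
    ⊝-at f n = ≡.refl

  -- The Cauchy product by recursion on the index, from f g = f₀ g + q (tail f) g. Structural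
  -- induction thereby replaces the handling of finite sums.
  _⊛_ : Series → Series → Series
  (f ⊛ g) zero    = f 0 R.* g 0
  (f ⊛ g) (suc n) = f 0 R.* g (suc n) R.+ (tail f ⊛ g) n

  const : Carrier → Series
  const c zero    = c
  const c (suc n) = 0#

  const-0-at : ∀ n → const 0# n ≡ 0#
  const-0-at zero    = ≡.refl
  const-0-at (suc n) = ≡.refl

  X : Series
  X zero          = 0#
  X (suc zero)    = 1#
  X (suc (suc n)) = 0#

  ⊛-upto : ∀ {f f′ g g′} n → (∀ i → i ℕ.≤ n → f i ≈ᵣ f′ i) → (∀ i → i ℕ.≤ n → g i ≈ᵣ g′ i) →
           (f ⊛ g) n ≈ᵣ (f′ ⊛ g′) n
  ⊛-upto zero    p q = R.*-cong (p 0 ℕ.z≤n) (q 0 ℕ.z≤n)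
  ⊛-upto (suc n) p q = R.+-cong (R.*-cong (p 0 ℕ.z≤n) (q (suc n) ℕₚ.≤-refl))
    (⊛-upto n (λ i i≤n → p (suc i) (ℕ.s≤s i≤n)) (λ i i≤n → q i (ℕₚ.m≤n⇒m≤1+n i≤n)))

  ⊛-at-cong : ∀ {f f′ g g′} → (∀ i → f i ≈ᵣ f′ i) → (∀ i → g i ≈ᵣ g′ i) → ∀ n → (f ⊛ g) n ≈ᵣ (f′ ⊛ g′) n
  ⊛-at-cong p q n = ⊛-upto n (λ i _ → p i) (λ i _ → q i)

  scale-⊛ : ∀ c f g n → ((λ i → c R.* f i) ⊛ g) n ≈ᵣ c R.* (f ⊛ g) n
  scale-⊛ c f g zero    = R.*-assoc c _ _
  scale-⊛ c f g (suc n) = R.trans (R.+-cong (R.*-assoc c _ _) (scale-⊛ c (tail f) g n)) (R.sym (R.distribˡ c _ _))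

  private
    swap : ∀ a b c d → (a R.+ b) R.+ (c R.+ d) ≈ᵣ (a R.+ c) R.+ (b R.+ d)
    swap a b c d = R.trans (R.+-assoc a b _) (R.trans (R.+-congˡ (R.trans (R.sym (R.+-assoc b c d))
      (R.trans (R.+-congʳ (R.+-comm b c)) (R.+-assoc c b d)))) (R.sym (R.+-assoc a c _)))

    opaque
      unfolding _⊕_
      ⊛-distribʳ : ∀ h f g n → ((f ⊕ g) ⊛ h) n ≈ᵣ (f ⊛ h) n R.+ (g ⊛ h) n
      ⊛-distribʳ h f g zero    = R.distribʳ _ _ _
      ⊛-distribʳ h f g (suc n) = R.trans (R.+-cong (R.distribʳ _ _ _) (⊛-distribʳ h (tail f) (tail g) n)) (swap _ _ _ _)

    opaque
      unfolding _⊕_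
      ⊛-assoc : ∀ f g h n → ((f ⊛ g) ⊛ h) n ≈ᵣ (f ⊛ (g ⊛ h)) n
      ⊛-assoc f g h zero    = R.*-assoc _ _ _
      ⊛-assoc f g h (suc n) = begin
        (f 0 R.* g 0) R.* h (suc n) R.+ ((tail (f ⊛ g)) ⊛ h) n
          ≈⟨ R.+-cong (R.*-assoc _ _ _) (⊛-distribʳ h (λ i → f 0 R.* g (suc i)) (tail f ⊛ g) n) ⟩
        f 0 R.* (g 0 R.* h (suc n)) R.+ (((λ i → f 0 R.* g (suc i)) ⊛ h) n R.+ ((tail f ⊛ g) ⊛ h) n)
          ≈⟨ R.+-congˡ (R.+-cong (scale-⊛ (f 0) (tail g) h n) (⊛-assoc (tail f) g h n)) ⟩
        f 0 R.* (g 0 R.* h (suc n)) R.+ (f 0 R.* (tail g ⊛ h) n R.+ (tail f ⊛ (g ⊛ h)) n)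
          ≈⟨ R.sym (R.+-assoc _ _ _) ⟩
        f 0 R.* (g 0 R.* h (suc n)) R.+ f 0 R.* (tail g ⊛ h) n R.+ (tail f ⊛ (g ⊛ h)) n
          ≈⟨ R.+-congʳ (R.sym (R.distribˡ (f 0) _ _)) ⟩
        f 0 R.* (g 0 R.* h (suc n) R.+ (tail g ⊛ h) n) R.+ (tail f ⊛ (g ⊛ h)) n ∎
        where open RR

    -- The mirror image of the defining equation, which peels the right factor; commutativity
    -- compares the two.
    ⊛-sucʳ : ∀ f g n → (f ⊛ g) (suc n) ≈ᵣ f (suc n) R.* g 0 R.+ (f ⊛ tail g) n
    ⊛-sucʳ f g zero    = R.+-comm _ _
    ⊛-sucʳ f g (suc n) = begin
      f 0 R.* g (2 ℕ.+ n) R.+ (tail f ⊛ g) (suc n)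
        ≈⟨ R.+-congˡ (⊛-sucʳ (tail f) g n) ⟩
      f 0 R.* g (2 ℕ.+ n) R.+ (f (2 ℕ.+ n) R.* g 0 R.+ (tail f ⊛ tail g) n)
        ≈⟨ R.sym (R.+-assoc _ _ _) ⟩
      f 0 R.* g (2 ℕ.+ n) R.+ f (2 ℕ.+ n) R.* g 0 R.+ (tail f ⊛ tail g) n
        ≈⟨ R.+-congʳ (R.+-comm _ _) ⟩
      f (2 ℕ.+ n) R.* g 0 R.+ f 0 R.* g (2 ℕ.+ n) R.+ (tail f ⊛ tail g) n
        ≈⟨ R.+-assoc _ _ _ ⟩
      f (2 ℕ.+ n) R.* g 0 R.+ (f 0 R.* g (2 ℕ.+ n) R.+ (tail f ⊛ tail g) n) ∎
      where open RR

    ⊛-comm : ∀ f g n → (f ⊛ g) n ≈ᵣ (g ⊛ f) n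
    ⊛-comm f g zero    = R.*-comm _ _
    ⊛-comm f g (suc n) = R.trans (R.+-cong (R.*-comm _ _) (⊛-comm (tail f) g n)) (R.sym (⊛-sucʳ g f n))

    ⊛-zeroˡ : ∀ f g → (∀ i → f i ≈ᵣ 0#) → ∀ n → (f ⊛ g) n ≈ᵣ 0#
    ⊛-zeroˡ f g z zero    = R.trans (R.*-congʳ (z 0)) (R.zeroˡ _)
    ⊛-zeroˡ f g z (suc n) = R.trans (R.+-cong (R.trans (R.*-congʳ (z 0)) (R.zeroˡ _)) (⊛-zeroˡ (tail f) g (λ i → z (suc i)) n))
        (R.+-identityˡ _)

  const-⊛ : ∀ c g n → (const c ⊛ g) n ≈ᵣ c R.* g n
  const-⊛ c g zero    = R.refl
  const-⊛ c g (suc n) = R.trans (R.+-congˡ (⊛-zeroˡ _ g (λ _ → R.refl) n)) (R.+-identityʳ _)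

  X-⊛-suc : ∀ g n → (X ⊛ g) (suc n) ≈ᵣ g n
  X-⊛-suc g n = R.trans (R.+-cong (R.zeroˡ _) (⊛-at-cong {tail X} {const 1#} {g} (λ { zero → R.refl ; (suc i) → R.refl }) (λ _ → R.refl) n))
    (R.trans (R.+-identityˡ _) (R.trans (const-⊛ 1# g n) (R.*-identityˡ _)))

  X-⊛-zero : ∀ g → (X ⊛ g) 0 ≈ᵣ 0#
  X-⊛-zero g = R.zeroˡ _

  private
    opaque
      unfolding _⊕_
      isRing : IsCommutativeRing _≋_ _⊕_ _⊛_ ⊝_ (const 0#) (const 1#)
      isRing = record
            { isRing = record
              { +-isAbelianGroup = record
                { isGroup = record
                  { isMonoid = record
                    { isSemigroup = record
                      { isMagma = record
                        { isEquivalence = record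
                          { refl  = pointwise λ _ → R.refl
                          ; sym   = λ p → pointwise λ n → R.sym (at p n)
                          ; trans = λ p q → pointwise λ n → R.trans (at p n) (at q n) }
                        ; ∙-cong = λ p q → pointwise λ n → R.+-cong (at p n) (at q n) }
                      ; assoc = λ f g h → pointwise λ n → R.+-assoc _ _ _ }
                    ; identity = (λ f → pointwise λ { zero → R.+-identityˡ _ ; (suc n) → R.+-identityˡ _ })
                               , (λ f → pointwise λ { zero → R.+-identityʳ _ ; (suc n) → R.+-identityʳ _ }) }
                  ; inverse = (λ f → pointwise λ { zero → R.-‿inverseˡ _ ; (suc n) → R.-‿inverseˡ _ })
                            , (λ f → pointwise λ { zero → R.-‿inverseʳ _ ; (suc n) → R.-‿inverseʳ _ })
                  ; ⁻¹-cong = λ p → pointwise λ n → R.-‿cong (at p n) }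
                ; comm = λ f g → pointwise λ n → R.+-comm _ _ }
              ; *-cong = λ p q → pointwise (⊛-at-cong (at p) (at q))
              ; *-assoc = λ f g h → pointwise (⊛-assoc f g h)
              ; *-identity = (λ f → pointwise λ n → R.trans (const-⊛ 1# f n) (R.*-identityˡ _))
                           , (λ f → pointwise λ n → R.trans (⊛-comm f (const 1#) n) (R.trans (const-⊛ 1# f n) (R.*-identityˡ _)))
              ; distrib = (λ f g h → pointwise λ n → R.trans (⊛-comm f (g ⊕ h) n) (R.trans (⊛-distribʳ f g h n) (R.+-cong (⊛-comm g f n)
                  (⊛-comm h f n))))
                        , (λ f g h → pointwise (⊛-distribʳ f g h)) }
            ; *-comm = λ f g → pointwise (⊛-comm f g) }

  seriesRing : CommutativeRing 0ℓ 0ℓ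
  seriesRing = record
    { Carrier = Series ; _≈_ = _≋_ ; _+_ = _⊕_ ; _*_ = _⊛_ ; -_ = ⊝_ ; 0# = const 0# ; 1# = const 1#
    ; isCommutativeRing = isRing }

  const-cong : ∀ {c d} → c ≈ᵣ d → const c ≋ const d
  const-cong p = pointwise λ { zero → p ; (suc n) → R.refl }

  const-* : ∀ c d → const (c R.* d) ≋ const c ⊛ const d
  const-* c d = pointwise λ { zero → R.refl ; (suc n) → R.sym (R.trans (const-⊛ c (const d) (suc n)) (R.zeroʳ c)) }

  opaque
    unfolding _⊕_
    const-+ : ∀ c d → const (c R.+ d) ≋ const c ⊕ const d
    const-+ c d = pointwise λ { zero → R.refl ; (suc n) → R.sym (R.+-identityˡ _) }

    const-neg : ∀ c → const (R.- c) ≋ ⊝ const c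
    const-neg c = pointwise λ { zero → R.refl ; (suc n) → R.sym (R.trans (R.sym (R.+-identityˡ _)) (R.-‿inverseʳ _)) }

  const-hom : CommutativeRing.rawRing ℤ-ring -Raw-AlmostCommutative⟶ fromCommutativeRing seriesRing
  const-hom = record
    { ⟦_⟧    = λ z → const I.⟦ z ⟧
    ; +-homo = λ x y → P.trans (const-cong (I.+-homo x y)) (const-+ _ _)
    ; *-homo = λ x y → P.trans (const-cong (I.*-homo x y)) (const-* _ _)
    ; -‿homo = λ x → P.trans (const-cong (I.-‿homo x)) (const-neg _)
    ; 0-homo = const-cong I.0-homo
    ; 1-homo = const-cong I.1-homo }
    where
    module I = _-Raw-AlmostCommutative⟶_ ι
    module P = CommutativeRing seriesRing

  module P = CommutativeRing seriesRing
  open P using (_+_; _*_; -_; _-_)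
  open Solver seriesRing const-hom public
    using (by; _:+_; _:*_; _:-_; :-_; _:^_; con; κ; Polynomial; replace; difference; equal; combine₁; combine₂; combine₃)
  open import Algebra.Properties.Semiring.Exp P.semiring public using (_^_; ^-congˡ; ^-homo-*; ^-assocʳ)
  open import Algebra.Properties.CommutativeSemiring.Exp P.commutativeSemiring public using (^-distrib-*)
  module PR = SetoidReasoning P.setoid

  opaque
    unfolding _⊕_
    head-tail : ∀ f → f ≋ const (f 0) + X * tail f
    head-tail f = pointwise λ
      { zero    → R.sym (R.trans (R.+-congˡ (X-⊛-zero (tail f))) (R.+-identityʳ _))
      ; (suc n) → R.sym (R.trans (R.+-congˡ (X-⊛-suc (tail f) n)) (R.+-identityˡ _)) }

  opaque
    unfolding _⊕_
    tail-* : ∀ f g → tail (f * g) ≋ const (f 0) * tail g + tail f * g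
    tail-* f g = pointwise λ n → R.+-congʳ (R.sym (const-⊛ (f 0) (tail g) n))

  infix 4 _≋_upto_
  -- Congruence modulo qᴺ. Equalities of series are often proved by induction on N, because a factor
  -- q raises the precision by one.
  record _≋_upto_ (f g : Series) (N : ℕ) : Set where
    constructor agree
    field agree-at : ∀ n → n ℕ.< N → f n ≈ᵣ g n
  open _≋_upto_ public

  module _ {N : ℕ} where
    upto-refl : ∀ {f} → f ≋ f upto N
    upto-refl = agree λ _ _ → R.refl
    upto-sym : ∀ {f g} → f ≋ g upto N → g ≋ f upto N
    upto-sym p = agree λ n n<N → R.sym (agree-at p n n<N)
    upto-trans : ∀ {f g h} → f ≋ g upto N → g ≋ h upto N → f ≋ h upto N
    upto-trans p q = agree λ n n<N → R.trans (agree-at p n n<N) (agree-at q n n<N)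
    ≋⇒upto : ∀ {f g} → f ≋ g → f ≋ g upto N
    ≋⇒upto p = agree λ n _ → at p n
    opaque
      unfolding _⊕_
      upto-+ : ∀ {f f′ g g′} → f ≋ f′ upto N → g ≋ g′ upto N → f + g ≋ f′ + g′ upto N
      upto-+ p q = agree λ n n<N → R.+-cong (agree-at p n n<N) (agree-at q n n<N)
      upto-* : ∀ {f f′ g g′} → f ≋ f′ upto N → g ≋ g′ upto N → f * g ≋ f′ * g′ upto N
      upto-* p q = agree λ n n<N → ⊛-upto n (λ i i≤n → agree-at p i (ℕₚ.≤-<-trans i≤n n<N)) (λ i i≤n → agree-at q i (ℕₚ.≤-<-trans i≤n n<N))
      upto-neg : ∀ {f f′} → f ≋ f′ upto N → - f ≋ - f′ upto N
      upto-neg p = agree λ n n<N → R.-‿cong (agree-at p n n<N)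
      upto-^ : ∀ {f f′} k → f ≋ f′ upto N → f ^ k ≋ f′ ^ k upto N
      upto-^ zero    p = upto-refl
      upto-^ (suc k) p = upto-* p (upto-^ k p)

  upto-mono : ∀ {M N f g} → M ℕ.≤ N → f ≋ g upto N → f ≋ g upto M
  upto-mono M≤N p = agree λ n n<M → agree-at p n (ℕₚ.<-≤-trans n<M M≤N)

  upto-all : ∀ {f g} → (∀ N → f ≋ g upto N) → f ≋ g
  upto-all p = pointwise λ n → agree-at (p (suc n)) n ℕₚ.≤-refl

  upto-setoid : ℕ → Setoid 0ℓ 0ℓ
  upto-setoid N = record { Carrier = Series ; _≈_ = _≋_upto N
    ; isEquivalence = record { refl = upto-refl ; sym = upto-sym ; trans = upto-trans } }

  X*-upto : ∀ {N f g} → f ≋ g upto N → X * f ≋ X * g upto suc N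
  X*-upto {f = f} {g} p = agree λ
    { zero    _            → R.trans (X-⊛-zero f) (R.sym (X-⊛-zero g))
    ; (suc n) (ℕ.s≤s n<N) → R.trans (X-⊛-suc f n) (R.trans (agree-at p n n<N) (R.sym (X-⊛-suc g n))) }

  X^*-upto : ∀ k {N f g} → f ≋ g upto N → X ^ k * f ≋ X ^ k * g upto k ℕ.+ N
  X^*-upto zero    p = upto-* upto-refl p
  X^*-upto (suc k) {N} {f} {g} p = upto-trans (≋⇒upto (P.*-assoc X (X ^ k) f))
    (upto-trans (X*-upto (X^*-upto k p)) (≋⇒upto (P.sym (P.*-assoc X (X ^ k) g))))

  X^*-vanish : ∀ k {N} f → N ℕ.≤ k → X ^ k * f ≋ P.0# upto N
  X^*-vanish k f N≤k = upto-mono (ℕₚ.≤-trans N≤k (ℕₚ.m≤m+n k 0))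
    (upto-trans (X^*-upto k {0} {f} {P.0#} (agree λ _ ())) (≋⇒upto (P.zeroʳ _)))

  X^*-at : ∀ k f n → (X ^ k * f) (k ℕ.+ n) ≈ᵣ f n
  X^*-at zero    f n = at (P.*-identityˡ f) n
  X^*-at (suc k) f n = R.trans (at (P.*-assoc X (X ^ k) f) (suc (k ℕ.+ n))) (R.trans (X-⊛-suc (X ^ k * f) (k ℕ.+ n)) (X^*-at k f n))

  -- The diagonal. It is the limit when the k-th series already has its final coefficients up to
  -- index k, which is the hypothesis of `lim-upto`.
  lim : (ℕ → Series) → Series
  lim F n = F n n

  lim-upto : ∀ {F} → (∀ k → F (suc k) ≋ F k upto suc k) → ∀ k → lim F ≋ F k upto suc k
  lim-upto {F} step k = agree λ { n (ℕ.s≤s n≤k) → R.sym (R.trans (reflAt n k (ℕₚ.m≤n⇒∃[o]m+o≡n n≤k)) R.refl) }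
    where
    from : ∀ n d → F (n ℕ.+ d) n ≈ᵣ F n n
    from n zero    = R.reflexive (≡.cong (λ m → F m n) (ℕₚ.+-identityʳ n))
    from n (suc d) = R.trans (R.reflexive (≡.cong (λ m → F m n) (ℕₚ.+-suc n d)))
      (R.trans (agree-at (step (n ℕ.+ d)) n (ℕ.s≤s (ℕₚ.m≤m+n n d))) (from n d))
    reflAt : ∀ n k → (∃ λ o → n ℕ.+ o ≡ k) → F k n ≈ᵣ F n n
    reflAt n k (o , ≡.refl) = from n o

  -- With f = 1 - h and h divisible by q, the partial geometric sums in h converge to the inverse.
  inverse : ∀ f → f 0 ≈ᵣ 1# → ∃ λ g → f * g ≋ P.1#
  inverse f f₀ = lim G , upto-all λ N → upto-mono (ℕₚ.n≤1+n N)
      (upto-trans (upto-* upto-refl (lim-upto step N)) (upto-trans (≋⇒upto (telescope N)) (tail-vanish N)))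
    where
    h = X * - tail f
    G : ℕ → Series
    G zero    = P.1#
    G (suc k) = G k + h ^ suc k
    h^-upto : ∀ k → h ^ k ≋ P.0# upto k
    h^-upto zero    = agree λ _ ()
    h^-upto (suc k) = upto-trans (≋⇒upto (by 3 (λ x t y → (x :* t) :* y , x :* (t :* y)) X (- tail f) (h ^ k)))
      (upto-trans (X*-upto (upto-* upto-refl (h^-upto k))) (≋⇒upto (P.trans (P.*-congˡ (P.zeroʳ _)) (P.zeroʳ _))))
    step : ∀ k → G (suc k) ≋ G k upto suc k
    step k = upto-trans (upto-+ upto-refl (h^-upto (suc k))) (≋⇒upto (P.+-identityʳ _))
    f≋1-h : f ≋ P.1# - h
    f≋1-h = P.trans (head-tail f) (P.+-cong (pointwise λ { zero → f₀ ; (suc n) → R.refl })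
      (by 2 (λ x t → x :* t , :- (x :* :- t)) X (tail f)))
    telescope : ∀ N → f * G N ≋ P.1# - h ^ suc N
    telescope zero    = P.trans (P.*-identityʳ f) (P.trans f≋1-h (P.+-congˡ (P.-‿cong (P.sym (P.*-identityʳ h)))))
    telescope (suc k) = P.trans (P.distribˡ f _ _) (P.trans (P.+-cong (telescope k) (P.*-congʳ f≋1-h))
      (by 3 (λ e h y → (e :- y) :+ (e :- h) :* y , e :- h :* y :+ (e :* y :- y)) P.1# h (h ^ suc k)
       ⟨ P.trans ⟩ P.trans (P.+-congˡ (P.trans (P.+-congʳ (P.*-identityˡ _)) (P.-‿inverseʳ _))) (P.+-identityʳ _)))
    tail-vanish : ∀ N → P.1# - h ^ suc N ≋ P.1# upto suc N
    tail-vanish N = upto-trans (upto-+ upto-refl (upto-neg (h^-upto (suc N))))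
      (≋⇒upto (P.trans (P.+-congˡ -0#≈0#) (P.+-identityʳ _)))
      where open import Algebra.Properties.Ring P.ring using (-0#≈0#)

  -- Non-zero-divisors. Cancelling regular factors avoids Laurent series where a quotient is not
  -- known to be a series.
  Regular : Series → Set
  Regular u = ∀ {f} → u * f ≋ P.0# → f ≋ P.0#

  cancel : ∀ {u} → Regular u → ∀ {f g} → u * f ≋ u * g → f ≋ g
  cancel {u} reg {f} {g} p = begin
    f           ≈⟨ by 2 (λ f g → f , (f :- g) :+ g) f g ⟩
    (f - g) + g ≈⟨ P.+-congʳ (reg (P.trans (by 3 (λ u f g → u :* (f :- g) , u :* f :- u :* g) u f g)
                    (P.trans (P.+-congʳ p) (P.-‿inverseʳ _)))) ⟩
    P.0# + g    ≈⟨ P.+-identityˡ g ⟩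
    g           ∎
    where open PR

  X-regular : Regular X
  X-regular {f} p = pointwise λ n → R.trans (R.sym (X-⊛-suc f n)) (R.trans (at p (suc n)) (R.reflexive (≡.sym (const-0-at n))))

  *-regular : ∀ {u v} → Regular u → Regular v → Regular (u * v)
  *-regular p q r = q (p (P.trans (P.sym (P.*-assoc _ _ _)) r))

  ^-regular : ∀ {u} → Regular u → ∀ k → Regular (u ^ k)
  ^-regular p zero    r = P.trans (P.sym (P.*-identityˡ _)) r
  ^-regular p (suc k) = *-regular p (^-regular p k)

  ≋-regular : ∀ {u v} → u ≋ v → Regular u → Regular v
  ≋-regular p reg r = reg (P.trans (P.*-congʳ p) r)

  head-regular : ∀ u → (∀ {c} → u 0 R.* c ≈ᵣ 0# → c ≈ᵣ 0#) → Regular u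
  head-regular u reg {f} p = pointwise λ { zero → go 0 f p ; (suc n) → go (suc n) f p }
    where
    go : ∀ n f → u * f ≋ P.0# → f n ≈ᵣ 0#
    go zero    f p = reg (at p 0)
    -- The constant term of f vanishes because that of u is regular; hence f = q · tail f, and the
    -- factor q cancels.
    go (suc n) f p = go n (tail f) (X-regular (begin
      X * (u * tail f)                 ≈⟨ by 3 (λ x u t → x :* (u :* t) , u :* (κ 0 :+ x :* t)) X u (tail f) ⟩
      u * (const _ + X * tail f)       ≈⟨ P.*-congˡ (P.+-congʳ (pointwise λ { zero → R.trans (_-Raw-AlmostCommutative⟶_.0-homo ι)
          (R.sym (reg (at p 0))) ; (suc _) → R.refl })) ⟩
      u * (const (f 0) + X * tail f)   ≈⟨ P.*-congˡ (head-tail f) ⟨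
      u * f                            ≈⟨ p ⟩
      P.0# ∎))
      where open PR

-- The substitution q ↦ qᵏ and the 5-dissection

module Operators (R : CommutativeRing 0ℓ 0ℓ)
  (ι : CommutativeRing.rawRing ℤ-ring -Raw-AlmostCommutative⟶ fromCommutativeRing R) where
  private module R = CommutativeRing R
  open R using (Carrier; 0#; 1#) renaming (_≈_ to _≈ᵣ_)
  open Series R ι
  open P using (_+_; _*_; -_; _-_)

  pick : ℕ → Carrier → Carrier
  pick zero    c = c
  pick (suc _) c = 0#

  pick-+ : ∀ n c d → pick n (c R.+ d) ≈ᵣ pick n c R.+ pick n d
  pick-+ zero    c d = R.refl
  pick-+ (suc n) c d = R.sym (R.+-identityʳ _)

  pick-* : ∀ n c d → pick n (c R.* d) ≈ᵣ c R.* pick n d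
  pick-* zero    c d = R.refl
  pick-* (suc n) c d = R.sym (R.zeroʳ _)

  pick-0 : ∀ n → pick n 0# ≈ᵣ 0#
  pick-0 zero    = R.refl
  pick-0 (suc n) = R.refl

  pick-cong : ∀ n {c d} → c ≈ᵣ d → pick n c ≈ᵣ pick n d
  pick-cong zero    p = p
  pick-cong (suc n) p = R.refl

  const≈pick : ∀ c n → const c n ≡ pick n c
  const≈pick c zero    = ≡.refl
  const≈pick c (suc n) = ≡.refl

  opaque
    -- The series f(qᵏ): `pick` keeps the indices divisible by k.
    dilate : (k : ℕ) .{{_ : NonZero k}} → Series → Series
    dilate k f n = pick (n % k) (f (n / k))

    dilate-at : ∀ k .{{_ : NonZero k}} f n → dilate k f n ≡ pick (n % k) (f (n / k))
    dilate-at k f n = ≡.refl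

    -- The terms q^(5n+r), replaced by qⁿ; `section 0` is the operator U.
    section : ℕ → Series → Series
    section r f n = f (n ℕ.* 5 ℕ.+ r)

    section-at : ∀ r f n → section r f n ≡ f (n ℕ.* 5 ℕ.+ r)
    section-at r f n = ≡.refl

  module _ (k : ℕ) .{{_ : NonZero k}} where
    opaque
      unfolding dilate _⊕_
      dilate-cong : ∀ {f g} → f ≋ g → dilate k f ≋ dilate k g
      dilate-cong p = pointwise λ n → pick-cong (n % k) (at p (n / k))

    opaque
      unfolding dilate _⊕_
      dilate-upto : ∀ {N f g} → f ≋ g upto N → dilate k f ≋ dilate k g upto N
      dilate-upto p = agree λ n n<N → pick-cong (n % k) (agree-at p (n / k) (ℕₚ.≤-<-trans (m/n≤m n k) n<N))

    opaque
      unfolding dilate _⊕_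
      dilate-+ : ∀ f g → dilate k (f + g) ≋ dilate k f + dilate k g
      dilate-+ f g = pointwise λ n → pick-+ (n % k) _ _

    opaque
      unfolding dilate _⊕_
      dilate-0 : dilate k P.0# ≋ P.0#
      dilate-0 = pointwise λ n → R.trans (pick-cong (n % k) (R.reflexive (const-0-at (n / k)))) (R.trans (pick-0 (n % k))
          (R.reflexive (≡.sym (const-0-at n))))

    opaque
      unfolding dilate _⊕_
      dilate-scale : ∀ c f → dilate k (const c * f) ≋ const c * dilate k f
      dilate-scale c f = pointwise λ n → R.trans (pick-cong (n % k) (const-⊛ c f (n / k)))
        (R.trans (pick-* (n % k) c _) (R.sym (const-⊛ c (dilate k f) n)))

    opaque
      unfolding dilate _⊕_
      -- This functional equation determines f(qᵏ). Multiplicativity and commutation follow from it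
      -- by induction on the precision, without arithmetic of quotients and remainders.
      dilate-step : ∀ f → dilate k f ≋ const (f 0) + X ^ k * dilate k (tail f)
      dilate-step f = pointwise go
        where
        go : ∀ n → dilate k f n ≈ᵣ (const (f 0) + X ^ k * dilate k (tail f)) n
        go n with n ℕ.<? k
        ... | yes n<k = R.trans (R.reflexive (≡.cong₂ (λ i j → pick i (f j)) (m<n⇒m%n≡m n<k) (m<n⇒m/n≡0 n<k)))
          (R.trans (R.reflexive (≡.sym (const≈pick (f 0) n)))
            (R.sym (R.trans (R.+-congˡ (R.trans (agree-at (X^*-vanish k {k} (dilate k (tail f)) ℕₚ.≤-refl) n n<k)
                (R.reflexive (const-0-at n)))) (R.+-identityʳ _))))
        ... | no n≮k with ℕₚ.m≤n⇒∃[o]m+o≡n (ℕₚ.≮⇒≥ n≮k)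
        ...   | m , ≡.refl = R.trans
          (R.reflexive (≡.cong₂ (λ i j → pick i (f j)) (≡.trans (≡.cong (_% k) (ℕₚ.+-comm k m)) ([m+n]%n≡m%n m k))
             (≡.trans (+-distrib-/-∣ˡ {k} m ∣-refl) (≡.cong (ℕ._+ m / k) (n/n≡1 k)))))
          (R.sym (R.trans (R.+-cong (R.reflexive (const-pos k m)) (X^*-at k (dilate k (tail f)) m)) (R.+-identityˡ _)))
          where
          const-pos : ∀ k .{{_ : NonZero k}} m → const (f 0) (k ℕ.+ m) ≡ 0#
          const-pos (suc k) m = ≡.refl

    dilate-const : ∀ c → dilate k (const c) ≋ const c
    dilate-const c = P.trans (dilate-step (const c)) (P.trans (P.+-congˡ (P.trans (P.*-congˡ
      (P.trans (dilate-cong (pointwise λ { zero → R.refl ; (suc n) → R.refl })) dilate-0)) (P.zeroʳ _))) (P.+-identityʳ _))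

    private
      widen : ∀ {N f g} → f ≋ g upto (k ℕ.+ N) → f ≋ g upto suc N
      widen = upto-mono (ℕₚ.+-monoˡ-≤ _ (ℕ.>-nonZero⁻¹ k))

    dilate-* : ∀ f g → dilate k (f * g) ≋ dilate k f * dilate k g
    dilate-* f g = upto-all λ N → go N f g
      where
      go : ∀ N f g → dilate k (f * g) ≋ dilate k f * dilate k g upto N
      go zero    f g = agree λ _ ()
      go (suc N) f g = begin
        dilate k (f * g)
          ≈⟨ ≋⇒upto (P.trans (dilate-step (f * g)) (P.+-cong (const-* (f 0) (g 0))
              (P.*-congˡ (P.trans (dilate-cong (tail-* f g)) (P.trans (dilate-+ _ _) (P.+-congʳ (dilate-scale (f 0) (tail g)))))))) ⟩
        const (f 0) * const (g 0) + X ^ k * (const (f 0) * dilate k (tail g) + dilate k (tail f * g))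
          ≈⟨ ≋⇒upto (by 5 (λ a b x u v → a :* b :+ x :* (a :* u :+ v) , a :* (b :+ x :* u) :+ x :* v)
              (const (f 0)) (const (g 0)) (X ^ k) (dilate k (tail g)) (dilate k (tail f * g))) ⟩
        const (f 0) * (const (g 0) + X ^ k * dilate k (tail g)) + X ^ k * dilate k (tail f * g)
          ≈⟨ upto-+ (≋⇒upto (P.*-congˡ (P.sym (dilate-step g)))) (widen (X^*-upto k (go N (tail f) g))) ⟩
        const (f 0) * dilate k g + X ^ k * (dilate k (tail f) * dilate k g)
          ≈⟨ ≋⇒upto (by 4 (λ a g x t → a :* g :+ x :* (t :* g) , (a :+ x :* t) :* g)
              (const (f 0)) (dilate k g) (X ^ k) (dilate k (tail f))) ⟩
        (const (f 0) + X ^ k * dilate k (tail f)) * dilate k g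
          ≈⟨ ≋⇒upto (P.*-congʳ (P.sym (dilate-step f))) ⟩
        dilate k f * dilate k g ∎
        where open import Relation.Binary.Reasoning.Setoid (upto-setoid (suc N))

    dilate-^ : ∀ f n → dilate k (f ^ n) ≋ dilate k f ^ n
    dilate-^ f zero    = dilate-const 1#
    dilate-^ f (suc n) = P.trans (dilate-* f (f ^ n)) (P.*-congˡ (dilate-^ f n))

    dilate-X : dilate k X ≋ X ^ k
    dilate-X = P.trans (dilate-step X) (P.trans (P.+-cong (pointwise λ { zero → R.refl ; (suc n) → R.refl })
      (P.*-congˡ (P.trans (dilate-cong (pointwise λ { zero → R.refl ; (suc n) → R.refl })) (dilate-const 1#))))
      (P.trans (P.+-identityˡ _) (P.*-identityʳ _)))

    dilate-neg : ∀ f → dilate k (- f) ≋ - dilate k f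
    dilate-neg f = P.trans (dilate-cong (by 1 (λ f → :- f , con ℤ.-1ℤ :* f) f))
      (P.trans (dilate-scale _ f) (by 1 (λ f → con ℤ.-1ℤ :* f , :- f) (dilate k f)))

    opaque
      unfolding dilate _⊕_
      dilate-injective : ∀ {f g} → dilate k f ≋ dilate k g → f ≋ g
      dilate-injective {f} {g} p = pointwise λ n → R.trans (R.sym (at-multiple f n)) (R.trans (at p (n ℕ.* k)) (at-multiple g n))
        where
        at-multiple : ∀ f n → dilate k f (n ℕ.* k) ≈ᵣ f n
        at-multiple f n = R.reflexive (≡.cong₂ (λ i j → pick i (f j)) (m*n%n≡0 n k) (m*n/n≡m n k))

  dilate-comm : ∀ j k .{{_ : NonZero j}} .{{_ : NonZero k}} f → dilate j (dilate k f) ≋ dilate k (dilate j f)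
  dilate-comm j k f = upto-all λ N → go N f
    where
    step : ∀ j k .{{_ : NonZero j}} .{{_ : NonZero k}} f →
           dilate j (dilate k f) ≋ const (f 0) + X ^ (j ℕ.* k) * dilate j (dilate k (tail f))
    step j k f = P.trans (dilate-cong j (dilate-step k f)) (P.trans (dilate-+ j _ _)
      (P.+-cong (dilate-const j (f 0)) (P.trans (dilate-* j _ _) (P.*-congʳ
        (P.trans (dilate-^ j X k) (P.trans (^-congˡ k (dilate-X j)) (^-assocʳ X j k)))))))
    go : ∀ N f → dilate j (dilate k f) ≋ dilate k (dilate j f) upto N
    go zero    f = agree λ _ ()
    go (suc N) f = begin
      dilate j (dilate k f) ≈⟨ ≋⇒upto (step j k f) ⟩
      const (f 0) + X ^ (j ℕ.* k) * dilate j (dilate k (tail f))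
        ≈⟨ upto-+ upto-refl (upto-mono (ℕₚ.+-monoˡ-≤ N (ℕₚ.*-mono-≤ (ℕ.>-nonZero⁻¹ j) (ℕ.>-nonZero⁻¹ k)))
            (X^*-upto (j ℕ.* k) (go N (tail f)))) ⟩
      const (f 0) + X ^ (j ℕ.* k) * dilate k (dilate j (tail f))
        ≈⟨ ≋⇒upto (P.+-congˡ (P.*-congʳ (P.reflexive (≡.cong (X ^_) (ℕₚ.*-comm j k))))) ⟩
      const (f 0) + X ^ (k ℕ.* j) * dilate k (dilate j (tail f)) ≈⟨ ≋⇒upto (step k j f) ⟨
      dilate k (dilate j f) ∎
      where open import Relation.Binary.Reasoning.Setoid (upto-setoid (suc N))

  opaque
    unfolding section _⊕_
    section-cong : ∀ r {f g} → f ≋ g → section r f ≋ section r g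
    section-cong r p = pointwise λ n → at p (n ℕ.* 5 ℕ.+ r)

  opaque
    unfolding section _⊕_
    section-scale : ∀ r c f → section r (const c * f) ≋ const c * section r f
    section-scale r c f = pointwise λ n → R.trans (const-⊛ c f _) (R.sym (const-⊛ c (section r f) n))

  opaque
    unfolding section _⊕_
    section-0 : ∀ r → section r P.0# ≋ P.0#
    section-0 r = pointwise λ n → R.trans (R.reflexive (const-0-at (n ℕ.* 5 ℕ.+ r))) (R.reflexive (≡.sym (const-0-at n)))

  opaque
    unfolding section _⊕_
    section-+ : ∀ r f g → section r (f + g) ≋ section r f + section r g
    section-+ r f g = pointwise λ n → R.refl

  X^-diag : ∀ k → (X ^ k) k ≈ᵣ 1#
  X^-diag k = R.trans (R.sym (at (P.*-identityʳ (X ^ k)) k))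
    (R.trans (R.reflexive (≡.cong (X ^ k * P.1#) (≡.sym (ℕₚ.+-identityʳ k)))) (X^*-at k P.1# 0))

  X^-off : ∀ k n → n ≢ k → (X ^ k) n ≈ᵣ 0#
  X^-off k n n≢k = R.trans (R.sym (at (P.*-identityʳ (X ^ k)) n)) (go (ℕₚ.<-cmp n k))
    where
    1-off : ∀ o → k ≢ k ℕ.+ o → P.1# o ≈ᵣ 0#
    1-off zero    p = contradiction (≡.sym (ℕₚ.+-identityʳ k)) p
    1-off (suc o) p = R.refl
    go : _ → (X ^ k * P.1#) n ≈ᵣ 0#
    go (tri< n<k _ _) = R.trans (agree-at (X^*-vanish k P.1# ℕₚ.≤-refl) n n<k) (R.reflexive (const-0-at n))
    go (tri≈ _ n≡k _) = contradiction n≡k n≢k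
    go (tri> _ _ k<n) with ℕₚ.m≤n⇒∃[o]m+o≡n (ℕₚ.<⇒≤ k<n)
    ... | o , ≡.refl = R.trans (X^*-at k P.1# o) (1-off o (λ e → n≢k (≡.sym e)))

  module _ (r : ℕ) {r<5 : True (r ℕ.<? 5)} where
    private
      shift : ∀ n → n ℕ.* 5 ℕ.+ r ≡ r → n ≡ 0
      shift zero    _ = ≡.refl
      shift (suc n) p = contradiction (ℕₚ.+-cancelʳ-≡ r (suc n ℕ.* 5) 0 p) λ ()

    opaque
      unfolding section _⊕_
      section-upto : ∀ {N f g} → f ≋ g upto (N ℕ.* 5) → section r f ≋ section r g upto N
      section-upto {N} p = agree λ n n<N → agree-at p _ (ℕₚ.<-≤-trans (ℕₚ.+-monoʳ-< (n ℕ.* 5) (toWitness r<5))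
        (ℕₚ.≤-trans (ℕₚ.≤-reflexive (ℕₚ.+-comm (n ℕ.* 5) 5)) (ℕₚ.*-monoˡ-≤ 5 n<N)))

    opaque
      unfolding section _⊕_
      section-X⁵ : ∀ f → section r (X ^ 5 * f) ≋ X * section r f
      section-X⁵ f = pointwise λ
        { zero    → R.trans (agree-at (X^*-vanish 5 f ℕₚ.≤-refl) r (toWitness r<5)) (R.trans (R.reflexive (const-0-at r))
            (R.sym (X-⊛-zero (section r f))))
        ; (suc n) → R.trans (X^*-at 5 f (n ℕ.* 5 ℕ.+ r)) (R.sym (X-⊛-suc (section r f) n)) }

    -- Linearity over the series in q⁵, on which the later evaluations of U rest.
    section-dilate : ∀ g f → section r (dilate 5 g * f) ≋ g * section r f
    section-dilate g f = upto-all λ N → go N g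
      where
      go : ∀ N g → section r (dilate 5 g * f) ≋ g * section r f upto N
      go zero    g = agree λ _ ()
      go (suc N) g = begin
        section r (dilate 5 g * f)
          ≈⟨ ≋⇒upto (section-cong r (P.trans (P.*-congʳ (dilate-step 5 g))
              (by 4 (λ a x d f → (a :+ x :* d) :* f , a :* f :+ x :* (d :* f)) (const (g 0)) (X ^ 5) (dilate 5 (tail g)) f))) ⟩
        section r (const (g 0) * f + X ^ 5 * (dilate 5 (tail g) * f))
          ≈⟨ ≋⇒upto (P.trans (section-+ r _ _) (P.+-cong (section-scale r (g 0) f) (section-X⁵ _))) ⟩
        const (g 0) * section r f + X * section r (dilate 5 (tail g) * f)
          ≈⟨ upto-+ upto-refl (X*-upto (go N (tail g))) ⟩
        const (g 0) * section r f + X * (tail g * section r f)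
          ≈⟨ ≋⇒upto (by 4 (λ a x d f → a :* f :+ x :* (d :* f) , (a :+ x :* d) :* f) (const (g 0)) X (tail g) (section r f)) ⟩
        (const (g 0) + X * tail g) * section r f
          ≈⟨ ≋⇒upto (P.*-congʳ (P.sym (head-tail g))) ⟩
        g * section r f ∎
        where open import Relation.Binary.Reasoning.Setoid (upto-setoid (suc N))

    opaque
      unfolding section _⊕_
      section-same : ∀ g → section r (X ^ r * dilate 5 g) ≋ g
      section-same g = P.trans (section-cong r (P.*-comm _ _)) (P.trans (section-dilate g (X ^ r))
        (P.trans (P.*-congˡ (pointwise λ { zero → X^-diag r ; (suc n) → X^-off r _ (λ p → contradiction (shift (suc n) p) λ ()) }))
            (P.*-identityʳ g)))

    opaque
      unfolding section _⊕_
      section-other : ∀ t {_ : True (t ℕ.<? 5)} {_ : False (t ℕ.≟ r)} g → section r (X ^ t * dilate 5 g) ≋ P.0#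
      section-other t {t<5} {t≢r} g = P.trans (section-cong r (P.*-comm _ _)) (P.trans (section-dilate g (X ^ t))
        (P.trans (P.*-congˡ (pointwise λ { zero → X^-off t r (λ p → toWitnessFalse t≢r (≡.sym p))
                                          ; (suc n) → X^-off t _ (λ p → ℕₚ.<⇒≢ (ℕₚ.<-≤-trans (toWitness t<5) (ℕₚ.m≤m+n 5 (n ℕ.* 5 ℕ.+ r)))
                                              (≡.sym p)) })) (P.zeroʳ g)))

  opaque
    unfolding section _⊕_
    tail-section : ∀ r f → tail (section r f) ≋ section r (λ n → f (5 ℕ.+ n))
    tail-section r f = pointwise λ n → R.refl

  dissection : ∀ f → f ≋ dilate 5 (section 0 f) + X * dilate 5 (section 1 f) + X ^ 2 * dilate 5 (section 2 f)
                         + X ^ 3 * dilate 5 (section 3 f) + X ^ 4 * dilate 5 (section 4 f)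
  dissection f = upto-all λ N → go N f
    where
    rebuilt : Series → Series
    rebuilt f = dilate 5 (section 0 f) + X * dilate 5 (section 1 f) + X ^ 2 * dilate 5 (section 2 f)
                + X ^ 3 * dilate 5 (section 3 f) + X ^ 4 * dilate 5 (section 4 f)
    tail⁵ : Series → Series
    tail⁵ f n = f (5 ℕ.+ n)
    go : ∀ N f → f ≋ rebuilt f upto N
    go zero    f = agree λ _ ()
    go (suc N) f = begin
      f ≈⟨ ≋⇒upto (P.trans (head-tail f) (P.+-congˡ (P.*-congˡ (P.trans (head-tail (tail f)) (P.+-congˡ (P.*-congˡ
             (P.trans (head-tail _) (P.+-congˡ (P.*-congˡ (P.trans (head-tail _) (P.+-congˡ (P.*-congˡ (head-tail _)))))))))))))  ⟩
      c 0 + X * (c 1 + X * (c 2 + X * (c 3 + X * (c 4 + X * tail⁵ f))))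
        ≈⟨ ≋⇒upto (by 7 (λ x a b c d e t → a :+ x :* (b :+ x :* (c :+ x :* (d :+ x :* (e :+ x :* t)))) ,
              a :+ x :* b :+ x :^ 2 :* c :+ x :^ 3 :* d :+ x :^ 4 :* e :+ x :^ 5 :* t) X (c 0) (c 1) (c 2) (c 3) (c 4) (tail⁵ f)) ⟩
      c 0 + X * c 1 + X ^ 2 * c 2 + X ^ 3 * c 3 + X ^ 4 * c 4 + X ^ 5 * tail⁵ f
        ≈⟨ upto-+ upto-refl (upto-mono (ℕₚ.+-monoˡ-≤ N (ℕ.s≤s {0} {4} ℕ.z≤n)) (X^*-upto 5 (go N (tail⁵ f)))) ⟩
      c 0 + X * c 1 + X ^ 2 * c 2 + X ^ 3 * c 3 + X ^ 4 * c 4 + X ^ 5 * rebuilt (tail⁵ f)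
        ≈⟨ ≋⇒upto (by 11 (λ x a b c d e a′ b′ c′ d′ e′ → a :+ x :* b :+ x :^ 2 :* c :+ x :^ 3 :* d :+ x :^ 4 :* e :+
            x :^ 5 :* (a′ :+ x :* b′ :+ x :^ 2 :* c′ :+ x :^ 3 :* d′ :+ x :^ 4 :* e′) ,
              (a :+ x :^ 5 :* a′) :+ x :* (b :+ x :^ 5 :* b′) :+ x :^ 2 :* (c :+ x :^ 5 :* c′) :+ x :^ 3 :* (d :+ x :^ 5 :* d′) :+
                  x :^ 4 :* (e :+ x :^ 5 :* e′))
              X (c 0) (c 1) (c 2) (c 3) (c 4) (s 0) (s 1) (s 2) (s 3) (s 4)) ⟩
      (c 0 + X ^ 5 * s 0) + X * (c 1 + X ^ 5 * s 1) + X ^ 2 * (c 2 + X ^ 5 * s 2) + X ^ 3 * (c 3 + X ^ 5 * s 3) + X ^ 4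
          * (c 4 + X ^ 5 * s 4)
        ≈⟨ ≋⇒upto (P.+-cong (P.+-cong (P.+-cong (P.+-cong (fold 0) (P.*-congˡ (fold 1))) (P.*-congˡ (fold 2))) (P.*-congˡ (fold 3)))
            (P.*-congˡ (fold 4))) ⟩
      rebuilt f ∎
      where
      open import Relation.Binary.Reasoning.Setoid (upto-setoid (suc N))
      c s : ℕ → Series
      c r = const (f r)
      s r = dilate 5 (section r (tail⁵ f))
      fold : ∀ r → c r + X ^ 5 * s r ≋ dilate 5 (section r f)
      fold r = P.sym (P.trans (dilate-step 5 (section r f)) (P.+-cong (const-cong (R.reflexive (section-at r f 0)))
          (P.*-congˡ (dilate-cong 5 (tail-section r f)))))

-- Quadratic extensions of a commutative ring

module Quadratic (A : CommutativeRing 0ℓ 0ℓ)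
  (ι : CommutativeRing.rawRing ℤ-ring -Raw-AlmostCommutative⟶ fromCommutativeRing A)
  (p q : CommutativeRing.Carrier A) where
  open CommutativeRing A using (Carrier; _+_; _*_; -_; 0#; 1#) renaming (_≈_ to _≈ᴬ_)
  private module A = CommutativeRing A
  private module I = _-Raw-AlmostCommutative⟶_ ι
  open Solver A ι using (by; _:+_; _:*_; :-_; con)

  infix 4 _≈_
  record Element : Set where
    constructor _+x_
    field constant slope : Carrier
  open Element public

  record _≈_ (f g : Element) : Set where
    constructor _,_
    field
      constant≈ : constant f ≈ᴬ constant g
      slope≈    : slope f ≈ᴬ slope g
  open _≈_ public

  -- Arithmetic of A[x] / (x² - p x - q) on pairs.
  _⊕_ _⊗_ : Element → Element → Element
  (a +x b) ⊕ (c +x d) = (a + c) +x (b + d)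
  (a +x b) ⊗ (c +x d) = (a * c + q * (b * d)) +x (a * d + b * c + p * (b * d))

  neg : Element → Element
  neg (a +x b) = (- a) +x (- b)

  embed : Carrier → Element
  embed a = a +x 0#

  root : Element
  root = 0# +x 1#

  isCommutativeRing : IsCommutativeRing _≈_ _⊕_ _⊗_ neg (embed 0#) (embed 1#)
  isCommutativeRing = record
    { isRing = record
      { +-isAbelianGroup = record
        { isGroup = record
          { isMonoid = record
            { isSemigroup = record
              { isMagma = record
                { isEquivalence = record
                  { refl  = A.refl , A.refl
                  ; sym   = λ (r , s) → A.sym r , A.sym s
                  ; trans = λ (r , s) (t , u) → A.trans r t , A.trans s u }
                ; ∙-cong = λ (r , s) (t , u) → A.+-cong r t , A.+-cong s u }
              ; assoc = λ x y z → A.+-assoc _ _ _ , A.+-assoc _ _ _ }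
            ; identity = (λ x → A.+-identityˡ _ , A.+-identityˡ _) , (λ x → A.+-identityʳ _ , A.+-identityʳ _) }
          ; inverse = (λ x → A.-‿inverseˡ _ , A.-‿inverseˡ _) , (λ x → A.-‿inverseʳ _ , A.-‿inverseʳ _)
          ; ⁻¹-cong = λ (r , s) → A.-‿cong r , A.-‿cong s }
        ; comm = λ x y → A.+-comm _ _ , A.+-comm _ _ }
      ; *-cong = λ (r , s) (t , u) → A.+-cong (A.*-cong r t) (A.*-congˡ (A.*-cong s u)) ,
                   A.+-cong (A.+-cong (A.*-cong r u) (A.*-cong s t)) (A.*-congˡ (A.*-cong s u))
      ; *-assoc = λ (a +x b) (c +x d) (e +x f) →
          by 8 (λ p q a b c d e f → (a :* c :+ q :* (b :* d)) :* e :+ q :* ((a :* d :+ b :* c :+ p :* (b :* d)) :* f) ,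
            a :* (c :* e :+ q :* (d :* f)) :+ q :* (b :* (c :* f :+ d :* e :+ p :* (d :* f)))) p q a b c d e f ,
          by 8 (λ p q a b c d e f → let u = a :* c :+ q :* (b :* d); v = a :* d :+ b :* c :+ p :* (b :* d); u′ = c :* e :+ q :* (d :* f); v′ = c :* f :+ d :* e :+ p :* (d :* f) in
            u :* f :+ v :* e :+ p :* (v :* f) , a :* v′ :+ b :* u′ :+ p :* (b :* v′)) p q a b c d e f
      ; *-identity = (λ (a +x b) → A.trans (A.+-cong (A.*-identityˡ _) (A.trans (A.*-congˡ (A.zeroˡ _)) (A.zeroʳ _))) (A.+-identityʳ _) ,
                        A.trans (A.+-cong (A.trans (A.+-cong (A.*-identityˡ _) (A.zeroˡ _)) (A.+-identityʳ _))
                            (A.trans (A.*-congˡ (A.zeroˡ _)) (A.zeroʳ _))) (A.+-identityʳ _))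
                   , (λ (a +x b) → A.trans (A.+-cong (A.*-identityʳ _) (A.trans (A.*-congˡ (A.zeroʳ _)) (A.zeroʳ _))) (A.+-identityʳ _) ,
                        A.trans (A.+-cong (A.trans (A.+-cong (A.zeroʳ _) (A.*-identityʳ _)) (A.+-identityˡ _))
                            (A.trans (A.*-congˡ (A.zeroʳ _)) (A.zeroʳ _))) (A.+-identityʳ _))
      ; distrib = (λ (a +x b) (c +x d) (e +x f) → distr₁ a b c d e f , distr₂ a b c d e f)
                , (λ (a +x b) (c +x d) (e +x f) → distr₃ a b c d e f , distr₄ a b c d e f) }
    ; *-comm = λ (a +x b) (c +x d) →
        by 5 (λ q a b c d → a :* c :+ q :* (b :* d) , c :* a :+ q :* (d :* b)) q a b c d ,
        by 5 (λ p a b c d → a :* d :+ b :* c :+ p :* (b :* d) , c :* b :+ d :* a :+ p :* (d :* b)) p a b c d }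
    where
    distr₁ = λ a b c d e f → by 7 (λ q a b c d e f → a :* (c :+ e) :+ q :* (b :* (d :+ f)) , (a :* c :+ q :* (b :* d)) :+
        (a :* e :+ q :* (b :* f))) q a b c d e f
    distr₂ = λ a b c d e f → by 7 (λ p a b c d e f → a :* (d :+ f) :+ b :* (c :+ e) :+ p :* (b :* (d :+ f)) ,
      (a :* d :+ b :* c :+ p :* (b :* d)) :+ (a :* f :+ b :* e :+ p :* (b :* f))) p a b c d e f
    distr₃ = λ a b c d e f → by 7 (λ q a b c d e f → (c :+ e) :* a :+ q :* ((d :+ f) :* b) , (c :* a :+ q :* (d :* b)) :+
        (e :* a :+ q :* (f :* b))) q a b c d e f
    distr₄ = λ a b c d e f → by 7 (λ p a b c d e f → (c :+ e) :* b :+ (d :+ f) :* a :+ p :* ((d :+ f) :* b) ,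
      (c :* b :+ d :* a :+ p :* (d :* b)) :+ (e :* b :+ f :* a :+ p :* (f :* b))) p a b c d e f

  ring : CommutativeRing 0ℓ 0ℓ
  ring = record { isCommutativeRing = isCommutativeRing }

  hom : CommutativeRing.rawRing ℤ-ring -Raw-AlmostCommutative⟶ fromCommutativeRing ring
  hom = record
    { ⟦_⟧    = λ z → embed I.⟦ z ⟧
    ; +-homo = λ x y → I.+-homo x y , A.sym (A.+-identityʳ _)
    ; *-homo = λ x y → A.trans (I.*-homo x y) (A.sym (A.trans (A.+-congˡ (A.trans (A.*-congˡ (A.zeroʳ _)) (A.zeroʳ _))) (A.+-identityʳ _)))
        ,
                       A.sym (A.trans (A.+-cong (A.trans (A.+-cong (A.zeroʳ _) (A.zeroˡ _)) (A.+-identityʳ _))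
                           (A.trans (A.*-congˡ (A.zeroʳ _)) (A.zeroʳ _))) (A.+-identityʳ _))
    ; -‿homo = λ x → I.-‿homo x , A.sym (A.trans (A.sym (A.+-identityˡ _)) (A.-‿inverseʳ _))
    ; 0-homo = I.0-homo , A.refl
    ; 1-homo = I.1-homo , A.refl }

-- The substitution q ↦ ω q

module Twisting (R : CommutativeRing 0ℓ 0ℓ)
  (ι : CommutativeRing.rawRing ℤ-ring -Raw-AlmostCommutative⟶ fromCommutativeRing R) where
  private module R = CommutativeRing R
  open R using (Carrier; 0#; 1#) renaming (_≈_ to _≈ᵣ_)
  open Series R ι
  open Operators R ι
  open P using (_+_; _*_; -_; _-_)
  open import Algebra.Properties.Semiring.Exp R.semiring using () renaming (_^_ to _^ʳ_; ^-congˡ to ^ʳ-congˡ)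
  private module S = Solver R ι

  opaque
    unfolding _⊕_
    -- The series f(ω q). For ω⁵ = 1 the terms of f with exponents congruent to r modulo 5 are
    -- multiplied by ωʳ.
    twist : Carrier → Series → Series
    twist ω f n = ω ^ʳ n R.* f n

    twist-cong : ∀ {ω ω′ f g} → ω ≈ᵣ ω′ → f ≋ g → twist ω f ≋ twist ω′ g
    twist-cong p q = pointwise λ n → R.*-cong (^ʳ-congˡ n p) (at q n)

    twist-upto : ∀ ω {N f g} → f ≋ g upto N → twist ω f ≋ twist ω g upto N
    twist-upto ω p = agree λ n n<N → R.*-congˡ (agree-at p n n<N)

    twist-+ : ∀ ω f g → twist ω (f + g) ≋ twist ω f + twist ω g
    twist-+ ω f g = pointwise λ n → R.distribˡ _ _ _

    twist-const : ∀ ω c → twist ω (const c) ≋ const c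
    twist-const ω c = pointwise λ { zero → R.*-identityˡ c ; (suc n) → R.zeroʳ _ }

    twist-X : ∀ ω → twist ω X ≋ const ω * X
    twist-X ω = pointwise λ
      { zero          → R.trans (R.zeroʳ _) (R.sym (R.zeroʳ _))
      ; (suc zero)    → R.trans (R.*-congʳ (R.*-identityʳ ω)) (R.sym (const-⊛ ω X 1))
      ; (suc (suc n)) → R.trans (R.zeroʳ _) (R.sym (R.trans (const-⊛ ω X (2 ℕ.+ n)) (R.zeroʳ ω))) }

    twist-* : ∀ ω f g → twist ω (f * g) ≋ twist ω f * twist ω g
    twist-* ω f g = pointwise λ n → go n f g
      where
      go : ∀ n f g → ω ^ʳ n R.* (f * g) n ≈ᵣ (twist ω f * twist ω g) n
      go zero    f g = R.trans (R.*-identityˡ _) (R.sym (R.*-cong (R.*-identityˡ _) (R.*-identityˡ _)))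
      go (suc n) f g = begin
        ω R.* w R.* (f 0 R.* g (suc n) R.+ (tail f * g) n)
          ≈⟨ S.by 5 (λ o w a b r → (o S.:* w) S.:* (a S.:* b S.:+ r) , a S.:* ((o S.:* w) S.:* b) S.:+ o S.:* (w S.:* r)) ω w (f 0)
              (g (suc n)) ((tail f * g) n) ⟩
        f 0 R.* (ω R.* w R.* g (suc n)) R.+ ω R.* (w R.* (tail f * g) n)
          ≈⟨ R.+-cong (R.*-congʳ (R.sym (R.*-identityˡ _))) (R.*-congˡ (go n (tail f) g)) ⟩
        (1# R.* f 0) R.* (ω R.* w R.* g (suc n)) R.+ ω R.* (twist ω (tail f) * twist ω g) n
          ≈⟨ R.+-congˡ (R.sym (R.trans (⊛-at-cong (λ i → R.*-assoc _ _ _) (λ _ → R.refl) n) (scale-⊛ ω (twist ω (tail f)) (twist ω g) n))) ⟩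
        (1# R.* f 0) R.* (ω R.* w R.* g (suc n)) R.+ (tail (twist ω f) * twist ω g) n ∎
        where
        open import Relation.Binary.Reasoning.Setoid R.setoid
        w : Carrier
        w = ω ^ʳ n

  const-^ : ∀ c n → const (c ^ʳ n) ≋ const c ^ n
  const-^ c zero    = P.refl
  const-^ c (suc n) = P.trans (const-* c _) (P.*-congˡ (const-^ c n))

  twist-X^ : ∀ ω k → twist ω (X ^ k) ≋ const ω ^ k * X ^ k
  twist-X^ ω zero    = P.trans (twist-const ω 1#) (P.sym (P.*-identityˡ _))
  twist-X^ ω (suc k) = P.trans (twist-* ω X (X ^ k)) (P.trans (P.*-cong (twist-X ω) (twist-X^ ω k))
    (by 4 (λ w x v y → (w :* x) :* (v :* y) , (w :* v) :* (x :* y)) (const ω) X (const ω ^ k) (X ^ k)))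

  twist-neg : ∀ ω f → twist ω (- f) ≋ - twist ω f
  twist-neg ω f = P.trans (twist-cong R.refl (by 1 (λ f → :- f , con ℤ.-1ℤ :* f) f))
    (P.trans (twist-* ω _ f) (P.trans (P.*-congʳ (twist-const ω _)) (by 1 (λ f → con ℤ.-1ℤ :* f , :- f) (twist ω f))))

  -- Substituting ω q into f(qᵏ) raises ω to the k-th power; for a fifth root of unity this permutes
  -- the primitive roots if k = 2 and removes ω if k = 5.
  twist-dilate : ∀ k .{{_ : NonZero k}} ω f → twist ω (dilate k f) ≋ dilate k (twist (ω ^ʳ k) f)
  twist-dilate k ω f = upto-all λ N → go N f
    where
    head-twist : ∀ ω f → const (f 0) ≋ const (twist ω f 0)
    head-twist ω f = const-cong (eq ω f)
      where
      opaque
        unfolding twist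
        eq : ∀ ω f → f 0 ≈ᵣ twist ω f 0
        eq ω f = R.sym (R.*-identityˡ _)
    tail-twist : ∀ ω f → const ω * twist ω (tail f) ≋ tail (twist ω f)
    tail-twist ω f = pointwise λ n → R.trans (const-⊛ ω _ n) (eq ω f n)
      where
      opaque
        unfolding twist
        eq : ∀ ω f n → ω R.* twist ω (tail f) n ≈ᵣ tail (twist ω f) n
        eq ω f n = R.sym (R.*-assoc _ _ _)
    go : ∀ N f → twist ω (dilate k f) ≋ dilate k (twist (ω ^ʳ k) f) upto N
    go zero    f = agree λ _ ()
    go (suc N) f = begin
      twist ω (dilate k f)
        ≈⟨ ≋⇒upto (P.trans (twist-cong R.refl (dilate-step k f)) (P.trans (twist-+ ω _ _) (P.+-cong (twist-const ω _)
            (P.trans (twist-* ω _ _) (P.*-congʳ (twist-X^ ω k)))))) ⟩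
      const (f 0) + (const ω ^ k * X ^ k) * twist ω (dilate k (tail f))
        ≈⟨ ≋⇒upto (P.+-cong (head-twist (ω ^ʳ k) f) (by 3 (λ w x t → (w :* x) :* t , x :* (w :* t)) (const ω ^ k) (X ^ k)
            (twist ω (dilate k (tail f))))) ⟩
      const (twist (ω ^ʳ k) f 0) + X ^ k * (const ω ^ k * twist ω (dilate k (tail f)))
        ≈⟨ upto-+ upto-refl (upto-mono (ℕₚ.+-monoˡ-≤ N (ℕ.>-nonZero⁻¹ k)) (X^*-upto k (upto-* (≋⇒upto (P.sym (const-^ ω k)))
            (go N (tail f))))) ⟩
      const (twist (ω ^ʳ k) f 0) + X ^ k * (const (ω ^ʳ k) * dilate k (twist (ω ^ʳ k) (tail f)))
        ≈⟨ ≋⇒upto (P.+-congˡ (P.*-congˡ (P.trans (P.sym (dilate-scale k _ _)) (dilate-cong k (tail-twist (ω ^ʳ k) f))))) ⟩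
      const (twist (ω ^ʳ k) f 0) + X ^ k * dilate k (tail (twist (ω ^ʳ k) f))
        ≈⟨ ≋⇒upto (dilate-step k (twist (ω ^ʳ k) f)) ⟨
      dilate k (twist (ω ^ʳ k) f) ∎
      where open import Relation.Binary.Reasoning.Setoid (upto-setoid (suc N))

  twist-1 : ∀ f → twist 1# f ≋ f
  twist-1 f = pointwise (λ n → eq n)
    where
    1^ : ∀ n → 1# ^ʳ n ≈ᵣ 1#
    1^ zero    = R.refl
    1^ (suc n) = R.trans (R.*-identityˡ _) (1^ n)
    opaque
      unfolding twist
      eq : ∀ n → twist 1# f n ≈ᵣ f n
      eq n = R.trans (R.*-congʳ (1^ n)) (R.*-identityˡ _)

-- Products over the fifth roots of unity

module NormForm (R : CommutativeRing 0ℓ 0ℓ)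
  (ι : CommutativeRing.rawRing ℤ-ring -Raw-AlmostCommutative⟶ fromCommutativeRing R) where
  private module R = CommutativeRing R
  open R using (Carrier; 0#; 1#) renaming (_≈_ to _≈ᵣ_)
  open Series R ι
  open Operators R ι
  open Twisting R ι
  open P using (_+_; _*_; -_; _-_)
  private module I = _-Raw-AlmostCommutative⟶_ ι
  open import Algebra.Properties.Semiring.Exp R.semiring using () renaming (_^_ to _^ʳ_)

  -- The image of the integer 1, in the form in which the solver produces it; `one≋1` identifies it
  -- with the unit of the ring.
  one : Series
  one = const I.⟦ + 1 ⟧

  -- ω is a ζ-primitive fifth root of unity and h - ω is its inverse.
  record PrimitiveFifthRoot (ω h : Series) : Set where
    field
      inv : ω * (h - ω) ≋ one
      min : h * h + h ≋ one
  open PrimitiveFifthRoot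

  module _ {ω h : Series} (G : PrimitiveFifthRoot ω h) where
    primitive-conjugate : PrimitiveFifthRoot (h - ω) h
    primitive-conjugate = record { inv = P.trans (by 2 (λ z h → (h :- z) :* (h :- (h :- z)) , z :* (h :- z)) ω h) (inv G) ; min = min G }

    -- The automorphism ω ↦ ω² sends ω + ω⁻¹ to the other root -1 - h of h² + h = 1.
    primitive-square : PrimitiveFifthRoot (ω * ω) (- one - h)
    primitive-square = record
      { inv = combine₂ (by 2 (λ z h → (z :* z) :* (:- κ 1 :- h :- z :* z) ,
                κ 1 :+ (z :^ 2 :+ z :* h :+ h :^ 2 :+ h) :* (z :* (h :- z) :- κ 1) :+ (κ 1 :- z :* h) :* (h :* h :+ h :- κ 1)) ω h) (inv G)
                    (min G)
      ; min = P.trans (by 1 (λ h → (:- κ 1 :- h) :* (:- κ 1 :- h) :+ (:- κ 1 :- h) , h :* h :+ h) h) (min G) }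

    conjugate-square : (h - ω) * (h - ω) ≋ - one - h - ω * ω
    conjugate-square = combine₂ (by 2 (λ z h → (h :- z) :* (h :- z) ,
      (:- κ 1 :- h :- z :* z) :+ (:- κ 2) :* (z :* (h :- z) :- κ 1) :+ κ 1 :* (h :* h :+ h :- κ 1)) ω h) (inv G) (min G)

    fifth : ω ^ 5 ≋ one
    fifth = combine₂ (by 2 (λ z h → z :^ 5 ,
      κ 1 :+ (:- (z :^ 3 :+ z :^ 2 :* h :+ z :* h :^ 2 :- z :+ h :^ 3 :- κ 2 :* h)) :* (z :* (h :- z) :- κ 1)
      :+ (z :* h :^ 2 :- z :* h :- z :- h :+ κ 1) :* (h :* h :+ h :- κ 1)) ω h) (inv G) (min G)

    fourth : ω ^ 4 ≋ h - ω
    fourth = combine₂ (by 2 (λ z h → z :^ 4 , (h :- z) :+ (:- (z :^ 2 :+ z :* h :+ h :^ 2 :- κ 1)) :* (z :* (h :- z) :- κ 1)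
      :+ (z :* h :- z :- κ 1) :* (h :* h :+ h :- κ 1)) ω h) (inv G) (min G)

    third : ω ^ 3 ≋ - one - h - ω * ω
    third = combine₂ (by 2 (λ z h → z :^ 3 , (:- κ 1 :- h :- z :* z) :+ (:- (z :+ h :+ κ 1)) :* (z :* (h :- z) :- κ 1)
      :+ z :* (h :* h :+ h :- κ 1)) ω h) (inv G) (min G)

    linearFactors : ∀ T → (one - T) * (one - ω * T) * (one - (h - ω) * T) * (one - ω * ω * T) * (one - (h - ω) * (h - ω) * T) ≋ one - T ^ 5
    linearFactors T = combine₂ (by 3 (λ t p c → (κ 1 :- t) :* (κ 1 :- p :* t) :* (κ 1 :- (c :- p) :* t) :* (κ 1 :- p :* p :* t) :* (κ
        1 :- (c :- p) :* (c :- p) :* t) ,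
      (κ 1 :- t :^ 5) :+ (:- (t :^ 5 :* p :^ 4 :- κ 2 :* t :^ 5 :* p :^ 3 :* c :+ t :^ 5 :* p :^ 2 :* c :^ 2 :- t :^ 5 :* p :^ 2 :+
          t :^ 5 :* p :* c :+ t :^ 5 :- t :^ 4 :* p :^ 4
        :+ κ 2 :* t :^ 4 :* p :^ 3 :* c :- t :^ 4 :* p :^ 2 :* c :^ 2 :+ t :^ 4 :* p :^ 2 :* c :- t :^ 4 :* p :^ 2 :- t :^ 4 :* p :* c :^ 2
            :+ t :^ 4 :* p :* c :- t :^ 4 :* c :^ 2
        :- t :^ 4 :* c :+ t :^ 4 :- t :^ 3 :* p :^ 2 :* c :+ t :^ 3 :* p :^ 2 :+ t :^ 3 :* p :* c :^ 2 :- t :^ 3 :* p :* c :+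
            t :^ 3 :* c :^ 2 :- t :^ 3 :* c :+ t :^ 2 :* p :^ 2
        :- t :^ 2 :* p :* c :+ κ 2 :* t :^ 2 :* c :- κ 2 :* t)) :* (p :* (c :- p) :- κ 1)
      :+ (t :^ 4 :- t :^ 3 :* c :+ t :^ 2 :* c :- t) :* (c :* c :+ c :- κ 1)) T ω h) (inv G) (min G)

    -- The product is symmetric in ω and ω⁻¹, so only h remains. B and C carry ω and ω³ because they
    -- will hold the exponents congruent to 1 and 3 modulo 5.
    conjugatePair : ∀ A B C → (A + ω * B + ω ^ 3 * C) * (A + (h - ω) * B + (h - ω) ^ 3 * C) ≋ A * A + B * B + C * C + h * (A * B)
        - (one + h) * (A * C + B * C)
    conjugatePair A B C = combine₂ (by 5 (λ a b c z h → (a :+ z :* b :+ z :^ 3 :* c) :* (a :+ (h :- z) :* b :+ (h :- z) :^ 3 :* c) ,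
      (a :* a :+ b :* b :+ c :* c :+ h :* (a :* b) :- (κ 1 :+ h) :* (a :* c :+ b :* c))
      :+ (:- (κ 3 :* a :* c :* h :- b :^ 2 :- κ 2 :* b :* c :* z :^ 2 :+ κ 2 :* b :* c :* z :* h :- b :* c :* h :^ 2 :+
          κ 2 :* b :* c :- c :^ 2 :* z :^ 4 :+ κ 2 :* c :^ 2 :* z :^ 3 :* h
        :- c :^ 2 :* z :^ 2 :* h :^ 2 :+ c :^ 2 :* z :^ 2 :- c :^ 2 :* z :* h :- c :^ 2)) :* (z :* (h :- z) :- κ 1)
      :+ (a :* c :* h :- a :* c :+ b :* c) :* (h :* h :+ h :- κ 1)) A B C ω h) (inv G) (min G)

    -- The two quadratic factors are conjugate under h ↦ -1 - h, so the full product has integer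
    -- coefficients.
    pairProduct : ∀ A B C → (A + B + C) * (A * A + B * B + C * C + h * (A * B) - (one + h) * (A * C + B * C))
        * (A * A + B * B + C * C + (- one - h) * (A * B) - (one + (- one - h)) * (A * C + B * C))
      ≋ A ^ 5 + B ^ 5 + C ^ 5 - const (I.⟦ + 5 ⟧) * (A * B * C ^ 3) + const (I.⟦ + 5 ⟧) * (A * A * B * B * C)
    pairProduct A B C = combine₁ (by 4 (λ a b c h → (a :+ b :+ c) :* (a :* a :+ b :* b :+ c :* c :+ h :* (a :* b) :- (κ 1 :+ h) :* (a :* c
        :+ b :* c))
        :* (a :* a :+ b :* b :+ c :* c :+ (:- κ 1 :- h) :* (a :* b) :- (κ 1 :+ (:- κ 1 :- h)) :* (a :* c :+ b :* c)) ,
      (a :^ 5 :+ b :^ 5 :+ c :^ 5 :- κ 5 :* (a :* b :* c :^ 3) :+ κ 5 :* (a :* a :* b :* b :* c))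
      :+ (:- (a :^ 3 :* b :^ 2) :+ κ 2 :* a :^ 3 :* b :* c :- a :^ 3 :* c :^ 2 :- a :^ 2 :* b :^ 3 :+
          κ 3 :* a :^ 2 :* b :^ 2 :* c :- a :^ 2 :* b :* c :^ 2 :- a :^ 2 :* c :^ 3
        :+ κ 2 :* a :* b :^ 3 :* c :- a :* b :^ 2 :* c :^ 2 :- κ 2 :* a :* b :* c :^ 3 :- b :^ 3 :* c :^ 2 :- b :^ 2 :* c :^ 3) :* (h :* h
            :+ h :- κ 1)) A B C h) (min G)

  const-injective : ∀ {c d} → const c ≋ const d → c ≈ᵣ d
  const-injective p = at p 0

  one≋1 : one ≋ P.1#
  one≋1 = const-cong I.1-homo

  1-X^ : ℕ → Series
  1-X^ k = P.1# - X ^ k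

  pochhammer : ℕ → Series
  pochhammer zero    = P.1#
  pochhammer (suc n) = pochhammer n * 1-X^ (suc n)

  dilate-1-X^ : ∀ n → dilate 5 (1-X^ n) ≋ P.1# - (X ^ n) ^ 5
  dilate-1-X^ n = P.trans (dilate-+ 5 _ _) (P.+-cong (dilate-const 5 _) (P.trans (dilate-neg 5 _) (P.-‿cong
    (P.trans (dilate-^ 5 X n) (P.trans (^-congˡ n (dilate-X 5)) (P.trans (^-assocʳ X 5 n)
        (P.trans (P.reflexive (≡.cong (X ^_) (ℕₚ.*-comm 5 n))) (P.sym (^-assocʳ X n 5)))))))))

  module FifthRoot (z g : Carrier) (z-inverse : z R.* (g R.- z) ≈ᵣ 1#) (g-minimal : g R.* g R.+ g ≈ᵣ 1#) where
    private
      ζ γ : Series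
      ζ = const z
      γ = const g
      z̄ : Carrier
      z̄ = g R.- z

    ζ̄-eq : const z̄ ≋ γ - ζ
    ζ̄-eq = P.trans (const-+ g (R.- z)) (P.+-congˡ (const-neg z))

    ζ-primitive : PrimitiveFifthRoot ζ γ
    ζ-primitive = record
      { inv = P.trans (P.*-congˡ (P.sym ζ̄-eq)) (P.trans (P.sym (const-* z z̄)) (P.trans (const-cong z-inverse) (P.sym one≋1)))
      ; min = P.trans (P.+-congʳ (P.sym (const-* g g))) (P.trans (P.sym (const-+ _ _)) (P.trans (const-cong g-minimal) (P.sym one≋1))) }

    ζ̄-primitive : PrimitiveFifthRoot (γ - ζ) γ
    ζ̄-primitive = primitive-conjugate ζ-primitive

    -- The product of f(ω q) over all fifth roots of unity; z̄ is z⁻¹ and z̄² stands for z³.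
    norm : Series → Series
    norm f = f * twist z f * twist z̄ f * twist (z R.* z) f * twist (z̄ R.* z̄) f

    norm-cong : ∀ {f h} → f ≋ h → norm f ≋ norm h
    norm-cong p = P.*-cong (P.*-cong (P.*-cong (P.*-cong p (t p)) (t p)) (t p)) (t p)
      where
      t : ∀ {ω f h} → f ≋ h → twist ω f ≋ twist ω h
      t = twist-cong R.refl

    norm-upto : ∀ {N f h} → f ≋ h upto N → norm f ≋ norm h upto N
    norm-upto p = upto-* (upto-* (upto-* (upto-* p (twist-upto _ p)) (twist-upto _ p)) (twist-upto _ p)) (twist-upto _ p)

    norm-* : ∀ f h → norm (f * h) ≋ norm f * norm h
    norm-* f h = P.trans (P.*-cong (P.*-cong (P.*-cong (P.*-congˡ (twist-* z f h)) (twist-* z̄ f h)) (twist-* _ f h)) (twist-* _ f h))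
      (by 10 (λ a b c d e a′ b′ c′ d′ e′ → (a :* a′) :* (b :* b′) :* (c :* c′) :* (d :* d′) :* (e :* e′) ,
          (a :* b :* c :* d :* e) :* (a′ :* b′ :* c′ :* d′ :* e′))
        f (twist z f) (twist z̄ f) (twist _ f) (twist _ f) h (twist z h) (twist z̄ h) (twist _ h) (twist _ h))

    norm-1 : norm P.1# ≋ P.1#
    norm-1 = P.trans (P.*-cong (P.*-cong (P.*-cong (P.*-congˡ (twist-const z _)) (twist-const z̄ _)) (twist-const _ _)) (twist-const _ _))
      (P.trans (P.*-identityʳ _) (P.trans (P.*-identityʳ _) (P.trans (P.*-identityʳ _) (P.*-identityʳ _))))

    private
      square-const : ∀ ω → const (ω R.* ω) ≋ const ω * const ω
      square-const ω = const-* ω ω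

      zz² : (z R.* z) ^ʳ 2 ≈ᵣ z̄
      zz² = const-injective (P.trans (const-^ (z R.* z) 2) (P.trans (^-congˡ 2 (square-const z))
        (P.trans (by 1 (λ z → (z :* z) :^ 2 , z :^ 4) ζ) (P.trans (fourth ζ-primitive) (P.sym ζ̄-eq)))))

      z̄z̄² : (z̄ R.* z̄) ^ʳ 2 ≈ᵣ z
      z̄z̄² = const-injective (P.trans (const-^ (z̄ R.* z̄) 2) (P.trans (^-congˡ 2 (P.trans (square-const z̄) (P.*-cong ζ̄-eq ζ̄-eq)))
        (P.trans (by 1 (λ z → (z :* z) :^ 2 , z :^ 4) (γ - ζ)) (P.trans (fourth ζ̄-primitive)
          (by 2 (λ z g → g :- (g :- z) , z) ζ γ)))))

      z^5 : ∀ {ω h} → PrimitiveFifthRoot (const ω) h → ω ^ʳ 5 ≈ᵣ 1#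
      z^5 {ω} G = const-injective (P.trans (const-^ ω 5) (P.trans (fifth G) one≋1))

      primitive-resp : ∀ {ω ω′ h} → ω ≋ ω′ → PrimitiveFifthRoot ω h → PrimitiveFifthRoot ω′ h
      primitive-resp p G = record { inv = P.trans (P.*-cong (P.sym p) (P.+-congˡ (P.-‿cong (P.sym p)))) (PrimitiveFifthRoot.inv G) ; min =
          PrimitiveFifthRoot.min G }

      primitive-zz : PrimitiveFifthRoot (const (z R.* z)) (- one - γ)
      primitive-zz = primitive-resp (P.sym (square-const z)) (primitive-square ζ-primitive)

      primitive-z̄ : PrimitiveFifthRoot (const z̄) γ
      primitive-z̄ = primitive-resp (P.sym ζ̄-eq) ζ̄-primitive

      primitive-z̄z̄ : PrimitiveFifthRoot (const (z̄ R.* z̄)) (- one - γ)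
      primitive-z̄z̄ = primitive-resp (P.sym (P.trans (square-const z̄) (P.*-cong ζ̄-eq ζ̄-eq))) (primitive-square ζ̄-primitive)

    -- Squaring permutes the fifth roots of unity: z, z̄, z², z̄² go to z², z̄², z̄, z.
    norm-dilate₂ : ∀ f → norm (dilate 2 f) ≋ dilate 2 (norm f)
    norm-dilate₂ f = begin
      norm (dilate 2 f)
        ≈⟨ P.*-cong (P.*-cong (P.*-cong (P.*-congˡ (tw z (R.*-congˡ (R.*-identityʳ z)))) (tw z̄ (R.*-congˡ (R.*-identityʳ z̄))))
            (tw (z R.* z) zz²)) (tw (z̄ R.* z̄) z̄z̄²) ⟩
      d f * d (twist (z R.* z) f) * d (twist (z̄ R.* z̄) f) * d (twist z̄ f) * d (twist z f)
        ≈⟨ by 5 (λ a b c e f → a :* b :* c :* e :* f , a :* f :* e :* b :* c) (d f) (d (twist (z R.* z) f)) (d (twist (z̄ R.* z̄) f))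
            (d (twist z̄ f)) (d (twist z f)) ⟩
      d f * d (twist z f) * d (twist z̄ f) * d (twist (z R.* z) f) * d (twist (z̄ R.* z̄) f)
        ≈⟨ P.sym (P.trans (dilate-* 2 _ _)
            (P.*-congʳ (P.trans (dilate-* 2 _ _) (P.*-congʳ (P.trans (dilate-* 2 _ _) (P.*-congʳ (dilate-* 2 _ _))))))) ⟩
      d (norm f) ∎
      where
      open PR
      d : Series → Series
      d = dilate 2
      tw : ∀ ω {ω′} → ω ^ʳ 2 ≈ᵣ ω′ → twist ω (d f) ≋ d (twist ω′ f)
      tw ω p = P.trans (twist-dilate 2 ω f) (dilate-cong 2 (twist-cong p P.refl))

    private
      twist-1-X^ : ∀ ω k → twist ω (1-X^ k) ≋ P.1# - const ω ^ k * X ^ k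
      twist-1-X^ ω k = P.trans (twist-+ ω _ _) (P.+-cong (twist-const ω _) (P.trans (twist-neg ω _) (P.-‿cong (twist-X^ ω k))))

      norm-1-X^ : ∀ k {p q} → ζ ^ k ≋ p → (γ - ζ) ^ k ≋ q → norm (1-X^ k) ≋ (P.1# - X ^ k) * (P.1# - p * X ^ k) * (P.1# - q * X ^ k)
          * (P.1# - p * p * X ^ k) * (P.1# - q * q * X ^ k)
      norm-1-X^ k {p} {q} ep eq = P.*-cong (P.*-cong (P.*-cong (P.*-congˡ (t z ep)) (t z̄ e̅q)) (t (z R.* z) (sq z ep)))
          (t (z̄ R.* z̄) (sq z̄ e̅q))
        where
        e̅q : const z̄ ^ k ≋ q
        e̅q = P.trans (^-congˡ k ζ̄-eq) eq
        t : ∀ ω {p} → const ω ^ k ≋ p → twist ω (1-X^ k) ≋ P.1# - p * X ^ k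
        t ω e = P.trans (twist-1-X^ ω k) (P.+-congˡ (P.-‿cong (P.*-congʳ e)))
        sq : ∀ ω {p} → const ω ^ k ≋ p → const (ω R.* ω) ^ k ≋ p * p
        sq ω e = P.trans (^-congˡ k (square-const ω)) (P.trans (^-distrib-* (const ω) (const ω) k) (P.*-cong e e))

      residue : ∀ {ω h} → PrimitiveFifthRoot ω h → ∀ r n → ω ^ (r ℕ.+ n ℕ.* 5) ≋ ω ^ r
      residue {ω} G r n = P.trans (^-homo-* ω r (n ℕ.* 5)) (P.trans (P.*-congˡ (go n)) (P.*-identityʳ _))
        where
        go : ∀ n → ω ^ (n ℕ.* 5) ≋ P.1#
        go zero    = P.refl
        go (suc n) = P.trans (^-homo-* ω 5 (n ℕ.* 5)) (P.trans (P.*-cong (P.trans (fifth G) one≋1) (go n)) (P.*-identityʳ _))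

      -- If 5 does not divide k, the k-th power permutes the roots of unity. With p = ζᵏ the five
      -- factors are those of 1 - T⁵ for the root p at T = qᵏ.
      coprime : ∀ k {p q c} → PrimitiveFifthRoot p c → q ≋ c - p → ζ ^ k ≋ p → (γ - ζ) ^ k ≋ q → norm (1-X^ k) ≋ dilate 5 (1-X^ k)
      coprime k {p} {q} {c} G e ep eq = P.trans (norm-1-X^ k ep (P.trans eq e)) (P.trans
        (P.*-cong (P.*-cong (P.*-cong (P.*-cong o o) o) o) o)
        (P.trans (linearFactors G (X ^ k)) (P.trans (P.+-congʳ one≋1) (P.sym (dilate-1-X^ k)))))
        where
        o : ∀ {x} → P.1# - x ≋ one - x
        o = P.+-congʳ (P.sym one≋1)

      norm₁ : ∀ n → norm (1-X^ (1 ℕ.+ n ℕ.* 5)) ≋ dilate 5 (1-X^ (1 ℕ.+ n ℕ.* 5))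
      norm₁ n = coprime (1 ℕ.+ n ℕ.* 5) ζ-primitive P.refl (P.trans (residue ζ-primitive 1 n) (P.*-identityʳ _))
          (P.trans (residue ζ̄-primitive 1 n) (P.*-identityʳ _))

      norm₂ : ∀ n → norm (1-X^ (2 ℕ.+ n ℕ.* 5)) ≋ dilate 5 (1-X^ (2 ℕ.+ n ℕ.* 5))
      norm₂ n = coprime (2 ℕ.+ n ℕ.* 5) (primitive-square ζ-primitive) (conjugate-square ζ-primitive)
        (P.trans (residue ζ-primitive 2 n) (P.*-congˡ (P.*-identityʳ _))) (P.trans (residue ζ̄-primitive 2 n) (P.*-congˡ (P.*-identityʳ _)))

      norm₃ : ∀ n → norm (1-X^ (3 ℕ.+ n ℕ.* 5)) ≋ dilate 5 (1-X^ (3 ℕ.+ n ℕ.* 5))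
      norm₃ n = coprime (3 ℕ.+ n ℕ.* 5) (primitive-conjugate (primitive-square ζ-primitive))
          (P.+-congˡ (P.-‿cong (conjugate-square ζ-primitive)))
        (P.trans (residue ζ-primitive 3 n) (third ζ-primitive)) (P.trans (residue ζ̄-primitive 3 n) (third ζ̄-primitive))

      norm₄ : ∀ n → norm (1-X^ (4 ℕ.+ n ℕ.* 5)) ≋ dilate 5 (1-X^ (4 ℕ.+ n ℕ.* 5))
      norm₄ n = coprime (4 ℕ.+ n ℕ.* 5) ζ̄-primitive P.refl (P.trans (residue ζ-primitive 4 n) (fourth ζ-primitive))
          (P.trans (residue ζ̄-primitive 4 n) (fourth ζ̄-primitive))

      1-X^-*5 : ∀ n → 1-X^ (n ℕ.* 5) ≋ dilate 5 (1-X^ n)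
      1-X^-*5 n = P.trans (P.+-congˡ (P.-‿cong (P.sym (^-assocʳ X n 5)))) (P.sym (dilate-1-X^ n))

      -- Every twist fixes q^(5n), so the five factors coincide.
      norm₅ : ∀ n → norm (1-X^ (n ℕ.* 5)) ≋ dilate 5 (1-X^ n) ^ 5
      norm₅ n = P.trans (norm-1-X^ (n ℕ.* 5) (residue ζ-primitive 0 n) (residue ζ̄-primitive 0 n))
        (P.trans (P.*-cong (P.*-cong (P.*-cong (P.*-cong (1-X^-*5 n) u) u) v) v) (by 1 (λ x → x :* x :* x :* x :* x , x :^ 5)
            (dilate 5 (1-X^ n))))
        where
        u : P.1# - P.1# * X ^ (n ℕ.* 5) ≋ dilate 5 (1-X^ n)
        u = P.trans (P.+-congˡ (P.-‿cong (P.*-identityˡ _))) (1-X^-*5 n)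
        v : P.1# - P.1# * P.1# * X ^ (n ℕ.* 5) ≋ dilate 5 (1-X^ n)
        v = P.trans (P.+-congˡ (P.-‿cong (P.trans (P.*-congʳ (P.*-identityˡ _)) (P.*-identityˡ _)))) (1-X^-*5 n)

    -- The truncated form of norm η = η(q⁵)⁶ / η(q²⁵). In a block of five factors, four indices are
    -- prime to 5 and give factors of η(q⁵); the last gives a fifth power, and the factor of η(q²⁵)
    -- on the left supplies the fifth factor that η(q⁵) still lacks.
    norm-pochhammer : ∀ n → norm (pochhammer (n ℕ.* 5)) * dilate 5 (dilate 5 (pochhammer n)) ≋ dilate 5 (pochhammer (n ℕ.* 5)) * dilate 5
        (pochhammer n) ^ 5
    norm-pochhammer zero    = P.trans (P.*-cong norm-1 (P.trans (dilate-cong 5 (dilate-const 5 _)) (dilate-const 5 _)))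
        (P.sym (P.trans (P.*-cong (dilate-const 5 _) (P.trans (^-congˡ 5 (dilate-const 5 _))
      (P.trans (P.*-identityˡ _) (P.trans (P.*-identityˡ _) (P.trans (P.*-identityˡ _) (P.trans (P.*-identityˡ _) (P.*-identityˡ _)))))))
          P.refl))
    norm-pochhammer (suc n) = begin
      norm (p * f₁ * f₂ * f₃ * f₄ * f₅) * dilate 5 (dilate 5 (pochhammer n * 1-X^ (suc n)))
        ≈⟨ P.*-cong
            (P.trans (norm-* _ _) (P.*-cong
                (P.trans (norm-* _ _) (P.*-cong (P.trans (norm-* _ _) (P.*-cong (P.trans (norm-* _ _) (P.*-cong (P.trans (norm-* _ _)
              (P.*-congˡ (norm₁ n))) (norm₂ n))) (norm₃ n))) (norm₄ n))) (norm₅ (suc n))))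
            (P.trans (dilate-cong 5 (dilate-* 5 _ _)) (dilate-* 5 _ _)) ⟩
      norm p * d f₁ * d f₂ * d f₃ * d f₄ * d e ^ 5 * (d (d (pochhammer n)) * d (d e))
        ≈⟨ P.trans (by 8 (λ p a b c h e q r → p :* a :* b :* c :* h :* e :^ 5 :* (q :* r) , (p :* q) :* (a :* b :* c :* h) :* (r :* e :^ 5))
             (norm p) (d f₁) (d f₂) (d f₃) (d f₄) (d e) (d (d (pochhammer n))) (d (d e))) (P.*-congʳ (P.*-congʳ (norm-pochhammer n))) ⟩
      (d p * d (pochhammer n) ^ 5) * (d f₁ * d f₂ * d f₃ * d f₄) * (d (d e) * d e ^ 5)
        ≈⟨ P.trans (P.*-congˡ (P.*-congʳ (dilate-cong 5 (P.sym (1-X^-*5 (suc n))))))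
           (by 8 (λ p a b c h k q e → (p :* q :^ 5) :* (a :* b :* c :* h) :* (k :* e :^ 5) , p :* a :* b :* c :* h :* k :* (q :* e) :^ 5)
             (d p) (d f₁) (d f₂) (d f₃) (d f₄) (d f₅) (d (pochhammer n)) (d e)) ⟩
      d p * d f₁ * d f₂ * d f₃ * d f₄ * d f₅ * (d (pochhammer n) * d e) ^ 5
        ≈⟨ P.sym (P.*-cong
             (P.trans (dilate-* 5 _ _) (P.*-congʳ (P.trans (dilate-* 5 _ _)
                 (P.*-congʳ (P.trans (dilate-* 5 _ _) (P.*-congʳ (P.trans (dilate-* 5 _ _) (P.*-congʳ (dilate-* 5 _ _)))))))))
             (^-congˡ 5 (dilate-* 5 _ _))) ⟩
      dilate 5 (pochhammer (suc n ℕ.* 5)) * dilate 5 (pochhammer (suc n)) ^ 5 ∎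
      where
      open PR
      d : Series → Series
      d = dilate 5
      p = pochhammer (n ℕ.* 5)
      e = 1-X^ (suc n)
      f₁ = 1-X^ (1 ℕ.+ n ℕ.* 5)
      f₂ = 1-X^ (2 ℕ.+ n ℕ.* 5)
      f₃ = 1-X^ (3 ℕ.+ n ℕ.* 5)
      f₄ = 1-X^ (4 ℕ.+ n ℕ.* 5)
      f₅ = 1-X^ (5 ℕ.+ n ℕ.* 5)

    -- Series in q⁵ are fixed by the twists, so f(ω q) only puts ω before the class 1 and ω³ before
    -- the class 3.
    norm-classes : ∀ a b c → let A = dilate 5 a; B = X * dilate 5 b; C = X ^ 3 * dilate 5 c in
      norm (A + B + C) ≋ A ^ 5 + B ^ 5 + C ^ 5 - const (I.⟦ + 5 ⟧) * (A * B * C ^ 3) + const (I.⟦ + 5 ⟧) * (A * A * B * B * C)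
    norm-classes a b c = begin
      norm (A + B + C)
        ≈⟨ P.*-cong (P.*-cong (P.*-cong (P.*-congˡ (tw ζ-primitive)) (tw primitive-z̄)) (tw primitive-zz)) (tw primitive-z̄z̄) ⟩
      (A + B + C) * T ζ * T (const z̄) * T (const (z R.* z)) * T (const (z̄ R.* z̄))
        ≈⟨ P.*-cong (P.*-cong (P.*-congˡ (Tc ζ̄-eq)) (Tc (square-const z)))
            (Tc (P.trans (square-const z̄) (P.trans (P.*-cong ζ̄-eq ζ̄-eq) (conjugate-square ζ-primitive)))) ⟩
      (A + B + C) * T ζ * T (γ - ζ) * T (ζ * ζ) * T (- one - γ - ζ * ζ)
        ≈⟨ by 5 (λ a b c d e → a :* b :* c :* d :* e , a :* (b :* c) :* (d :* e)) (A + B + C) (T ζ) (T (γ - ζ)) (T (ζ * ζ))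
            (T (- one - γ - ζ * ζ)) ⟩
      (A + B + C) * (T ζ * T (γ - ζ)) * (T (ζ * ζ) * T (- one - γ - ζ * ζ))
        ≈⟨ P.*-cong (P.*-congˡ (conjugatePair ζ-primitive A B C)) (conjugatePair (primitive-square ζ-primitive) A B C) ⟩
      _ ≈⟨ pairProduct ζ-primitive A B C ⟩
      A ^ 5 + B ^ 5 + C ^ 5 - const (I.⟦ + 5 ⟧) * (A * B * C ^ 3) + const (I.⟦ + 5 ⟧) * (A * A * B * B * C) ∎
      where
      open PR
      A B C : Series
      A = dilate 5 a
      B = X * dilate 5 b
      C = X ^ 3 * dilate 5 c
      T : Series → Series
      T ω = A + ω * B + ω ^ 3 * C
      Tc : ∀ {ω ω′} → ω ≋ ω′ → T ω ≋ T ω′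
      Tc p = P.+-cong (P.+-congˡ (P.*-congʳ p)) (P.*-congʳ (^-congˡ 3 p))
      td : ∀ {ω h} → PrimitiveFifthRoot (const ω) h → ∀ f → twist ω (dilate 5 f) ≋ dilate 5 f
      td G f = P.trans (twist-dilate 5 _ f) (dilate-cong 5 (P.trans (twist-cong (z^5 G) P.refl) (twist-1 f)))
      tw : ∀ {ω h} → PrimitiveFifthRoot (const ω) h → twist ω (A + B + C) ≋ T (const ω)
      tw {ω} G = P.trans (twist-+ ω _ _) (P.+-cong (P.trans (twist-+ ω _ _) (P.+-cong (td G a)
          (P.trans (twist-* ω _ _) (P.trans (P.*-cong (twist-X ω) (td G b)) (P.*-assoc _ _ _)))))
          (P.trans (twist-* ω _ _) (P.trans (P.*-cong (twist-X^ ω 3) (td G c)) (P.*-assoc _ _ _))))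

-- Euler's product and the pentagonal number theorem

module ProductsAndEuler where
  ℤ-id : CommutativeRing.rawRing ℤ-ring -Raw-AlmostCommutative⟶ fromCommutativeRing ℤ-ring
  ℤ-id = -raw-almostCommutative⟶ (fromCommutativeRing ℤ-ring)

  open Series ℤ-ring ℤ-id public
  open Operators ℤ-ring ℤ-id public
  open P using (_+_; _*_; -_; _-_)

  1-X^_ : ℕ → Series
  1-X^ k = P.1# - X ^ k

  sum< : (ℕ → Series) → ℕ → Series
  sum< f zero    = P.0#
  sum< f (suc n) = sum< f n + f n

  prod< : (ℕ → Series) → ℕ → Series
  prod< w zero    = P.1#
  prod< w (suc n) = prod< w n * w n

  prodFrom : (ℕ → Series) → ℕ → ℕ → Series
  prodFrom w t zero    = P.1#
  prodFrom w t (suc d) = w t * prodFrom w (suc t) d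

  -- w t * ... * w (n - 1)
  prodBetween : (ℕ → Series) → ℕ → ℕ → Series
  prodBetween w t n = prodFrom w t (n ∸ t)

  module _ (w : ℕ → Series) where
    prodFrom-last : ∀ t d → prodFrom w t (suc d) ≋ prodFrom w t d * w (t ℕ.+ d)
    prodFrom-last t zero    = P.trans (P.*-comm _ _) (P.*-congˡ (P.reflexive (≡.cong w (≡.sym (ℕₚ.+-identityʳ t)))))
    prodFrom-last t (suc d) = P.trans (P.*-congˡ (P.trans (prodFrom-last (suc t) d)
        (P.*-congˡ (P.reflexive (≡.cong w (≡.sym (ℕₚ.+-suc t d)))))))
      (P.sym (P.*-assoc _ _ _))

    prodBetween-first : ∀ {t n} → t ℕ.< n → prodBetween w t n ≋ w t * prodBetween w (suc t) n
    prodBetween-first {t} {n} t<n = P.reflexive (≡.cong (prodFrom w t) (≡.sym (ℕₚ.suc-pred (n ∸ t) {{ℕ.>-nonZero (ℕₚ.m<n⇒0<n∸m t<n)}}))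
      ⟨ ≡.trans ⟩ ≡.cong (λ d → w t * prodFrom w (suc t) d) (ℕₚ.pred[m∸n]≡m∸[1+n] n t))
      where open import Function using (_⟨_⟩_)

    prodBetween-last : ∀ {t n} → t ℕ.≤ n → prodBetween w t (suc n) ≋ prodBetween w t n * w n
    prodBetween-last {t} {n} t≤n = P.trans (P.reflexive (≡.cong (prodFrom w t) (ℕₚ.+-∸-assoc 1 t≤n)))
      (P.trans (prodFrom-last t (n ∸ t)) (P.*-congˡ (P.reflexive (≡.cong w (ℕₚ.m+[n∸m]≡n t≤n)))))

    prodBetween-empty : ∀ n → prodBetween w n n ≋ P.1#
    prodBetween-empty n = P.reflexive (≡.cong (prodFrom w n) (ℕₚ.n∸n≡0 n))

    prodBetween-0 : ∀ n → prodBetween w 0 n ≋ prod< w n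
    prodBetween-0 zero    = P.refl
    prodBetween-0 (suc n) = P.trans (prodBetween-last {0} {n} ℕ.z≤n) (P.*-congʳ (prodBetween-0 n))

  X^-cong : ∀ {m n} → m ≡ n → X ^ m ≋ X ^ n
  X^-cong p = P.reflexive (≡.cong (X ^_) p)

  X^-vanish : ∀ k {N} → N ℕ.≤ k → X ^ k ≋ P.0# upto N
  X^-vanish k N≤k = upto-trans (≋⇒upto (P.sym (P.*-identityʳ _))) (X^*-vanish k P.1# N≤k)

  sum<-vanish : ∀ f n {N} → (∀ i → i ℕ.< n → f (suc i) ≋ P.0# upto N) → sum< f (suc n) ≋ f 0 upto N
  sum<-vanish f zero    p = ≋⇒upto (P.+-identityˡ _)
  sum<-vanish f (suc n) p = upto-trans (upto-+ (sum<-vanish f n (λ i i<n → p i (ℕₚ.m≤n⇒m≤1+n i<n))) (p n ℕₚ.≤-refl))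
      (≋⇒upto (P.+-identityʳ _))

  pochhammer : ℕ → Series
  pochhammer = prod< (λ i → 1-X^ (suc i))

  pochhammer-step : ∀ k → pochhammer (suc k) ≋ pochhammer k upto suc k
  pochhammer-step k = upto-trans (upto-* upto-refl (upto-+ upto-refl (upto-neg (X^-vanish (suc k) ℕₚ.≤-refl))))
    (≋⇒upto (P.trans (P.*-congˡ (by 0 (κ 1 :- κ 0 , κ 1))) (P.*-identityʳ _)))

  opaque
    η : Series
    η = lim pochhammer

    η-upto : ∀ k → η ≋ pochhammer k upto suc k
    η-upto = lim-upto pochhammer-step

  triangle : ℕ → ℕ
  triangle zero    = 0
  triangle (suc n) = triangle n ℕ.+ suc n

  module Euler where
    σ : Series
    σ = - P.1#

    Q : ℕ → ℕ → Series
    Q = prodBetween (λ i → 1-X^ (suc i))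

    -- A summand of Shanks's finite form of the pentagonal number theorem; `Q s n` is the quotient
    -- of (1 - q)...(1 - qⁿ) by (1 - q)...(1 - qˢ).
    term : ℕ → ℕ → Series
    term n s = σ ^ s * Q s n * X ^ (n ℕ.* s ℕ.+ triangle s)

    -- Passing from n to n + 1 changes a partial sum by a single boundary term, by induction on the
    -- number of summands.
    telescoping : ∀ n t → t ℕ.≤ n →
      sum< (term (suc n)) (suc t) ≋ sum< (term n) (suc t) - σ ^ t * Q t n * X ^ (suc n ℕ.* suc t ℕ.+ triangle t)
    telescoping n zero _ = begin
      P.0# + P.1# * Q 0 (suc n) * X ^ (n ℕ.* 0 ℕ.+ 0)
        ≈⟨ P.+-congˡ (P.*-congʳ (P.*-congˡ (prodBetween-last _ {0} {n} ℕ.z≤n))) ⟩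
      P.0# + P.1# * (Q 0 n * (P.1# - X ^ suc n)) * X ^ (n ℕ.* 0 ℕ.+ 0)
        ≈⟨ P.+-congˡ (P.*-congˡ z) ⟩
      P.0# + P.1# * (Q 0 n * (P.1# - X ^ suc n)) * P.1#
        ≈⟨ by 2 (λ q x → κ 0 :+ κ 1 :* (q :* (κ 1 :- x)) :* κ 1 , κ 0 :+ κ 1 :* q :* κ 1 :- κ 1 :* q :* x) (Q 0 n) (X ^ suc n) ⟩
      P.0# + P.1# * Q 0 n * P.1# - P.1# * Q 0 n * X ^ suc n
        ≈⟨ P.+-cong (P.+-congˡ (P.*-congˡ (P.sym z))) (P.-‿cong (P.*-congˡ (X^-cong (e n)))) ⟩
      P.0# + P.1# * Q 0 n * X ^ (n ℕ.* 0 ℕ.+ 0) - P.1# * Q 0 n * X ^ (suc n ℕ.* 1 ℕ.+ 0) ∎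
      where
      open PR
      z : X ^ (n ℕ.* 0 ℕ.+ 0) ≋ P.1#
      z = X^-cong (≡.trans (ℕₚ.+-identityʳ _) (ℕₚ.*-zeroʳ n))
      e : ∀ n → suc n ≡ suc n ℕ.* 1 ℕ.+ 0
      e n = ≡.sym (≡.trans (ℕₚ.+-identityʳ _) (ℕₚ.*-identityʳ (suc n)))
    telescoping n (suc t) t<n = begin
      sum< (term (suc n)) (suc t) + σ * σ ^ t * Q (suc t) (suc n) * X ^ (suc n ℕ.* suc t ℕ.+ triangle (suc t))
        ≈⟨ P.+-cong (P.trans (telescoping n t (ℕₚ.<⇒≤ t<n)) (P.+-congˡ (P.-‿cong (P.*-cong (P.*-congˡ (prodBetween-first _ t<n))
            (X^-cong (e₁ n t (triangle t)))))))
                    (P.*-cong (P.*-congˡ (prodBetween-last _ t<n)) (P.trans (X^-cong (e₂ n t (triangle t))) (^-homo-* X e (suc t)))) ⟩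
      sum< (term n) (suc t) - σ ^ t * ((P.1# - X ^ suc t) * Q (suc t) n) * X ^ e
        + σ * σ ^ t * (Q (suc t) n * (P.1# - X ^ suc n)) * (X ^ e * X ^ suc t)
        ≈⟨ by 6 (λ s g q y z v → s :- g :* ((κ 1 :- z) :* q) :* y :+ (:- κ 1) :* g :* (q :* (κ 1 :- v)) :* (y :* z) ,
             s :+ (:- κ 1) :* g :* q :* y :- (:- κ 1) :* g :* q :* (v :* (y :* z)))
             (sum< (term n) (suc t)) (σ ^ t) (Q (suc t) n) (X ^ e) (X ^ suc t) (X ^ suc n) ⟩
      sum< (term n) (suc t) + σ * σ ^ t * Q (suc t) n * X ^ e - σ * σ ^ t * Q (suc t) n * (X ^ suc n * (X ^ e * X ^ suc t))
        ≈⟨ P.+-congˡ (P.-‿cong (P.*-congˡ (P.trans (P.trans (P.*-congˡ (P.sym (^-homo-* X e (suc t))))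
            (P.sym (^-homo-* X (suc n) (e ℕ.+ suc t)))) (X^-cong (e₃ n t (triangle t)))))) ⟩
      sum< (term n) (suc (suc t)) - σ * σ ^ t * Q (suc t) n * X ^ (suc n ℕ.* suc (suc t) ℕ.+ triangle (suc t)) ∎
      where
      open PR
      e = n ℕ.* suc t ℕ.+ triangle (suc t)
      e₁ : ∀ n t T → suc n ℕ.* suc t ℕ.+ T ≡ n ℕ.* suc t ℕ.+ (T ℕ.+ suc t)
      e₁ = solve-∀
      e₂ : ∀ n t T → suc n ℕ.* suc t ℕ.+ (T ℕ.+ suc t) ≡ n ℕ.* suc t ℕ.+ (T ℕ.+ suc t) ℕ.+ suc t
      e₂ = solve-∀
      e₃ : ∀ n t T → suc n ℕ.+ (n ℕ.* suc t ℕ.+ (T ℕ.+ suc t) ℕ.+ suc t) ≡ suc n ℕ.* suc (suc t) ℕ.+ (T ℕ.+ suc t)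
      e₃ = solve-∀

    -- s (3 s - 1) / 2 and s (3 s + 1) / 2 for s = n + 1
    pent₁ pent₂ : ℕ → ℕ
    pent₁ n = suc n ℕ.* suc n ℕ.+ triangle n
    pent₂ n = suc n ℕ.* suc n ℕ.+ triangle (suc n)

    pentagonalSum : ℕ → Series
    pentagonalSum zero    = P.1#
    pentagonalSum (suc n) = pentagonalSum n + σ ^ suc n * (X ^ pent₁ n + X ^ pent₂ n)

    -- At t = n the boundary term and the new summand s = n + 1 are the two pentagonal terms that
    -- are added in this step.
    sum-term : ∀ n → sum< (term n) (suc n) ≋ pentagonalSum n
    sum-term zero    = by 0 (κ 0 :+ κ 1 :* κ 1 :* κ 1 , κ 1)
    sum-term (suc n) = begin
      sum< (term (suc n)) (suc n) + σ ^ suc n * Q (suc n) (suc n) * X ^ pent₂ n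
        ≈⟨ P.+-cong (telescoping n n ℕₚ.≤-refl) (P.*-congʳ (P.trans (P.*-congˡ (prodBetween-empty _ (suc n))) (P.*-identityʳ _))) ⟩
      sum< (term n) (suc n) - σ ^ n * Q n n * X ^ pent₁ n + σ ^ suc n * X ^ pent₂ n
        ≈⟨ P.+-congʳ (P.+-cong (sum-term n) (P.-‿cong (P.*-congʳ (P.trans (P.*-congˡ (prodBetween-empty _ n)) (P.*-identityʳ _))))) ⟩
      pentagonalSum n - σ ^ n * X ^ pent₁ n + σ ^ suc n * X ^ pent₂ n
        ≈⟨ by 4 (λ p s x y → p :- s :* x :+ (:- κ 1) :* s :* y , p :+ (:- κ 1) :* s :* (x :+ y))
             (pentagonalSum n) (σ ^ n) (X ^ pent₁ n) (X ^ pent₂ n) ⟩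
      pentagonalSum (suc n) ∎
      where open PR

    -- Modulo q^(n+1) only the summand s = 0 of the finite form survives, and it is the product (1 -
    -- q)...(1 - qⁿ).
    euler : ∀ n → η ≋ pentagonalSum n upto suc n
    euler n = upto-trans (η-upto n) (upto-trans (upto-sym poch) (≋⇒upto (sum-term n)))
      where
      big : ∀ n i → suc n ℕ.≤ n ℕ.* suc i ℕ.+ (triangle i ℕ.+ suc i)
      big n i = ≡.subst (suc n ℕ.≤_) (e n i (triangle i)) (ℕₚ.m≤m+n (suc n) _)
        where
        e : ∀ n i T → suc n ℕ.+ (n ℕ.* i ℕ.+ T ℕ.+ i) ≡ n ℕ.* suc i ℕ.+ (T ℕ.+ suc i)
        e = solve-∀
      poch : sum< (term n) (suc n) ≋ pochhammer n upto suc n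
      poch = upto-trans (sum<-vanish (term n) n (λ i _ → upto-trans (upto-* upto-refl (X^-vanish _ (big n i))) (≋⇒upto (P.zeroʳ _))))
        (≋⇒upto (P.trans (P.*-cong (P.trans (P.*-identityˡ _) (prodBetween-0 _ n)) (X^-cong (≡.trans (ℕₚ.+-identityʳ _) (ℕₚ.*-zeroʳ n))))
            (P.*-identityʳ _)))

-- Gauss's product for the triangular series ψ

module TriangularSeries where
  open ProductsAndEuler
  open P using (_+_; _*_; -_; _-_)

  triangle≥ : ∀ n → n ℕ.≤ triangle n
  triangle≥ zero    = ℕ.z≤n
  triangle≥ (suc n) = ℕₚ.m≤n+m (suc n) (triangle n)

  triangle-double : ∀ n → triangle (2 ℕ.* n) ≡ n ℕ.* (2 ℕ.* n ℕ.+ 1)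
  triangle-double zero    = ≡.refl
  triangle-double (suc n) = ≡.trans (≡.cong triangle (e₀ n)) (≡.trans (≡.cong (λ t → t ℕ.+ suc (2 ℕ.* n) ℕ.+ suc (suc (2 ℕ.* n)))
      (triangle-double n)) (e₁ n))
    where
    e₀ : ∀ n → 2 ℕ.* suc n ≡ suc (suc (2 ℕ.* n))
    e₀ = solve-∀
    e₁ : ∀ n → n ℕ.* (2 ℕ.* n ℕ.+ 1) ℕ.+ suc (2 ℕ.* n) ℕ.+ suc (suc (2 ℕ.* n)) ≡ suc n ℕ.* (2 ℕ.* suc n ℕ.+ 1)
    e₁ = solve-∀

  triangularSum : ℕ → Series
  triangularSum = sum< (λ k → X ^ triangle k)

  opaque
    ψ : Series
    ψ = lim (λ n → triangularSum (suc n))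

    ψ-upto : ∀ k → ψ ≋ triangularSum k upto k
    ψ-upto k = upto-trans (upto-mono (ℕₚ.n≤1+n k) (lim-upto step k)) (upto-trans (upto-+ upto-refl (X^-vanish _ (triangle≥ k)))
        (≋⇒upto (P.+-identityʳ _)))
      where
      step : ∀ k → triangularSum (suc (suc k)) ≋ triangularSum (suc k) upto suc k
      step k = upto-trans (upto-+ upto-refl (X^-vanish _ (triangle≥ (suc k)))) (≋⇒upto (P.+-identityʳ _))

  module Gauss where
    inverse-1-X^ : ∀ n → ∃ λ g → (1-X^ (suc n)) * g ≋ P.1#
    inverse-1-X^ n = inverse (1-X^ (suc n))
        (≡.trans (⊕-at _ _ 0) (≡.cong (ℤ._+_ (+ 1)) (≡.trans (⊝-at _ 0) (≡.cong ℤ.-_ (X-⊛-zero (X ^ n))))))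

    v : ℕ → Series
    v n = proj₁ (inverse-1-X^ (2 ℕ.* n))

    -- The factor (1 - q^(2n+2)) / (1 - q^(2n+1)) of Gauss's product.
    w : ℕ → Series
    w n = (1-X^ (2 ℕ.* suc n)) * v n

    w-spec : ∀ n → w n * (1-X^ (suc (2 ℕ.* n))) ≋ 1-X^ (2 ℕ.* suc n)
    w-spec n = P.trans (by 3 (λ a v b → (a :* v) :* b , a :* (b :* v)) (1-X^ (2 ℕ.* suc n)) (v n) (1-X^ (suc (2 ℕ.* n))))
      (P.trans (P.*-congˡ (proj₂ (inverse-1-X^ (2 ℕ.* n)))) (P.*-identityʳ _))

    R : ℕ → ℕ → Series
    R = prodBetween w

    -- Shanks's companion sum for Gauss's identity, built from quotients of the partial products of
    -- `w`.
    term : ℕ → ℕ → Series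
    term n s = R s n * X ^ (s ℕ.* suc (2 ℕ.* n))

    telescoping : ∀ n t → t ℕ.≤ n →
      sum< (term (suc n)) (suc t) ≋ sum< (term n) (suc t) + R t n * (v n * (X ^ (suc t ℕ.* suc (2 ℕ.* n)) * (1-X^ (suc (2 ℕ.* t)))))
    telescoping n zero _ = begin
      P.0# + R 0 (suc n) * P.1#
        ≈⟨ P.+-congˡ (P.*-congʳ (prodBetween-last w {0} {n} ℕ.z≤n)) ⟩
      P.0# + R 0 n * ((P.1# - X ^ (2 ℕ.* suc n)) * v n) * P.1#
        ≈⟨ P.+-congˡ (P.*-congʳ (P.*-congˡ (P.*-congʳ (P.+-congˡ (P.-‿cong (X^-cong (e n))))))) ⟩
      P.0# + R 0 n * ((P.1# - X * X ^ suc (2 ℕ.* n)) * v n) * P.1#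
        ≈⟨ by 4 (λ q v x y → κ 0 :+ q :* ((κ 1 :- x :* y) :* v) :* κ 1 ,
                κ 0 :+ q :* ((κ 1 :- y) :* v) :+ q :* (v :* (y :* (κ 1 :- x :* κ 1)))) (R 0 n) (v n) X (X ^ suc (2 ℕ.* n)) ⟩
      P.0# + R 0 n * ((P.1# - X ^ suc (2 ℕ.* n)) * v n) + R 0 n * (v n * (X ^ suc (2 ℕ.* n) * (1-X^ 1)))
        ≈⟨ P.+-cong (P.+-congˡ (P.*-congˡ (proj₂ (inverse-1-X^ (2 ℕ.* n)))))
            (P.*-congˡ (P.*-congˡ (P.*-congʳ (X^-cong {suc (2 ℕ.* n)} (≡.sym (ℕₚ.+-identityʳ _)))))) ⟩
      P.0# + R 0 n * P.1# + R 0 n * (v n * (X ^ (1 ℕ.* suc (2 ℕ.* n)) * (1-X^ 1))) ∎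
      where
      open PR
      e : ∀ n → 2 ℕ.* suc n ≡ suc (suc (2 ℕ.* n))
      e = solve-∀
    telescoping n (suc t) t<n = begin
      sum< (term (suc n)) (suc t) + R (suc t) (suc n) * X ^ (suc t ℕ.* suc (2 ℕ.* suc n))
        ≈⟨ P.+-cong (telescoping n t (ℕₚ.<⇒≤ t<n)) (P.*-cong (prodBetween-last w t<n) (P.trans (X^-cong (e₁ n t))
            (^-homo-* X e (2 ℕ.* suc t)))) ⟩
      sum< (term n) (suc t) + R t n * (v n * (X ^ e * (1-X^ (suc (2 ℕ.* t))))) + R (suc t) n * ((P.1# - X ^ (2 ℕ.* suc n)) * v n)
          * (X ^ e * X ^ (2 ℕ.* suc t))
        ≈⟨ P.+-cong (P.+-congˡ (P.trans (P.*-congʳ (prodBetween-first w t<n))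
             (P.trans (by 5 (λ w r v x y → (w :* r) :* (v :* (x :* y)) , r :* (v :* (x :* (w :* y)))) (w t) (R (suc t) n) (v n) (X ^ e)
                 (1-X^ (suc (2 ℕ.* t))))
               (P.*-congˡ (P.*-congˡ (P.*-congˡ (w-spec t)))))))
             (P.*-congʳ (P.*-congˡ (P.*-congʳ (P.+-congˡ (P.-‿cong (X^-cong (e₂ n))))))) ⟩
      sum< (term n) (suc t) + R (suc t) n * (v n * (X ^ e * (P.1# - X ^ (2 ℕ.* suc t)))) + R (suc t) n * ((P.1# - X * X ^ suc (2 ℕ.* n)) * v
          n) * (X ^ e * X ^ (2 ℕ.* suc t))
        ≈⟨ by 7 (λ s r v y z x w → s :+ r :* (v :* (y :* (κ 1 :- z))) :+ r :* ((κ 1 :- x :* w) :* v) :* (y :* z) ,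
              s :+ r :* y :* ((κ 1 :- w) :* v) :+ r :* (v :* ((w :* y) :* (κ 1 :- x :* z))))
              (sum< (term n) (suc t)) (R (suc t) n) (v n) (X ^ e) (X ^ (2 ℕ.* suc t)) X (X ^ suc (2 ℕ.* n)) ⟩
      sum< (term n) (suc t) + R (suc t) n * X ^ e * ((P.1# - X ^ suc (2 ℕ.* n)) * v n) + R (suc t) n
          * (v n * ((X ^ suc (2 ℕ.* n) * X ^ e) * (P.1# - X * X ^ (2 ℕ.* suc t))))
        ≈⟨ P.+-cong (P.+-congˡ (P.trans (P.*-congˡ (proj₂ (inverse-1-X^ (2 ℕ.* n)))) (P.*-identityʳ _)))
            (P.*-congˡ (P.*-congˡ (P.*-congʳ (P.sym (^-homo-* X (suc (2 ℕ.* n)) e))))) ⟩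
      sum< (term n) (suc (suc t)) + R (suc t) n * (v n * (X ^ (suc (suc t) ℕ.* suc (2 ℕ.* n)) * (1-X^ (suc (2 ℕ.* suc t))))) ∎
      where
      open PR
      e = suc t ℕ.* suc (2 ℕ.* n)
      e₁ : ∀ n t → suc t ℕ.* suc (2 ℕ.* suc n) ≡ suc t ℕ.* suc (2 ℕ.* n) ℕ.+ 2 ℕ.* suc t
      e₁ = solve-∀
      e₂ : ∀ n → 2 ℕ.* suc n ≡ suc (suc (2 ℕ.* n))
      e₂ = solve-∀

    -- The step to n + 1 adds the summand s = n and the boundary term, whose exponents are the
    -- triangular numbers of index 2n and 2n + 1.
    sum-term : ∀ n → sum< (term n) n ≋ triangularSum (2 ℕ.* n)
    sum-term zero    = P.refl
    sum-term (suc n) = begin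
      sum< (term (suc n)) (suc n) ≈⟨ telescoping n n ℕₚ.≤-refl ⟩
      sum< (term n) n + R n n * X ^ (n ℕ.* suc (2 ℕ.* n)) + R n n * (v n * (X ^ (suc n ℕ.* suc (2 ℕ.* n)) * (1-X^ (suc (2 ℕ.* n)))))
        ≈⟨ P.+-cong (P.+-cong (sum-term n) (P.trans (P.*-congʳ (prodBetween-empty w n)) (P.*-identityˡ _)))
             (P.trans (P.*-congʳ (prodBetween-empty w n)) (P.trans (P.*-identityˡ _)
             (by 3 (λ v x y → v :* (x :* y) , x :* (y :* v)) (v n) (X ^ (suc n ℕ.* suc (2 ℕ.* n))) (1-X^ (suc (2 ℕ.* n)))))) ⟩
      triangularSum (2 ℕ.* n) + X ^ (n ℕ.* suc (2 ℕ.* n)) + X ^ (suc n ℕ.* suc (2 ℕ.* n)) * ((1-X^ (suc (2 ℕ.* n))) * v n)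
        ≈⟨ P.+-cong (P.+-congˡ (X^-cong (≡.sym (≡.trans (triangle-double n) (e₁ n))))) (P.trans (P.*-congˡ (proj₂ (inverse-1-X^ (2 ℕ.* n))))
            (P.trans (P.*-identityʳ _)
             (X^-cong (≡.trans (e₂ n) (≡.cong (ℕ._+ suc (2 ℕ.* n)) (≡.sym (triangle-double n))))))) ⟩
      triangularSum (suc (suc (2 ℕ.* n)))
        ≈⟨ P.reflexive (≡.cong triangularSum (e₃ n)) ⟩
      triangularSum (2 ℕ.* suc n) ∎
      where
      open PR
      e₁ : ∀ n → n ℕ.* (2 ℕ.* n ℕ.+ 1) ≡ n ℕ.* suc (2 ℕ.* n)
      e₁ = solve-∀
      e₂ : ∀ n → suc n ℕ.* suc (2 ℕ.* n) ≡ n ℕ.* (2 ℕ.* n ℕ.+ 1) ℕ.+ suc (2 ℕ.* n)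
      e₂ = solve-∀
      e₃ : ∀ n → suc (suc (2 ℕ.* n)) ≡ 2 ℕ.* suc n
      e₃ = solve-∀

    product-upto : ∀ n → prod< w n ≋ ψ upto n
    product-upto zero    = agree λ _ ()
    product-upto (suc n) = upto-trans (upto-sym small)
      (upto-trans (≋⇒upto (sum-term (suc n))) (upto-sym (upto-mono (ℕₚ.m≤m+n (suc n) _) (ψ-upto (2 ℕ.* suc n)))))
      where
      big : ∀ i → suc n ℕ.≤ suc i ℕ.* suc (2 ℕ.* suc n)
      big i = ℕₚ.≤-trans (ℕₚ.≤-trans (ℕₚ.m≤m+n (suc n) _) (ℕₚ.n≤1+n _)) (ℕₚ.m≤m+n _ _)
      small : sum< (term (suc n)) (suc n) ≋ prod< w (suc n) upto suc n
      small = upto-trans (sum<-vanish (term (suc n)) n (λ i _ → upto-trans (upto-* upto-refl (X^-vanish _ (big i))) (≋⇒upto (P.zeroʳ _))))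
        (≋⇒upto (P.trans (P.*-identityʳ _) (prodBetween-0 w (suc n))))

    even odd : ℕ → Series
    even = prod< (λ i → 1-X^ (2 ℕ.* suc i))
    odd  = prod< (λ i → 1-X^ (suc (2 ℕ.* i)))

    w-odd : ∀ n → prod< w n * odd n ≋ even n
    w-odd zero    = P.*-identityˡ _
    w-odd (suc n) = P.trans (by 4 (λ a b c d → (a :* b) :* (c :* d) , (a :* c) :* (b :* d)) (prod< w n) (w n) (odd n)
        (1-X^ (suc (2 ℕ.* n))))
      (P.*-cong (w-odd n) (w-spec n))

    pochhammer-double : ∀ n → pochhammer (2 ℕ.* n) ≋ odd n * even n
    pochhammer-double zero    = P.sym (P.*-identityˡ _)
    pochhammer-double (suc n) = P.trans (P.reflexive (≡.cong pochhammer (e₁ n))) (P.trans (P.*-cong (P.*-congʳ (pochhammer-double n))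
        (P.+-congˡ (P.-‿cong (X^-cong (≡.sym (e₁ n))))))
      (by 4 (λ o e a b → ((o :* e) :* a) :* b , (o :* a) :* (e :* b)) (odd n) (even n) (1-X^ (suc (2 ℕ.* n))) (1-X^ (2 ℕ.* suc n))))
      where
      e₁ : ∀ n → 2 ℕ.* suc n ≡ suc (suc (2 ℕ.* n))
      e₁ = solve-∀

    dilate-1-X^ : ∀ n → dilate 2 (1-X^ n) ≋ 1-X^ (2 ℕ.* n)
    dilate-1-X^ n = P.trans (dilate-+ 2 _ _) (P.+-cong (dilate-const 2 _) (P.trans (dilate-neg 2 _) (P.-‿cong
      (P.trans (dilate-^ 2 X n) (P.trans (^-congˡ n (dilate-X 2)) (^-assocʳ X 2 n))))))

    even-dilate : ∀ n → even n ≋ dilate 2 (pochhammer n)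
    even-dilate zero    = P.sym (dilate-const 2 _)
    even-dilate (suc n) = P.trans (P.*-cong (even-dilate n) (P.sym (dilate-1-X^ (suc n)))) (P.sym (dilate-* 2 _ _))

    gauss : ψ * η ≋ dilate 2 η * dilate 2 η
    gauss = upto-all λ n → begin
      ψ * η                     ≈⟨ upto-* (upto-sym (product-upto n)) (upto-mono (ℕₚ.m≤n⇒m≤1+n (ℕₚ.m≤m+n n _)) (η-upto (2 ℕ.* n))) ⟩
      prod< w n * pochhammer (2 ℕ.* n) ≈⟨ ≋⇒upto (P.trans (P.*-congˡ (pochhammer-double n)) (P.trans (P.sym (P.*-assoc _ _ _))
          (P.*-congʳ (w-odd n)))) ⟩
      even n * even n           ≈⟨ ≋⇒upto (P.*-cong (even-dilate n) (even-dilate n)) ⟩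
      dilate 2 (pochhammer n) * dilate 2 (pochhammer n)
        ≈⟨ upto-* (dil n) (dil n) ⟩
      dilate 2 η * dilate 2 η ∎
      where
      import Relation.Binary.Reasoning.Setoid as SR
      open module Reason {n} = SR (upto-setoid n)
      dil : ∀ n → dilate 2 (pochhammer n) ≋ dilate 2 η upto n
      dil n = dilate-upto 2 (upto-mono (ℕₚ.n≤1+n n) (upto-sym (η-upto n)))

-- Exponents of ψ and η modulo 5

module Dissections where
  open ProductsAndEuler
  open TriangularSeries
  open P using (_+_; _*_; -_; _-_)

  dilate-X^ : ∀ k → dilate 5 (X ^ k) ≋ X ^ (5 ℕ.* k)
  dilate-X^ k = P.trans (dilate-^ 5 X k) (P.trans (^-congˡ k (dilate-X 5)) (^-assocʳ X 5 k))

  -- The quotient is kept as data because it is the exponent left after taking the section.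
  record Residue (t e : ℕ) : Set where
    constructor residueOf
    field
      quotient : ℕ
      equation : e ≡ t ℕ.+ 5 ℕ.* quotient
  open Residue

  module _ {t e : ℕ} {t<5 : True (t ℕ.<? 5)} (p : Residue t e) where
    private
      split : X ^ e ≋ X ^ t * dilate 5 (X ^ quotient p)
      split = P.trans (X^-cong (equation p)) (P.trans (^-homo-* X t _) (P.*-congˡ (P.sym (dilate-X^ (quotient p)))))

    section-X^ : section t (X ^ e) ≋ X ^ quotient p
    section-X^ = P.trans (section-cong t split) (section-same t {t<5} _)

    section-X^-other : ∀ {r} {_ : True (r ℕ.<? 5)} {_ : False (t ℕ.≟ r)} → section r (X ^ e) ≋ P.0#
    section-X^-other {r} {r<5} {t≢r} = P.trans (section-cong r split) (section-other r {r<5} t {t<5} {t≢r} _)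

  infixl 6 _⊹_
  _⊹_ : ∀ {t t′ e e′} → Residue t e → Residue t′ e′ → Residue (t ℕ.+ t′) (e ℕ.+ e′)
  _⊹_ {t} {t′} (residueOf k ≡.refl) (residueOf l ≡.refl) = residueOf (k ℕ.+ l) (shuffle t t′ k l)
    where
    shuffle : ∀ t t′ k l → t ℕ.+ 5 ℕ.* k ℕ.+ (t′ ℕ.+ 5 ℕ.* l) ≡ t ℕ.+ t′ ℕ.+ 5 ℕ.* (k ℕ.+ l)
    shuffle = solve-∀

  reduce : ∀ t j {e} → Residue (t ℕ.+ 5 ℕ.* j) e → Residue t e
  reduce t j (residueOf k ≡.refl) = residueOf (j ℕ.+ k) (shuffle t j k)
    where
    shuffle : ∀ t j k → t ℕ.+ 5 ℕ.* j ℕ.+ 5 ℕ.* k ≡ t ℕ.+ 5 ℕ.* (j ℕ.+ k)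
    shuffle = solve-∀

  residue : ∀ c n → Residue c (c ℕ.+ n ℕ.* 5)
  residue c n = residueOf n (≡.cong (c ℕ.+_) (ℕₚ.*-comm n 5))

  residue-square : ∀ c n → Residue (c ℕ.* c) ((c ℕ.+ n ℕ.* 5) ℕ.* (c ℕ.+ n ℕ.* 5))
  residue-square c n = residueOf (2 ℕ.* c ℕ.* n ℕ.+ 5 ℕ.* n ℕ.* n) (expand c n)
    where
    expand : ∀ c n → (c ℕ.+ n ℕ.* 5) ℕ.* (c ℕ.+ n ℕ.* 5) ≡ c ℕ.* c ℕ.+ 5 ℕ.* (2 ℕ.* c ℕ.* n ℕ.+ 5 ℕ.* n ℕ.* n)
    expand = solve-∀

  2*triangle : ∀ n → triangle n ℕ.+ triangle n ≡ n ℕ.* suc n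
  2*triangle zero    = ≡.refl
  2*triangle (suc n) = ≡.trans (e₁ n (triangle n)) (≡.trans (≡.cong (ℕ._+ (suc n ℕ.+ suc n)) (2*triangle n)) (e₂ n))
    where
    e₁ : ∀ n T → T ℕ.+ suc n ℕ.+ (T ℕ.+ suc n) ≡ (T ℕ.+ T) ℕ.+ (suc n ℕ.+ suc n)
    e₁ = solve-∀
    e₂ : ∀ n → n ℕ.* suc n ℕ.+ (suc n ℕ.+ suc n) ≡ suc n ℕ.* suc (suc n)
    e₂ = solve-∀

  triangle-*5 : ∀ n → triangle (n ℕ.* 5) ≡ 5 ℕ.* (2 ℕ.* n ℕ.* n ℕ.+ triangle n)
  triangle-*5 zero    = ≡.refl
  triangle-*5 (suc n) = ≡.trans (≡.cong (λ t → t ℕ.+ suc m ℕ.+ suc (1 ℕ.+ m) ℕ.+ suc (2 ℕ.+ m) ℕ.+ suc (3 ℕ.+ m) ℕ.+ suc (4 ℕ.+ m))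
      (triangle-*5 n)) (e n (triangle n))
    where
    m = n ℕ.* 5
    e : ∀ n T → 5 ℕ.* (2 ℕ.* n ℕ.* n ℕ.+ T) ℕ.+ suc (n ℕ.* 5) ℕ.+ suc (1 ℕ.+ n ℕ.* 5) ℕ.+ suc (2 ℕ.+ n ℕ.* 5) ℕ.+ suc (3 ℕ.+ n ℕ.* 5) ℕ.+
        suc (4 ℕ.+ n ℕ.* 5)
          ≡ 5 ℕ.* (2 ℕ.* suc n ℕ.* suc n ℕ.+ (T ℕ.+ suc n))
    e = solve-∀

  module TriangleResidues (n : ℕ) where
    private
      m = n ℕ.* 5
      T = triangle n
      e₁ : ∀ n T → 5 ℕ.* (2 ℕ.* n ℕ.* n ℕ.+ T) ℕ.+ suc (n ℕ.* 5) ℕ.+ suc (1 ℕ.+ n ℕ.* 5) ≡ 3 ℕ.+ 5 ℕ.* (T ℕ.+ 2 ℕ.* (n ℕ.* suc n))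
      e₁ = solve-∀
      e₂ : ∀ T → T ℕ.+ 2 ℕ.* (T ℕ.+ T) ≡ 5 ℕ.* T
      e₂ = solve-∀

    tri₀ : Residue 0 (triangle m)
    tri₀ = residueOf (2 ℕ.* n ℕ.* n ℕ.+ triangle n) (triangle-*5 n)
    tri₁ : Residue 1 (triangle (1 ℕ.+ m))
    tri₁ = tri₀ ⊹ residue 1 n
    -- The triangular number of index 5n + 2 is 25 T + 3 with T that of index n. Hence the section
    -- of ψ at 3 is ψ(q⁵) again.
    tri₂ : Residue 3 (triangle (2 ℕ.+ m))
    tri₂ = residueOf (5 ℕ.* T) (≡.trans (≡.cong (λ t → t ℕ.+ suc m ℕ.+ suc (1 ℕ.+ m)) (triangle-*5 n)) (≡.trans (e₁ n T)
      (≡.cong (λ t → 3 ℕ.+ 5 ℕ.* t) (≡.trans (≡.cong (λ t → T ℕ.+ 2 ℕ.* t) (≡.sym (2*triangle n))) (e₂ T)))))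
    tri₃ : Residue 1 (triangle (3 ℕ.+ m))
    tri₃ = reduce 1 1 (tri₂ ⊹ residue 3 n)
    tri₄ : Residue 0 (triangle (4 ℕ.+ m))
    tri₄ = reduce 0 1 (tri₃ ⊹ residue 4 n)

  -- Truncation at multiples of 5 yields complete blocks of residues, so that the sections of the
  -- partial sums obey a recursion in n.
  section-limit : ∀ {r} {_ : True (r ℕ.<? 5)} (f : Series) (F : ℕ → Series) (g : Series) (G : ℕ → Series) →
    (∀ n → f ≋ F n upto n) → (∀ n → g ≋ G n upto n) → (∀ n → section r (F (n ℕ.* 5)) ≋ G n upto n) → section r f ≋ g
  section-limit {r} {r<5} f F g G p q s = upto-all λ n → upto-trans (section-upto r {r<5} (p (n ℕ.* 5))) (upto-trans (s n) (upto-sym (q n)))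

  section-+₅ : ∀ r {u v₀ v₁ v₂ v₃ v₄ a b c d e} → section r v₀ ≋ a → section r v₁ ≋ b → section r v₂ ≋ c → section r v₃ ≋ d → section r v₄ ≋
      e →
    section r (u + v₀ + v₁ + v₂ + v₃ + v₄) ≋ section r u + a + b + c + d + e
  section-+₅ r p₀ p₁ p₂ p₃ p₄ = add (add (add (add (add P.refl p₀) p₁) p₂) p₃) p₄
    where
    add : ∀ {u v x y} → section r u ≋ x → section r v ≋ y → section r (u + v) ≋ x + y
    add p q = P.trans (section-+ r _ _) (P.+-cong p q)

  module _ (r : ℕ) {r<5 : True (r ℕ.<? 5)} {0≢r : False (0 ℕ.≟ r)} {1≢r : False (1 ℕ.≟ r)} where
    ψ-section-vanish : {_ : False (3 ℕ.≟ r)} → section r ψ ≋ P.0#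
    ψ-section-vanish {3≢r} = section-limit {r} {r<5} ψ triangularSum P.0# (λ _ → P.0#) ψ-upto (λ _ → upto-refl) (λ n → ≋⇒upto (go n))
      where
      go : ∀ n → section r (triangularSum (n ℕ.* 5)) ≋ P.0#
      go zero    = section-0 r
      go (suc n) = P.trans (section-+₅ r (section-X^-other tri₀ {r} {r<5} {0≢r}) (section-X^-other tri₁ {r} {r<5} {1≢r})
          (section-X^-other tri₂ {r} {r<5} {3≢r})
          (section-X^-other tri₃ {r} {r<5} {1≢r}) (section-X^-other tri₄ {r} {r<5} {0≢r}))
        (P.trans (by 1 (λ x → x :+ κ 0 :+ κ 0 :+ κ 0 :+ κ 0 :+ κ 0 , x) (section r (triangularSum (n ℕ.* 5)))) (go n))
        where open TriangleResidues n

  ψ-section₂ : section 2 ψ ≋ P.0#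
  ψ-section₂ = ψ-section-vanish 2

  ψ-section₄ : section 4 ψ ≋ P.0#
  ψ-section₄ = ψ-section-vanish 4

  ψ-section₃ : section 3 ψ ≋ dilate 5 ψ
  ψ-section₃ = section-limit ψ triangularSum (dilate 5 ψ) (λ n → dilate 5 (triangularSum n)) ψ-upto (λ n → dilate-upto 5 (ψ-upto n)) (λ n →
      ≋⇒upto (go n))
    where
    go : ∀ n → section 3 (triangularSum (n ℕ.* 5)) ≋ dilate 5 (triangularSum n)
    go zero    = P.trans (section-0 3) (P.sym (dilate-0 5))
    go (suc n) = P.trans (section-+₅ 3 (section-X^-other tri₀) (section-X^-other tri₁) (section-X^ tri₂) (section-X^-other tri₃)
        (section-X^-other tri₄))
      (P.trans (by 2 (λ x y → x :+ κ 0 :+ κ 0 :+ y :+ κ 0 :+ κ 0 , x :+ y) (section 3 (triangularSum (n ℕ.* 5))) (X ^ (5 ℕ.* triangle n)))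
      (P.trans (P.+-cong (go n) (P.sym (dilate-X^ (triangle n)))) (P.sym (dilate-+ 5 _ _))))
      where open TriangleResidues n

  module _ where
    open Euler
    private
      dilate-σ : ∀ k → dilate 5 (σ ^ k) ≋ σ ^ k
      dilate-σ k = P.trans (dilate-^ 5 σ k) (^-congˡ k (P.trans (dilate-neg 5 _) (P.-‿cong (dilate-const 5 _))))

      σ^5 : ∀ n → σ ^ (n ℕ.* 5) ≋ σ ^ n
      σ^5 zero    = P.refl
      σ^5 (suc n) = P.trans (P.*-congˡ (P.*-congˡ (P.*-congˡ (P.*-congˡ (P.*-congˡ (σ^5 n))))))
        (by 1 (λ y → let s = :- κ 1 in s :* (s :* (s :* (s :* (s :* y)))) , s :* y) (σ ^ n))

      pair : ∀ r {_ : True (r ℕ.<? 5)} k {a b} → section r (X ^ pent₁ k) ≋ a → section r (X ^ pent₂ k) ≋ b →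
             section r (σ ^ suc k * (X ^ pent₁ k + X ^ pent₂ k)) ≋ σ ^ suc k * (a + b)
      pair r {r<5} k p q = P.trans (section-cong r (P.*-congʳ (P.sym (dilate-σ (suc k))))) (P.trans (section-dilate r {r<5} (σ ^ suc k) _)
        (P.*-congˡ (P.trans (section-+ r _ _) (P.+-cong p q))))

      module PentagonalResidues (n : ℕ) where
        open TriangleResidues n
        T = triangle n
        m = n ℕ.* 5
        double : ∀ a → a ℕ.+ T ℕ.+ 2 ℕ.* (n ℕ.* suc n) ≡ a ℕ.+ 5 ℕ.* T
        double a = ≡.trans (≡.cong (λ t → a ℕ.+ T ℕ.+ 2 ℕ.* t) (≡.sym (2*triangle n))) (e a T)
          where
          e : ∀ a T → a ℕ.+ T ℕ.+ 2 ℕ.* (T ℕ.+ T) ≡ a ℕ.+ 5 ℕ.* T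
          e = solve-∀
        -- The generalised pentagonal numbers congruent to 1 modulo 5 are 1 plus 25 times such a
        -- number. In a block of five pairs they occur in the first place of the first pair and in
        -- the second place of the fourth.
        p₁₀ : Residue 1 (pent₁ m)
        p₁₀ = residueOf (5 ℕ.* (n ℕ.* n ℕ.+ T)) (≡.trans (≡.cong (λ t → suc m ℕ.* suc m ℕ.+ t) (triangle-*5 n)) (≡.trans (e₁ n T)
          (≡.cong (λ t → 1 ℕ.+ 5 ℕ.* t) (≡.trans (double (5 ℕ.* (n ℕ.* n))) (≡.sym (ℕₚ.*-distribˡ-+ 5 (n ℕ.* n) T))))))
          where
          e₁ : ∀ n T → suc (n ℕ.* 5) ℕ.* suc (n ℕ.* 5) ℕ.+ 5 ℕ.* (2 ℕ.* n ℕ.* n ℕ.+ T) ≡ 1 ℕ.+ 5 ℕ.* (5 ℕ.* (n ℕ.* n) ℕ.+ T ℕ.+ 2 ℕ.*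
              (n ℕ.* suc n))
          e₁ = solve-∀
        p₂₀ : Residue 2 (pent₂ m)
        p₂₀ = residue-square 1 n ⊹ tri₁
        p₁₁ : Residue 0 (pent₁ (1 ℕ.+ m))
        p₁₁ = reduce 0 1 (residue-square 2 n ⊹ tri₁)
        p₂₁ : Residue 2 (pent₂ (1 ℕ.+ m))
        p₂₁ = reduce 2 1 (residue-square 2 n ⊹ tri₂)
        p₁₂ : Residue 2 (pent₁ (2 ℕ.+ m))
        p₁₂ = reduce 2 2 (residue-square 3 n ⊹ tri₂)
        p₂₂ : Residue 0 (pent₂ (2 ℕ.+ m))
        p₂₂ = reduce 0 2 (residue-square 3 n ⊹ tri₃)
        p₁₃ : Residue 2 (pent₁ (3 ℕ.+ m))
        p₁₃ = reduce 2 3 (residue-square 4 n ⊹ tri₃)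
        p₂₃ : Residue 1 (pent₂ (3 ℕ.+ m))
        p₂₃ = residueOf (5 ℕ.* pent₁ n) (≡.trans (≡.cong (λ t → (4 ℕ.+ m) ℕ.* (4 ℕ.+ m) ℕ.+ (t ℕ.+ suc m ℕ.+ suc (1 ℕ.+ m) ℕ.+ suc (2 ℕ.+ m)
            ℕ.+ suc (3 ℕ.+ m))) (triangle-*5 n)) (≡.trans (e₁ n T)
          (≡.cong (λ t → 1 ℕ.+ 5 ℕ.* t) (≡.trans (double (5 ℕ.* (suc n ℕ.* suc n))) (≡.sym (ℕₚ.*-distribˡ-+ 5 (suc n ℕ.* suc n) T))))))
          where
          e₁ : ∀ n T → (4 ℕ.+ n ℕ.* 5) ℕ.* (4 ℕ.+ n ℕ.* 5) ℕ.+ (5 ℕ.* (2 ℕ.* n ℕ.* n ℕ.+ T) ℕ.+ suc (n ℕ.* 5) ℕ.+ suc (1 ℕ.+ n ℕ.* 5) ℕ.+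
              suc (2 ℕ.+ n ℕ.* 5) ℕ.+ suc (3 ℕ.+ n ℕ.* 5))
                ≡ 1 ℕ.+ 5 ℕ.* (5 ℕ.* (suc n ℕ.* suc n) ℕ.+ T ℕ.+ 2 ℕ.* (n ℕ.* suc n))
          e₁ = solve-∀
        p₁₄ : Residue 0 (pent₁ (4 ℕ.+ m))
        p₁₄ = reduce 0 5 (residue-square 5 n ⊹ tri₄)
        p₂₄ : Residue 0 (pent₂ (4 ℕ.+ m))
        p₂₄ = reduce 0 5 (residue-square 5 n ⊹ TriangleResidues.tri₀ (suc n))

    -- A block contributes the second exponent of one pair of the rescaled sum and the first
    -- exponent of the next pair. The partial sums therefore differ by one term, whose exponent
    -- tends to infinity.
    η-section₁ : section 1 η ≋ - dilate 5 η
    η-section₁ = section-limit η pentagonalSum _ (λ n → - dilate 5 (pentagonalSum n))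
        (λ n → upto-mono (ℕₚ.n≤1+n n) (euler n)) (λ n → upto-neg (dilate-upto 5 (upto-mono (ℕₚ.n≤1+n n) (euler n))))
        (λ n → upto-trans (≋⇒upto (go n))
            (upto-trans (upto-+ upto-refl (upto-trans (upto-* upto-refl (X^-vanish (5 ℕ.* (n ℕ.* n ℕ.+ triangle n)) (big n)))
            (≋⇒upto (P.zeroʳ _)))) (≋⇒upto (P.+-identityʳ _))))
      where
      big : ∀ n → n ℕ.≤ 5 ℕ.* (n ℕ.* n ℕ.+ triangle n)
      big n = ℕₚ.≤-trans (triangle≥ n) (ℕₚ.≤-trans (ℕₚ.m≤n+m _ (n ℕ.* n)) (ℕₚ.m≤m+n _ _))
      go : ∀ n → section 1 (pentagonalSum (n ℕ.* 5)) ≋ - dilate 5 (pentagonalSum n) + σ ^ n * X ^ (5 ℕ.* (n ℕ.* n ℕ.+ triangle n))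
      go zero    = P.trans (section-X^-other {0} {0} (residueOf 0 ≡.refl)) (P.trans (by 0 (κ 0 , :- κ 1 :+ κ 1 :* κ 1))
          (P.+-congʳ (P.-‿cong (P.sym (dilate-const 5 _)))))
      go (suc n) = begin
        section 1 (pentagonalSum (suc n ℕ.* 5))
          ≈⟨ section-+₅ 1 (pair 1 m (section-X^ p₁₀) (section-X^-other p₂₀)) (pair 1 (1 ℕ.+ m) (section-X^-other p₁₁)
              (section-X^-other p₂₁))
               (pair 1 (2 ℕ.+ m) (section-X^-other p₁₂) (section-X^-other p₂₂)) (pair 1 (3 ℕ.+ m) (section-X^-other p₁₃) (section-X^ p₂₃))
               (pair 1 (4 ℕ.+ m) (section-X^-other p₁₄) (section-X^-other p₂₄)) ⟩
        _ ≈⟨ by 4 (λ d s x y → let σ = :- κ 1; o = κ 0 in d :+ σ :* s :* (x :+ o) :+ σ :* (σ :* s) :* (o :+ o) :+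
            σ :* (σ :* (σ :* s)) :* (o :+ o) :+ σ :* (σ :* (σ :* (σ :* s))) :* (o :+ y) :+ σ :* (σ :* (σ :* (σ :* (σ :* s)))) :* (o :+ o) ,
                d :+ s :* (y :- x)) (section 1 (pentagonalSum m)) (σ ^ m) x y ⟩
        section 1 (pentagonalSum m) + σ ^ m * (y - x)
          ≈⟨ P.+-cong (go n) (P.*-congʳ (σ^5 n)) ⟩
        - dilate 5 (pentagonalSum n) + σ ^ n * x + σ ^ n * (y - x)
          ≈⟨ by 5 (λ d s x y z → let σ = :- κ 1 in :- d :+ s :* x :+ s :* (y :- x) , :- (d :+ σ :* s :* (y :+ z)) :+ σ :* s :* z)
              (dilate 5 (pentagonalSum n)) (σ ^ n) x y z ⟩
        - (dilate 5 (pentagonalSum n) + σ ^ suc n * (y + z)) + σ ^ suc n * z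
          ≈⟨ P.+-congʳ (P.-‿cong (P.+-congˡ (P.*-cong (P.sym (dilate-σ (suc n))) (P.trans (P.+-cong (P.sym (dilate-X^ (pent₁ n)))
              (P.sym (dilate-X^ (pent₂ n)))) (P.sym (dilate-+ 5 _ _)))))) ⟩
        - (dilate 5 (pentagonalSum n) + dilate 5 (σ ^ suc n) * dilate 5 (X ^ pent₁ n + X ^ pent₂ n)) + σ ^ suc n * z
          ≈⟨ P.+-congʳ (P.-‿cong (P.trans (P.+-congˡ (P.sym (dilate-* 5 _ _))) (P.sym (dilate-+ 5 _ _)))) ⟩
        - dilate 5 (pentagonalSum (suc n)) + σ ^ suc n * X ^ (5 ℕ.* (suc n ℕ.* suc n ℕ.+ triangle (suc n))) ∎
        where
        open PR
        open PentagonalResidues n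
        x = X ^ (5 ℕ.* (n ℕ.* n ℕ.+ T))
        y = X ^ (5 ℕ.* pent₁ n)
        z = X ^ (5 ℕ.* pent₂ n)

    module _ (r : ℕ) {r<5 : True (r ℕ.<? 5)} {0≢r : False (0 ℕ.≟ r)} {1≢r : False (1 ℕ.≟ r)} {2≢r : False (2 ℕ.≟ r)} where
      η-section-vanish : section r η ≋ P.0#
      η-section-vanish = section-limit {r} {r<5} η pentagonalSum P.0# (λ _ → P.0#) (λ n → upto-mono (ℕₚ.n≤1+n n) (euler n)) (λ _ →
          upto-refl) (λ n → ≋⇒upto (go n))
        where
        go : ∀ n → section r (pentagonalSum (n ℕ.* 5)) ≋ P.0#
        go zero    = section-X^-other {0} {0} (residueOf 0 ≡.refl) {r} {r<5} {0≢r}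
        go (suc n) = P.trans (section-+₅ r (both m (section-X^-other p₁₀ {r} {r<5} {1≢r}) (section-X^-other p₂₀ {r} {r<5} {2≢r}))
            (both (1 ℕ.+ m) (section-X^-other p₁₁ {r} {r<5} {0≢r}) (section-X^-other p₂₁ {r} {r<5} {2≢r}))
            (both (2 ℕ.+ m) (section-X^-other p₁₂ {r} {r<5} {2≢r}) (section-X^-other p₂₂ {r} {r<5} {0≢r}))
                (both (3 ℕ.+ m) (section-X^-other p₁₃ {r} {r<5} {2≢r}) (section-X^-other p₂₃ {r} {r<5} {1≢r}))
            (both (4 ℕ.+ m) (section-X^-other p₁₄ {r} {r<5} {0≢r}) (section-X^-other p₂₄ {r} {r<5} {0≢r})))
          (P.trans (by 1 (λ x → x :+ κ 0 :+ κ 0 :+ κ 0 :+ κ 0 :+ κ 0 , x) (section r (pentagonalSum m))) (go n))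
          where
          open PentagonalResidues n
          both : ∀ k → section r (X ^ pent₁ k) ≋ P.0# → section r (X ^ pent₂ k) ≋ P.0# → section r (σ ^ suc k * (X ^ pent₁ k + X ^ pent₂ k))
              ≋ P.0#
          both k p q = P.trans (pair r {r<5} k p q) (P.trans (P.*-congˡ (P.+-identityˡ _)) (P.zeroʳ _))

    η-section₃ : section 3 η ≋ P.0#
    η-section₃ = η-section-vanish 3

    η-section₄ : section 4 η ≋ P.0#
    η-section₄ = η-section-vanish 4

-- Comparison of the classes in ψ η = η(q²)²

module ClassEquations where
  open ProductsAndEuler
  open TriangularSeries
  open Dissections
  open P using (_+_; _*_; -_; _-_)

  assemble : Series → Series → Series → Series → Series → Series
  assemble g₀ g₁ g₂ g₃ g₄ = dilate 5 g₀ + X * dilate 5 g₁ + X ^ 2 * dilate 5 g₂ + X ^ 3 * dilate 5 g₃ + X ^ 4 * dilate 5 g₄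

  module _ (g₀ g₁ g₂ g₃ g₄ : Series) where
    private
      parts : ∀ r → section r (assemble g₀ g₁ g₂ g₃ g₄) ≋ section r (X ^ 0 * dilate 5 g₀) + section r (X ^ 1 * dilate 5 g₁) + section r
          (X ^ 2 * dilate 5 g₂) + section r (X ^ 3 * dilate 5 g₃) + section r (X ^ 4 * dilate 5 g₄)
      parts r = P.trans (section-+ r _ _)
          (P.+-congʳ (P.trans (section-+ r _ _) (P.+-congʳ (P.trans (section-+ r _ _) (P.+-congʳ (P.trans (section-+ r _ _)
        (P.+-cong (section-cong r (P.sym (P.*-identityˡ _))) (section-cong r (P.*-congʳ (P.sym (P.*-identityʳ _)))))))))))
      five : ∀ {a b c d e a′ b′ c′ d′ e′} → a ≋ a′ → b ≋ b′ → c ≋ c′ → d ≋ d′ → e ≋ e′ → a + b + c + d + e ≋ a′ + b′ + c′ + d′ + e′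
      five p q r s t = P.+-cong (P.+-cong (P.+-cong (P.+-cong p q) r) s) t

    section₀ : section 0 (assemble g₀ g₁ g₂ g₃ g₄) ≋ g₀
    section₀ = P.trans (parts 0) (P.trans (five (section-same 0 g₀) (section-other 0 1 g₁) (section-other 0 2 g₂) (section-other 0 3 g₃)
        (section-other 0 4 g₄))
      (by 1 (λ x → x :+ κ 0 :+ κ 0 :+ κ 0 :+ κ 0 , x) g₀))
    section₁ : section 1 (assemble g₀ g₁ g₂ g₃ g₄) ≋ g₁
    section₁ = P.trans (parts 1) (P.trans (five (section-other 1 0 g₀) (section-same 1 g₁) (section-other 1 2 g₂) (section-other 1 3 g₃)
        (section-other 1 4 g₄))
      (by 1 (λ x → κ 0 :+ x :+ κ 0 :+ κ 0 :+ κ 0 , x) g₁))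
    section₃ : section 3 (assemble g₀ g₁ g₂ g₃ g₄) ≋ g₃
    section₃ = P.trans (parts 3) (P.trans (five (section-other 3 0 g₀) (section-other 3 1 g₁) (section-other 3 2 g₂) (section-same 3 g₃)
        (section-other 3 4 g₄))
      (by 1 (λ x → κ 0 :+ κ 0 :+ κ 0 :+ x :+ κ 0 , x) g₃))
    section₄ : section 4 (assemble g₀ g₁ g₂ g₃ g₄) ≋ g₄
    section₄ = P.trans (parts 4) (P.trans (five (section-other 4 0 g₀) (section-other 4 1 g₁) (section-other 4 2 g₂) (section-other 4 3 g₃)
        (section-same 4 g₄))
      (by 1 (λ x → κ 0 :+ κ 0 :+ κ 0 :+ κ 0 :+ x , x) g₄))

  η₂ η₅ η₁₀ ψ₅ η₂₅ η₅₀ ψ₂₅ : Series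
  η₂  = dilate 2 η
  η₅  = dilate 5 η
  η₁₀ = dilate 5 η₂
  ψ₅  = dilate 5 ψ
  η₂₅ = dilate 5 η₅
  η₅₀ = dilate 5 η₁₀
  ψ₂₅ = dilate 5 ψ₅

  gauss₅ : ψ₅ * η₅ ≋ η₁₀ * η₁₀
  gauss₅ = P.trans (P.sym (dilate-* 5 ψ η)) (P.trans (dilate-cong 5 Gauss.gauss) (dilate-* 5 η₂ η₂))

  gauss₂₅ : ψ₂₅ * η₂₅ ≋ η₅₀ * η₅₀
  gauss₂₅ = P.trans (P.sym (dilate-* 5 ψ₅ η₅)) (P.trans (dilate-cong 5 gauss₅) (dilate-* 5 η₁₀ η₁₀))

  module Classes where
    -- The indices of e and d are the residues of the exponents in η and η(q²); a and b belong to
    -- the residues 0 and 1 of ψ. The remaining non-zero components are -η(q⁵), -η(q¹⁰) and ψ(q⁵).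
    e₀ e₂ a b d₀ d₄ : Series
    e₀ = section 0 η
    e₂ = section 2 η
    a  = section 0 ψ
    b  = section 1 ψ
    d₀ = dilate 2 e₀
    d₄ = dilate 2 e₂

    η-split : η ≋ dilate 5 e₀ - X * η₂₅ + X ^ 2 * dilate 5 e₂
    η-split = P.trans (dissection η) (P.trans
      (P.+-cong (P.+-cong (P.+-congʳ (P.+-congˡ (P.*-congˡ (P.trans (dilate-cong 5 η-section₁) (dilate-neg 5 η₅)))))
        (P.*-congˡ (P.trans (dilate-cong 5 η-section₃) (dilate-0 5)))) (P.*-congˡ (P.trans (dilate-cong 5 η-section₄) (dilate-0 5))))
      (by 4 (λ x a b c → a :+ x :* (:- b) :+ x :^ 2 :* c :+ x :^ 3 :* κ 0 :+ x :^ 4 :* κ 0 , a :- x :* b :+ x :^ 2 :* c)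
        X (dilate 5 e₀) η₂₅ (dilate 5 e₂)))

    ψ-split : ψ ≋ dilate 5 a + X * dilate 5 b + X ^ 3 * ψ₂₅
    ψ-split = P.trans (dissection ψ) (P.trans
      (P.+-cong (P.+-cong (P.+-congˡ (P.*-congˡ (P.trans (dilate-cong 5 ψ-section₂) (dilate-0 5)))) (P.*-congˡ (dilate-cong 5 ψ-section₃)))
        (P.*-congˡ (P.trans (dilate-cong 5 ψ-section₄) (dilate-0 5))))
      (by 4 (λ x a b c → a :+ x :* b :+ x :^ 2 :* κ 0 :+ x :^ 3 :* c :+ x :^ 4 :* κ 0 , a :+ x :* b :+ x :^ 3 :* c)
        X (dilate 5 a) (dilate 5 b) ψ₂₅))

    η₂-split : η₂ ≋ dilate 5 d₀ - X ^ 2 * η₅₀ + X ^ 4 * dilate 5 d₄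
    η₂-split = P.trans (dilate-cong 2 η-split) (P.trans (dilate-+ 2 _ _) (P.+-cong
      (P.trans (dilate-+ 2 _ _) (P.+-cong (dilate-comm 2 5 e₀) (P.trans (dilate-neg 2 _) (P.-‿cong
        (P.trans (dilate-* 2 _ _) (P.*-cong (dilate-X 2) (P.trans (dilate-comm 2 5 η₅) (dilate-cong 5 (dilate-comm 2 5 η)))))))))
      (P.trans (dilate-* 2 _ _) (P.*-cong (P.trans (dilate-^ 2 X 2) (P.trans (^-congˡ 2 (dilate-X 2)) (^-assocʳ X 2 2)))
          (dilate-comm 2 5 e₂)))))

    -- The residue sums 2 + 4 and 4 + 4 exceed 5; the factors `X` in the classes 1 and 3 are the
    -- carries.
    square : η₂ * η₂ ≋ assemble (d₀ * d₀) (- (X * ((η₁₀ + η₁₀) * d₄))) (- ((d₀ + d₀) * η₁₀)) (X * (d₄ * d₄)) (η₁₀ * η₁₀ + (d₀ + d₀) * d₄)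
    square = P.trans (P.*-cong η₂-split η₂-split) (P.trans
      (by 4 (λ x d f g → (d :- x :^ 2 :* f :+ x :^ 4 :* g) :* (d :- x :^ 2 :* f :+ x :^ 4 :* g) ,
          d :* d :+ x :* (:- (x :^ 5 :* ((f :+ f) :* g))) :+ x :^ 2 :* (:- ((d :+ d) :* f)) :+ x :^ 3 :* (x :^ 5 :* (g :* g)) :+
              x :^ 4 :* (f :* f :+ (d :+ d) :* g))
        X (dilate 5 d₀) η₅₀ (dilate 5 d₄))
      (P.sym (P.+-cong (P.+-cong (P.+-cong (P.+-cong (dilate-* 5 _ _)
        (P.*-congˡ (P.trans (dilate-neg 5 _)
            (P.-‿cong (P.trans (dilate-* 5 _ _) (P.*-cong (dilate-X 5) (P.trans (dilate-* 5 _ _) (P.*-congʳ (dilate-+ 5 _ _)))))))))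
        (P.*-congˡ (P.trans (dilate-neg 5 _) (P.-‿cong (P.trans (dilate-* 5 _ _) (P.*-congʳ (dilate-+ 5 _ _)))))))
        (P.*-congˡ (P.trans (dilate-* 5 _ _) (P.*-cong (dilate-X 5) (dilate-* 5 _ _)))))
        (P.*-congˡ (P.trans (dilate-+ 5 _ _) (P.+-cong (dilate-* 5 _ _) (P.trans (dilate-* 5 _ _) (P.*-congʳ (dilate-+ 5 _ _)))))))))

    product : ψ * η ≋ assemble (a * e₀ + X * (ψ₅ * e₂)) (b * e₀ - a * η₅) (a * e₂ - b * η₅) (ψ₅ * e₀ + b * e₂) (- (ψ₅ * η₅))
    product = P.trans (P.*-cong ψ-split η-split) (P.trans
      (by 7 (λ x a b c e g e₂ → (a :+ x :* b :+ x :^ 3 :* c) :* (e :- x :* g :+ x :^ 2 :* e₂) ,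
          (a :* e :+ x :^ 5 :* (c :* e₂)) :+ x :* (b :* e :- a :* g) :+ x :^ 2 :* (a :* e₂ :- b :* g) :+ x :^ 3 :* (c :* e :+ b :* e₂) :+
              x :^ 4 :* (:- (c :* g)))
        X (dilate 5 a) (dilate 5 b) ψ₂₅ (dilate 5 e₀) η₂₅ (dilate 5 e₂))
      (P.sym (P.+-cong (P.+-cong (P.+-cong (P.+-cong
        (P.trans (dilate-+ 5 _ _) (P.+-cong (dilate-* 5 _ _) (P.trans (dilate-* 5 _ _) (P.*-cong (dilate-X 5) (dilate-* 5 _ _)))))
        (P.*-congˡ (minus (dilate-* 5 _ _) (dilate-* 5 _ _)))) (P.*-congˡ (minus (dilate-* 5 _ _) (dilate-* 5 _ _))))
        (P.*-congˡ (P.trans (dilate-+ 5 _ _) (P.+-cong (dilate-* 5 _ _) (dilate-* 5 _ _)))))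
        (P.*-congˡ (P.trans (dilate-neg 5 _) (P.-‿cong (dilate-* 5 _ _)))))))
      where
      minus : ∀ {f g f′ g′} → dilate 5 f ≋ f′ → dilate 5 g ≋ g′ → dilate 5 (f - g) ≋ f′ - g′
      minus p q = P.trans (dilate-+ 5 _ _) (P.+-cong p (P.trans (dilate-neg 5 _) (P.-‿cong q)))

    private
      classes : ∀ r → section r (assemble _ _ _ _ _) ≋ section r (assemble _ _ _ _ _)
      classes r = section-cong r (P.trans (P.sym square) (P.trans (P.sym Gauss.gauss) product))

    class₀ : d₀ * d₀ ≋ a * e₀ + X * (ψ₅ * e₂)
    class₀ = P.trans (P.sym (section₀ _ _ _ _ _)) (P.trans (classes 0) (section₀ _ _ _ _ _))
    class₁ : - (X * ((η₁₀ + η₁₀) * d₄)) ≋ b * e₀ - a * η₅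
    class₁ = P.trans (P.sym (section₁ _ _ _ _ _)) (P.trans (classes 1) (section₁ _ _ _ _ _))
    class₃ : X * (d₄ * d₄) ≋ ψ₅ * e₀ + b * e₂
    class₃ = P.trans (P.sym (section₃ _ _ _ _ _)) (P.trans (classes 3) (section₃ _ _ _ _ _))
    class₄ : η₁₀ * η₁₀ + (d₀ + d₀) * d₄ ≋ - (ψ₅ * η₅)
    class₄ = P.trans (P.sym (section₄ _ _ _ _ _)) (P.trans (classes 4) (section₄ _ _ _ _ _))

    integer-regular : ∀ u {n} → u 0 ≡ + suc n → Regular u
    integer-regular u {n} p = head-regular u (λ {c} q → ℤₚ.*-cancelˡ-≡ (+ suc n) c (+ 0) (≡.trans (≡.cong (ℤ._* c) (≡.sym p))
        (≡.trans q (≡.sym (ℤₚ.*-zeroʳ (+ suc n))))))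

    const-regular : ∀ n → Regular (const (+ suc n))
    const-regular n = integer-regular _ ≡.refl

    -- Gauss's identity at q⁵ turns the right side of `class₄` into -η(q¹⁰)², which leaves twice the
    -- product.
    d₀d₄ : d₀ * d₄ ≋ - (η₁₀ * η₁₀)
    d₀d₄ = cancel (const-regular 1) (combine₂ (by 4 (λ d e f g → κ 2 :* (d :* e) ,
        κ 2 :* (:- (f :* f)) :+ κ 1 :* ((f :* f :+ (d :+ d) :* e) :- (:- g)) :+ (:- κ 1) :* (g :- f :* f)) d₀ d₄ η₁₀ (ψ₅ * η₅)) class₄
            gauss₅)

    -- The equation `d₀d₄` arises from this one by q ↦ q², an injective substitution. The classical
    -- relation between the classes of η is thus found without the Rogers-Ramanujan products.
    e₀e₂ : e₀ * e₂ ≋ - (η₅ * η₅)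
    e₀e₂ = dilate-injective 2 (P.trans (dilate-* 2 e₀ e₂) (P.trans d₀d₄ (P.sym (P.trans (dilate-neg 2 _) (P.-‿cong (P.trans (dilate-* 2 _ _)
      (P.*-cong (dilate-comm 2 5 η) (dilate-comm 2 5 η))))))))

-- The classes of ψ in terms of Ramanujan's parameter k

module Parametrisation where
  open ProductsAndEuler
  open TriangularSeries
  open Dissections
  open ClassEquations
  open P using (_+_; _*_; -_; _-_)
  open Classes

  -- Constant term 1, which gives invertibility as well as regularity.
  Monic : Series → Set
  Monic f = f 0 ≡ + 1

  monic-regular : ∀ {f} → Monic f → Regular f
  monic-regular = integer-regular _

  monic-* : ∀ {f g} → Monic f → Monic g → Monic (f * g)
  monic-* p q = ≡.cong₂ ℤ._*_ p q

  monic-dilate : ∀ k .{{_ : NonZero k}} {f} → Monic f → Monic (dilate k f)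
  monic-dilate (suc k) {f} p = ≡.trans (dilate-at (suc k) f 0) p

  η-monic : Monic η
  η-monic = agree-at (η-upto 0) 0 ℕₚ.≤-refl

  ψ-monic : Monic ψ
  ψ-monic = ≡.trans (agree-at (ψ-upto 1) 0 ℕₚ.≤-refl) (⊕-at P.0# (X ^ 0) 0)

  opaque
    recip : ∀ f → Monic f → Series
    recip f p = proj₁ (inverse f p)

    recip-inverse : ∀ f (p : Monic f) → f * recip f p ≋ P.1#
    recip-inverse f p = proj₂ (inverse f p)

  recip-monic : ∀ f (p : Monic f) → Monic (recip f p)
  recip-monic f p = ≡.trans (≡.sym (ℤₚ.*-identityˡ _)) (≡.trans (≡.cong (ℤ._* recip f p 0) (≡.sym p)) (at (recip-inverse f p) 0))

  1+X*-monic : ∀ {f g} → f ≋ P.1# + X * g → Monic f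
  1+X*-monic {f} {g} p = ≡.trans (at p 0) (≡.trans (⊕-at P.1# (X * g) 0) (≡.cong (ℤ._+_ (+ 1)) (X-⊛-zero g)))

  module Parameters where
    E₀ E₂ D₀ D₄ B′ : Series
    E₀ = dilate 5 e₀
    E₂ = dilate 5 e₂
    D₀ = dilate 5 d₀
    D₄ = dilate 5 d₄
    B′ = dilate 5 b

    A B C : Series
    A = dilate 5 a
    B = X * B′
    C = X ^ 3 * ψ₂₅

    E₀-monic : Monic E₀
    E₀-monic = monic-dilate 5 (≡.trans (section-at 0 η 0) η-monic)

    D₀-monic : Monic D₀
    D₀-monic = monic-dilate 5 (monic-dilate 2 (≡.trans (section-at 0 η 0) η-monic))

    η₂₅-monic : Monic η₂₅
    η₂₅-monic = monic-dilate 5 (monic-dilate 5 η-monic)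

    η₅₀-monic : Monic η₅₀
    η₅₀-monic = monic-dilate 5 (monic-dilate 5 (monic-dilate 2 η-monic))

    ψ₂₅-monic : Monic ψ₂₅
    ψ₂₅-monic = monic-dilate 5 (monic-dilate 5 ψ-monic)

    -- With R the Rogers-Ramanujan continued fraction, U is R(q⁵), V is R(q¹⁰), and K = U V² is
    -- Ramanujan's k at q⁵. The series δ is the common scale of the classes of ψ.
    1/E₀ u v δ U V K : Series
    1/E₀ = recip E₀ E₀-monic
    u = η₂₅ * 1/E₀
    v = η₅₀ * recip D₀ D₀-monic
    δ = D₀ * D₀ * 1/E₀
    U = X * u
    V = X ^ 2 * v
    K = U * V * V

    u-monic : Monic u
    u-monic = monic-* {η₂₅} {1/E₀} η₂₅-monic (recip-monic _ E₀-monic)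

    v-monic : Monic v
    v-monic = monic-* {η₅₀} {recip D₀ D₀-monic} η₅₀-monic (recip-monic _ D₀-monic)

    δ-monic : Monic δ
    δ-monic = monic-* {D₀ * D₀} {1/E₀} (monic-* {D₀} {D₀} D₀-monic D₀-monic) (recip-monic _ E₀-monic)

    U-regular : Regular U
    U-regular = *-regular X-regular (monic-regular u-monic)

    η₂₅-u : η₂₅ ≋ u * E₀
    η₂₅-u = combine₁ (by 3 (λ n i e → n , n :* i :* e :+ (:- n) :* (e :* i :- κ 1)) η₂₅ 1/E₀ E₀) (recip-inverse E₀ E₀-monic)

    η₅₀-v : η₅₀ ≋ v * D₀
    η₅₀-v = combine₁ (by 3 (λ n i e → n , n :* i :* e :+ (:- n) :* (e :* i :- κ 1)) η₅₀ (recip D₀ D₀-monic) D₀) (recip-inverse D₀ D₀-monic)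

    D₀² : D₀ * D₀ ≋ δ * E₀
    D₀² = combine₁ (by 3 (λ d i e → d :* d , d :* d :* i :* e :+ (:- (d :* d)) :* (e :* i :- κ 1)) D₀ 1/E₀ E₀) (recip-inverse E₀ E₀-monic)

    private
      d* : ∀ {f g f′ g′} → dilate 5 f ≋ f′ → dilate 5 g ≋ g′ → dilate 5 (f * g) ≋ f′ * g′
      d* p q = P.trans (dilate-* 5 _ _) (P.*-cong p q)
      d+ : ∀ {f g f′ g′} → dilate 5 f ≋ f′ → dilate 5 g ≋ g′ → dilate 5 (f + g) ≋ f′ + g′
      d+ p q = P.trans (dilate-+ 5 _ _) (P.+-cong p q)
      d- : ∀ {f f′} → dilate 5 f ≋ f′ → dilate 5 (- f) ≋ - f′
      d- p = P.trans (dilate-neg 5 _) (P.-‿cong p)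
      d : ∀ {f} → dilate 5 f ≋ dilate 5 f
      d = P.refl
      dX = dilate-X 5

    E₂-u : E₂ ≋ - (u * u) * E₀
    E₂-u = cancel (monic-regular E₀-monic) (combine₂
      (by 4 (λ e f n u → e :* f , e :* (:- (u :* u) :* e) :+ κ 1 :* (e :* f :- :- (n :* n)) :+ (:- (n :+ u :* e)) :* (n :- u :* e)) E₀ E₂
          η₂₅ u)
      (P.trans (P.sym (d* d d)) (P.trans (dilate-cong 5 e₀e₂) (d- (d* d d)))) η₂₅-u)

    D₄-v : D₄ ≋ - (v * v) * D₀
    D₄-v = cancel (monic-regular D₀-monic) (combine₂
      (by 4 (λ e f n u → e :* f , e :* (:- (u :* u) :* e) :+ κ 1 :* (e :* f :- :- (n :* n)) :+ (:- (n :+ u :* e)) :* (n :- u :* e)) D₀ D₄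
          η₅₀ v)
      (P.trans (P.sym (d* d d)) (P.trans (dilate-cong 5 d₀d₄) (d- (d* d d)))) η₅₀-v)

    η-U : η ≋ E₀ * (P.1# - U - U * U)
    η-U = P.trans η-split (combine₂ (by 5 (λ x e n f u → e :- x :* n :+ x :^ 2 :* f ,
        e :* (κ 1 :- x :* u :- (x :* u) :* (x :* u)) :+ (:- x) :* (n :- u :* e) :+ x :^ 2 :* (f :- :- (u :* u) :* e)) X E₀ η₂₅ E₂ u) η₂₅-u
            E₂-u)

    -- Gauss's identity at q²⁵ in the new parameters.
    C-U : C * U ≋ V * V * δ
    C-U = cancel (monic-regular E₀-monic) (P.trans (by 4 (λ x s u e → e :* (x :^ 3 :* s :* (x :* u)) , x :^ 4 :* (s :* (u :* e))) X ψ₂₅ u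
        E₀)
      (P.trans (P.*-congˡ (P.trans (P.*-congˡ (P.sym η₂₅-u)) (P.trans gauss₂₅ (P.*-cong η₅₀-v η₅₀-v))))
      (combine₁ (by 5 (λ x v d δ e → x :^ 4 :* ((v :* d) :* (v :* d)) , e :* ((x :^ 2 :* v) :* (x :^ 2 :* v) :* δ) :+
          x :^ 4 :* v :* v :* (d :* d :- δ :* e)) X v D₀ δ E₀) D₀²)))

    -- The class 0 with E₂ = -u² E₀ inserted; `C-eq` and `B-eq` treat the classes 3 and 1 in the
    -- same way.
    A-eq : A ≋ δ + U * U * C
    A-eq = cancel (monic-regular E₀-monic) (combine₃ (by 8 (λ x a e d δ s f u → e :* a ,
        e :* (δ :+ (x :* u) :* (x :* u) :* (x :^ 3 :* s)) :+ (:- κ 1) :* (d :* d :- (a :* e :+ x :^ 5 :* (s :* f))) :+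
            κ 1 :* (d :* d :- δ :* e) :+ (:- (x :^ 5 :* s)) :* (f :- :- (u :* u) :* e))
        X A E₀ D₀ δ ψ₂₅ E₂ u)
      (P.trans (P.sym (d* d d)) (P.trans (dilate-cong 5 class₀) (d+ (d* d d) (d* dX (d* d d))))) D₀² E₂-u)

    C-eq : C ≋ V * V * V * V * δ + U * U * B
    C-eq = cancel (monic-regular E₀-monic) (P.trans (combine₃ (by 9 (λ x b e d δ s f u g → e :* (x :^ 3 :* s) ,
        (x :^ 8 :* (g :* g) :+ e :* ((x :* u) :* (x :* u) :* (x :* b))) :+ (:- (x :^ 3)) :* (x :^ 5 :* (g :* g) :- (s :* e :+ b :* f)) :+
            (:- (x :^ 3 :* b)) :* (f :- :- (u :* u) :* e) :+ κ 0 :* (d :* d :- δ :* e))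
        X B′ E₀ D₀ δ ψ₂₅ E₂ u D₄)
      (P.trans (P.sym (d* dX (d* d d))) (P.trans (dilate-cong 5 class₃) (d+ (d* d d) (d* d d)))) E₂-u D₀²)
      (combine₂ (by 8 (λ x b e d δ u g v → x :^ 8 :* (g :* g) :+ e :* ((x :* u) :* (x :* u) :* (x :* b)) ,
         e :* ((x :^ 2 :* v) :* (x :^ 2 :* v) :* (x :^ 2 :* v) :* (x :^ 2 :* v) :* δ :+ (x :* u) :* (x :* u) :* (x :* b))
          :+ (x :^ 8 :* (g :+ :- (v :* v) :* d)) :* (g :- :- (v :* v) :* d) :+ (x :^ 8 :* v :^ 4) :* (d :* d :- δ :* e))
         X B′ E₀ D₀ δ u D₄ v) D₄-v D₀²))

    B-eq : B ≋ (V * V * V + V * V * V) * δ + U * A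
    B-eq = cancel (monic-regular E₀-monic) (P.trans (combine₂ (by 7 (λ x a b e h g n → e :* (x :* b) ,
          x :* (a :* n) :- x :^ 6 :* ((h :+ h) :* g) :+ (:- x) :* ((:- (x :^ 5 :* ((h :+ h) :* g))) :- (b :* e :- a :* n)) :+
              κ 0 :* (n :- n)) X A B′ E₀ η₅₀ D₄ η₂₅)
        (P.trans (P.sym (d- (d* dX (d* (d+ d d) d)))) (P.trans (dilate-cong 5 class₁) (d+ (d* d d) (d- (d* d d))))) P.refl)
      (P.trans (P.+-cong (P.*-congˡ (P.*-congˡ η₂₅-u)) (P.-‿cong (P.*-congˡ (P.*-cong (P.+-cong η₅₀-v η₅₀-v) D₄-v))))
      (combine₁ (by 7 (λ x a e d δ u v → x :* (a :* (u :* e)) :- x :^ 6 :* ((v :* d :+ v :* d) :* (:- (v :* v) :* d)) ,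
          e :* (((x :^ 2 :* v) :* (x :^ 2 :* v) :* (x :^ 2 :* v) :+ (x :^ 2 :* v) :* (x :^ 2 :* v) :* (x :^ 2 :* v)) :* δ :+ (x :* u) :* a)
              :+ (κ 2 :* x :^ 6 :* v :^ 3) :* (d :* d :- δ :* e))
          X A E₀ D₀ δ u v) D₀²)))

    A-K : A ≋ δ * (P.1# + K)
    A-K = cancel U-regular (combine₂ (by 5 (λ u v δ a c → u :* a , u :* (δ :* (κ 1 :+ u :* v :* v)) :+ u :* (a :- (δ :+ u :* u :* c)) :+
        (u :* u) :* (c :* u :- v :* v :* δ))
      U V δ A C) A-eq C-U)

    U³B : U ^ 3 * B ≋ V * V * δ * (P.1# - K)
    U³B = combine₂ (by 5 (λ u v δ b c → u :^ 3 :* b , v :* v :* δ :* (κ 1 :- u :* v :* v) :+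
        (:- u) :* (c :- (v :* v :* v :* v :* δ :+ u :* u :* b)) :+ κ 1 :* (c :* u :- v :* v :* δ))
      U V δ B C) C-eq C-U

    V+U²-regular : Regular (V + U * U)
    V+U²-regular = ≋-regular (by 3 (λ x v u → x :^ 2 :* (v :+ u :* u) , x :^ 2 :* v :+ (x :* u) :* (x :* u)) X v u)
      (*-regular (^-regular X-regular 2) (integer-regular (v + u * u) (≡.trans (⊕-at v (u * u) 0) (≡.cong₂ ℤ._+_ v-monic
          (monic-* {u} {u} u-monic u-monic)))))

    -- Ramanujan's relation (R(q²) - R(q)²) / (R(q²) + R(q)²) = R(q) R(q²)² at q⁵. The two
    -- expressions for B differ by it times δ and V + U², which are regular.
    V-U² : (P.1# - K) * V ≋ (P.1# + K) * (U * U)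
    V-U² = equal (V+U²-regular (monic-regular δ-monic (P.trans
      (combine₃ (by 5 (λ u v δ a b → let k = u :* v :* v in
          δ :* ((v :+ u :* u) :* ((κ 1 :- k) :* v :- (κ 1 :+ k) :* (u :* u))) ,
          κ 0 :+ (:- κ 1) :* (u :^ 3 :* b :- v :* v :* δ :* (κ 1 :- k)) :+ u :^ 3 :* (b :- ((v :* v :* v :+ v :* v :* v) :* δ :+ u :* a)) :+
              (u :^ 4) :* (a :- δ :* (κ 1 :+ k)))
        U V δ A B) U³B B-eq A-K) P.refl)))

    1-K-monic : Monic (P.1# - K)
    1-K-monic = 1+X*-monic {g = - (u * V * V)} (by 3 (λ x u v → κ 1 :- x :* u :* v :* v , κ 1 :+ x :* (:- (u :* v :* v))) X u V)

    -- The quotient V / U² in the form that `V-U²` gives. With it the classes A, B, C become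
    -- polynomials in δ, U, w and K.
    w : Series
    w = (P.1# + K) * recip (P.1# - K) 1-K-monic

    w-eq : w * (P.1# - K) ≋ P.1# + K
    w-eq = combine₁ (by 2 (λ k i → (κ 1 :+ k) :* i :* (κ 1 :- k) , κ 1 :+ k :+ (κ 1 :+ k) :* ((κ 1 :- k) :* i :- κ 1)) K
        (recip (P.1# - K) 1-K-monic)) (recip-inverse (P.1# - K) 1-K-monic)

    V-w : V ≋ U * U * w
    V-w = cancel (monic-regular 1-K-monic) (combine₂ (by 4 (λ u v w k → (κ 1 :- k) :* v ,
       (κ 1 :- k) :* (u :* u :* w) :+ κ 1 :* ((κ 1 :- k) :* v :- (κ 1 :+ k) :* (u :* u)) :+ (:- (u :* u)) :* (w :* (κ 1 :- k) :- (κ 1 :+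
           k)))
       U V w K) V-U² w-eq)

    -- Ramanujan's R⁵ = k ((1 - k) / (1 + k))², at q⁵.
    K-eq : K ≋ U ^ 5 * w ^ 2
    K-eq = combine₁ (by 3 (λ u v w → u :* v :* v , u :^ 5 :* w :^ 2 :+ (u :* (v :+ u :* u :* w)) :* (v :- u :* u :* w)) U V w) V-w

    B-K : B ≋ δ * U * w * (P.1# + K)
    B-K = cancel (^-regular U-regular 3) (combine₃ (by 6 (λ u v δ b w k → u :^ 3 :* b ,
       u :^ 3 :* (δ :* u :* w :* (κ 1 :+ k)) :+ κ 1 :* (u :^ 3 :* b :- v :* v :* δ :* (κ 1 :- k)) :+
           (δ :* (κ 1 :- k) :* (v :+ u :* u :* w)) :* (v :- u :* u :* w)
         :+ (u :^ 4 :* w :* δ) :* (w :* (κ 1 :- k) :- (κ 1 :+ k))) U V δ B w K) U³B V-w w-eq)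

    C-K : C ≋ δ * U ^ 3 * w ^ 2
    C-K = cancel U-regular (combine₂ (by 5 (λ u v δ c w → u :* c , u :* (δ :* u :^ 3 :* w :^ 2) :+ κ 1 :* (c :* u :- v :* v :* δ) :+
        (δ :* (v :+ u :* u :* w)) :* (v :- u :* u :* w))
       U V δ C w) C-U V-w)

-- The norm of ψ, computed over ℤ[ζ] and descended to ℤ

module NormOfψ where
  open ProductsAndEuler
  open TriangularSeries
  open Dissections
  open ClassEquations
  open Parametrisation
  open Classes using (a; b; ψ-split)
  open Parameters using (A; B; C)

  module BaseChange (R : CommutativeRing 0ℓ 0ℓ)
    (ι : CommutativeRing.rawRing ℤ-ring -Raw-AlmostCommutative⟶ fromCommutativeRing R) where
    private module R = CommutativeRing R
    private module I = _-Raw-AlmostCommutative⟶_ ι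
    private module S = Series R ι
    private module O = Operators R ι

    opaque
      unfolding _⊕_ S._⊕_ dilate O.dilate
      lift : Series → S.Series
      lift f n = I.⟦ f n ⟧

      lift-cong : ∀ {f g} → f ≋ g → lift f S.≋ lift g
      lift-cong p = S.pointwise λ n → R.reflexive (≡.cong I.⟦_⟧ (at p n))

      lift-upto : ∀ {N f g} → f ≋ g upto N → lift f S.≋ lift g upto N
      lift-upto p = S.agree λ n n<N → R.reflexive (≡.cong I.⟦_⟧ (agree-at p n n<N))

      lift-+ : ∀ f g → lift (f P.+ g) S.≋ lift f S.P.+ lift g
      lift-+ f g = S.pointwise λ n → I.+-homo (f n) (g n)

      lift-neg : ∀ f → lift (P.- f) S.≋ S.P.- lift f
      lift-neg f = S.pointwise λ n → I.-‿homo (f n)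

      lift-* : ∀ f g → lift (f P.* g) S.≋ lift f S.P.* lift g
      lift-* f g = S.pointwise λ n → go n f g
        where
        go : ∀ n f g → I.⟦ (f P.* g) n ⟧ R.≈ (lift f S.P.* lift g) n
        go zero    f g = I.*-homo (f 0) (g 0)
        go (suc n) f g = R.trans (I.+-homo _ _) (R.+-cong (I.*-homo (f 0) (g (suc n))) (go n (tail f) g))

      lift-X : lift X S.≋ S.X
      lift-X = S.pointwise λ { zero → I.0-homo ; (suc zero) → I.1-homo ; (suc (suc n)) → I.0-homo }

      lift-const : ∀ c → lift (const c) S.≋ S.const I.⟦ c ⟧
      lift-const c = S.pointwise λ { zero → R.refl ; (suc n) → I.0-homo }

      lift-dilate : ∀ k .{{_ : NonZero k}} f → lift (dilate k f) S.≋ O.dilate k (lift f)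
      lift-dilate k f = S.pointwise λ n → go (n % k) (f (n / k))
        where
        go : ∀ n c → I.⟦ pick n c ⟧ R.≈ O.pick n I.⟦ c ⟧
        go zero    c = R.refl
        go (suc n) c = I.0-homo

      lift-injective : (∀ {c d} → I.⟦ c ⟧ R.≈ I.⟦ d ⟧ → c ≡ d) → ∀ {f g} → lift f S.≋ lift g → f ≋ g
      lift-injective inj p = pointwise λ n → inj (S.at p n)

      lift-head : ∀ f → lift f 0 ≡ I.⟦ f 0 ⟧
      lift-head f = ≡.refl

    lift-1 : lift P.1# S.≋ S.P.1#
    lift-1 = S.P.trans (lift-const (+ 1)) (S.const-cong I.1-homo)

    lift-^ : ∀ f n → lift (f ^ n) S.≋ lift f S.^ n
    lift-^ f zero    = lift-1
    lift-^ f (suc n) = S.P.trans (lift-* f (f ^ n)) (S.P.*-congˡ (lift-^ f n))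

  -- Here φ = ζ + ζ⁻¹ satisfies φ² = 1 - φ, and ζ² = φ ζ - 1. In two quadratic steps the relations
  -- of ζ hold by evaluation of integers.
  module ℤ[φ] = Quadratic ℤ-ring ℤ-id (ℤ.-1ℤ) (ℤ.1ℤ)
  module ℤ[ζ] = Quadratic ℤ[φ].ring ℤ[φ].hom ℤ[φ].root (ℤ[φ].embed (ℤ.-1ℤ))

  module ψ-Norm where
    private
      module S = Series ℤ[ζ].ring ℤ[ζ].hom
      module O = Operators ℤ[ζ].ring ℤ[ζ].hom
      module N = NormForm ℤ[ζ].ring ℤ[ζ].hom
      open BaseChange ℤ[ζ].ring ℤ[ζ].hom
      R = ℤ[ζ].ring
      z g : CommutativeRing.Carrier R
      z = ℤ[ζ].root
      g = ℤ[ζ].embed ℤ[φ].root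

      z-inverse : CommutativeRing._≈_ R (CommutativeRing._*_ R z (CommutativeRing._-_ R g z)) (CommutativeRing.1# R)
      z-inverse = (≡.refl ℤ[φ]., ≡.refl) ℤ[ζ]., (≡.refl ℤ[φ]., ≡.refl)

      g-minimal : CommutativeRing._≈_ R (CommutativeRing._+_ R (CommutativeRing._*_ R g g) g) (CommutativeRing.1# R)
      g-minimal = (≡.refl ℤ[φ]., ≡.refl) ℤ[ζ]., (≡.refl ℤ[φ]., ≡.refl)

      embed-injective : ∀ {c d} → CommutativeRing._≈_ R (ℤ[ζ].embed (ℤ[φ].embed c)) (ℤ[ζ].embed (ℤ[φ].embed d)) → c ≡ d
      embed-injective p = ℤ[φ].constant≈ (ℤ[ζ].constant≈ p)

      module F = N.FifthRoot z g z-inverse g-minimal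

      norm : Series → S.Series
      norm f = F.norm (lift f)

      d : S.Series → S.Series
      d = O.dilate 5

      lift-pochhammer : ∀ n → lift (pochhammer n) S.≋ N.pochhammer n
      lift-pochhammer zero    = lift-1
      lift-pochhammer (suc n) = S.P.trans (lift-* _ _) (S.P.*-cong (lift-pochhammer n)
        (S.P.trans (lift-+ _ _) (S.P.+-cong lift-1 (S.P.trans (lift-neg _)
            (S.P.-‿cong (S.P.trans (lift-^ X (suc n)) (S.^-congˡ (suc n) lift-X)))))))

      η-near : ∀ n → lift η S.≋ N.pochhammer (n ℕ.* 5) upto n
      η-near n = S.upto-trans (lift-upto (upto-mono (ℕₚ.m≤n⇒m≤1+n (ℕₚ.m≤m*n n 5)) (η-upto (n ℕ.* 5))))
          (S.≋⇒upto (lift-pochhammer (n ℕ.* 5)))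

      η-near′ : ∀ n → lift η S.≋ N.pochhammer n upto n
      η-near′ n = S.upto-trans (lift-upto (upto-mono (ℕₚ.n≤1+n n) (η-upto n))) (S.≋⇒upto (lift-pochhammer n))

      norm-η : norm η S.P.* d (d (lift η)) S.≋ d (lift η) S.^ 6
      norm-η = S.upto-all λ n → S.upto-trans
        (S.upto-* (F.norm-upto (η-near n)) (O.dilate-upto 5 (O.dilate-upto 5 (η-near′ n))))
        (S.upto-trans (S.≋⇒upto (F.norm-pochhammer n))
          (S.upto-* (O.dilate-upto 5 (S.upto-sym (η-near n))) (S.upto-^ 5 (O.dilate-upto 5 (S.upto-sym (η-near′ n))))))

      lift₅ : ∀ f → lift (dilate 5 f) S.≋ d (lift f)
      lift₅ = lift-dilate 5

      norm-η₂ : norm η₂ S.P.* lift η₅₀ S.≋ lift η₁₀ S.^ 6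
      norm-η₂ = begin
        norm η₂ S.P.* lift η₅₀
          ≈⟨ S.P.*-cong (S.P.trans (F.norm-cong (lift-dilate 2 η)) (F.norm-dilate₂ (lift η)))
               (S.P.trans (lift-cong (P.trans (dilate-cong 5 (dilate-comm 5 2 η)) (dilate-comm 5 2 η₅))) (S.P.trans (lift-dilate 2 η₂₅)
                 (O.dilate-cong 2 (S.P.trans (lift₅ η₅) (O.dilate-cong 5 (lift₅ η)))))) ⟩
        O.dilate 2 (norm η) S.P.* O.dilate 2 (d (d (lift η)))
          ≈⟨ S.P.sym (O.dilate-* 2 _ _) ⟩
        O.dilate 2 (norm η S.P.* d (d (lift η)))
          ≈⟨ O.dilate-cong 2 norm-η ⟩
        O.dilate 2 (d (lift η) S.^ 6)
          ≈⟨ O.dilate-^ 2 _ 6 ⟩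
        O.dilate 2 (d (lift η)) S.^ 6
          ≈⟨ S.^-congˡ 6 (S.P.trans (O.dilate-cong 2 (S.P.sym (lift₅ η))) (S.P.trans (S.P.sym (lift-dilate 2 η₅))
              (lift-cong (dilate-comm 2 5 η)))) ⟩
        lift η₁₀ S.^ 6 ∎
        where open S.PR

      norm-η′ : norm η S.P.* lift η₂₅ S.≋ lift η₅ S.^ 6
      norm-η′ = S.P.trans (S.P.*-congˡ (S.P.trans (lift₅ η₅) (O.dilate-cong 5 (lift₅ η))))
          (S.P.trans norm-η (S.^-congˡ 6 (S.P.sym (lift₅ η))))

      lift-regular : ∀ {f} → Monic f → S.Regular (lift f)
      lift-regular {f} p = S.head-regular (lift f) λ {c} q → R.trans (R.sym (R.*-identityˡ c))
        (R.trans (R.*-congʳ (R.reflexive (≡.sym (≡.trans (lift-head f) (≡.cong (λ t → ℤ[ζ].embed (ℤ[φ].embed t)) p))))) q)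
        where module R = CommutativeRing ℤ[ζ].ring

      gauss′ : ∀ {f g h} → f P.* g ≋ h P.* h → lift f S.P.* lift g S.≋ lift h S.P.* lift h
      gauss′ p = S.P.trans (S.P.sym (lift-* _ _)) (S.P.trans (lift-cong p) (lift-* _ _))

      -- Gauss's identity gives norm ψ · norm η = (norm η₂)². After the norms of η and η₂ are
      -- inserted, Gauss's identity at q⁵ and q²⁵ leaves ψ alone.
      norm-ψ : norm ψ S.P.* lift ψ₂₅ S.≋ lift ψ₅ S.^ 6
      norm-ψ = S.cancel (S.*-regular (S.^-regular (lift-regular {η₅} (monic-dilate 5 η-monic)) 6)
          (lift-regular {η₂₅} (monic-dilate 5 (monic-dilate 5 η-monic)))) (begin
        (e₅ S.^ 6 S.P.* e₂₅) S.P.* (norm ψ S.P.* p₂₅)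
          ≈⟨ S.P.*-congʳ (S.P.*-congʳ (S.P.sym norm-η′)) ⟩
        ((norm η S.P.* e₂₅) S.P.* e₂₅) S.P.* (norm ψ S.P.* p₂₅)
          ≈⟨ S.by 4 (λ n e m p → ((n S.:* e) S.:* e) S.:* (m S.:* p) , (m S.:* n) S.:* (p S.:* e) S.:* e) (norm η) e₂₅ (norm ψ) p₂₅ ⟩
        (norm ψ S.P.* norm η) S.P.* (p₂₅ S.P.* e₂₅) S.P.* e₂₅
          ≈⟨ S.P.*-congʳ (S.P.*-cong (S.P.trans (S.P.sym (nm ψ η)) (S.P.trans (nc (lift-cong Gauss.gauss)) (nm η₂ η₂))) (gauss′ gauss₂₅)) ⟩
        (norm η₂ S.P.* norm η₂) S.P.* (lift η₅₀ S.P.* lift η₅₀) S.P.* e₂₅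
          ≈⟨ S.by 3 (λ n h e → (n S.:* n) S.:* (h S.:* h) S.:* e , (n S.:* h) S.:* (n S.:* h) S.:* e) (norm η₂) (lift η₅₀) e₂₅ ⟩
        (norm η₂ S.P.* lift η₅₀) S.P.* (norm η₂ S.P.* lift η₅₀) S.P.* e₂₅
          ≈⟨ S.P.*-congʳ (S.P.*-cong norm-η₂ norm-η₂) ⟩
        lift η₁₀ S.^ 6 S.P.* lift η₁₀ S.^ 6 S.P.* e₂₅
          ≈⟨ S.by 2 (λ h e → h S.:^ 6 S.:* h S.:^ 6 S.:* e , (h S.:* h) S.:^ 6 S.:* e) (lift η₁₀) e₂₅ ⟩
        (lift η₁₀ S.P.* lift η₁₀) S.^ 6 S.P.* e₂₅
          ≈⟨ S.P.*-congʳ (S.^-congˡ 6 (S.P.sym (gauss′ gauss₅))) ⟩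
        (lift ψ₅ S.P.* e₅) S.^ 6 S.P.* e₂₅
          ≈⟨ S.by 3 (λ p e f → (p S.:* e) S.:^ 6 S.:* f , (e S.:^ 6 S.:* f) S.:* p S.:^ 6) (lift ψ₅) e₅ e₂₅ ⟩
        (e₅ S.^ 6 S.P.* e₂₅) S.P.* lift ψ₅ S.^ 6 ∎)
        where
        open S.PR
        e₅ = lift η₅
        e₂₅ = lift η₂₅
        p₂₅ = lift ψ₂₅
        nm : ∀ f g → norm (f P.* g) S.≋ norm f S.P.* norm g
        nm f g′ = S.P.trans (F.norm-cong (lift-* f g′)) (F.norm-* _ _)
        nc : ∀ {f h} → f S.≋ h → F.norm f S.≋ F.norm h
        nc = F.norm-cong

    normForm : Series
    normForm = A ^ 5 P.+ B ^ 5 P.+ C ^ 5 P.- const (+ 5) P.* (A P.* B P.* C ^ 3) P.+ const (+ 5) P.* (A P.* A P.* B P.* B P.* C)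

    private
      l+ : ∀ {f g f′ g′} → lift f S.≋ f′ → lift g S.≋ g′ → lift (f P.+ g) S.≋ f′ S.P.+ g′
      l+ p q = S.P.trans (lift-+ _ _) (S.P.+-cong p q)
      l* : ∀ {f g f′ g′} → lift f S.≋ f′ → lift g S.≋ g′ → lift (f P.* g) S.≋ f′ S.P.* g′
      l* p q = S.P.trans (lift-* _ _) (S.P.*-cong p q)
      l- : ∀ {f f′} → lift f S.≋ f′ → lift (P.- f) S.≋ S.P.- f′
      l- p = S.P.trans (lift-neg _) (S.P.-‿cong p)
      l^ : ∀ {f f′} n → lift f S.≋ f′ → lift (f ^ n) S.≋ f′ S.^ n
      l^ n p = S.P.trans (lift-^ _ n) (S.^-congˡ n p)

      A′ B′ C′ : S.Series
      A′ = d (lift a)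
      B′ = S.X S.P.* d (lift b)
      C′ = S.X S.^ 3 S.P.* d (lift ψ₅)
      lA : lift A S.≋ A′
      lA = lift₅ a
      lB : lift B S.≋ B′
      lB = l* lift-X (lift₅ b)
      lC : lift C S.≋ C′
      lC = l* (l^ 3 lift-X) (lift₅ ψ₅)

    -- Both sides are integral, and ℤ embeds into ℤ[ζ], so the identity descends.
    ψ-normForm : normForm P.* ψ₂₅ ≋ ψ₅ ^ 6
    ψ-normForm = lift-injective embed-injective (begin
      lift (normForm P.* ψ₂₅) ≈⟨ l* (l+ (l+ (l+ (l+ (l^ 5 lA) (l^ 5 lB)) (l^ 5 lC)) (l- (l* (lift-const (+ 5)) (l* (l* lA lB) (l^ 3 lC)))))
          (l* (lift-const (+ 5)) (l* (l* (l* (l* lA lA) lB) lB) lC))) S.P.refl ⟩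
      _ S.P.* lift ψ₂₅ ≈⟨ S.P.*-congʳ (S.P.sym (F.norm-classes (lift a) (lift b) (lift ψ₅))) ⟩
      F.norm (A′ S.P.+ B′ S.P.+ C′) S.P.* lift ψ₂₅
        ≈⟨ S.P.*-congʳ (F.norm-cong (S.P.sym (S.P.trans (lift-cong ψ-split) (l+ (l+ lA lB) lC)))) ⟩
      norm ψ S.P.* lift ψ₂₅ ≈⟨ norm-ψ ⟩
      lift ψ₅ S.^ 6 ≈⟨ S.P.sym (lift-^ ψ₅ 6) ⟩
      lift (ψ₅ ^ 6) ∎)
      where open S.PR

-- The modular equation and the expansion of Z in y

module ModularEquations where
  open ProductsAndEuler
  open TriangularSeries
  open Dissections
  open ClassEquations
  open Parametrisation
  open NormOfψ
  open P using (_+_; _*_; -_; _-_)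
  open Classes
  open Parameters
  open ψ-Norm using (normForm; ψ-normForm)

  open Solver seriesRing const-hom using (⟦_⟧; var)

  𝕧 : Polynomial 1
  𝕧 = var zero

  -- Polynomials stay syntactic, so that U can exchange the argument S for s in one and the same
  -- coefficient.
  value : Polynomial 1 → Series → Series
  value p f = ⟦ p ⟧ (f ∷ [])

  value₂ : (Polynomial 2 → Polynomial 2 → Polynomial 2) → Series → Series → Series
  value₂ p f g = ⟦ p (var zero) (var (suc zero)) ⟧ (f ∷ g ∷ [])

  module Hauptmodul where
    -- h is the denominator of w, and G that of S = K / (1 + K - K²), the identity reached in `SG`.
    h G 1/ψ s₁ s S : Series
    h = P.1# - K
    G = P.1# + K - K * K
    1/ψ = recip ψ ψ-monic
    s₁ = ψ₅ * ψ₅ * (1/ψ * 1/ψ)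
    s = X * s₁
    S = dilate 5 s

    s₁-monic : Monic s₁
    s₁-monic = monic-* {ψ₅ * ψ₅} {1/ψ * 1/ψ} (monic-* {ψ₅} {ψ₅} (monic-dilate 5 ψ-monic) (monic-dilate 5 ψ-monic))
      (monic-* {1/ψ} {1/ψ} (recip-monic ψ ψ-monic) (recip-monic ψ ψ-monic))

    S-eq : S ≋ X ^ 5 * dilate 5 s₁
    S-eq = P.trans (dilate-* 5 X s₁) (P.*-congʳ (dilate-X 5))

    s-regular : Regular s
    s-regular = *-regular X-regular (monic-regular s₁-monic)

    S-regular : Regular S
    S-regular = ≋-regular (P.sym S-eq) (*-regular (^-regular X-regular 5) (monic-regular (monic-dilate 5 {s₁} s₁-monic)))

    s-ψ : s * (ψ * ψ) ≋ X * (ψ₅ * ψ₅)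
    s-ψ = combine₁ (by 4 (λ x f g i → (x :* (f :* f :* (i :* i))) :* (g :* g) , x :* (f :* f) :+
        (x :* f :* f :* (g :* i :+ κ 1)) :* (g :* i :- κ 1))
      X ψ₅ ψ 1/ψ) (recip-inverse ψ ψ-monic)

    S-ψ : S * (ψ₅ * ψ₅) ≋ X ^ 5 * (ψ₂₅ * ψ₂₅)
    S-ψ = P.trans (P.sym (P.trans (dilate-* 5 s (ψ * ψ)) (P.*-congˡ (dilate-* 5 ψ ψ))))
      (P.trans (dilate-cong 5 s-ψ) (P.trans (dilate-* 5 X (ψ₅ * ψ₅)) (P.*-cong (dilate-X 5) (dilate-* 5 ψ₅ ψ₅))))

    -- The norm equation will contain C⁶; this turns it into a multiple of S³.
    C² : C * C ≋ X * (S * (ψ₅ * ψ₅))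
    C² = P.trans (by 2 (λ x c → (x :^ 3 :* c) :* (x :^ 3 :* c) , x :* (x :^ 5 :* (c :* c))) X ψ₂₅) (P.*-congˡ (P.sym S-ψ))

    G-monic : Monic G
    G-monic = 1+X*-monic {g = u * V * V * (P.1# - K)} (by 3 (λ x u v → let k = x :* u :* v :* v in
      κ 1 :+ k :- k :* k , κ 1 :+ x :* (u :* v :* v :* (κ 1 :- k))) X u V)

    -- The factor h⁴ clears the denominators of w, and U occurs only through U⁵ w² = K. Up to δ⁵
    -- everything is then a polynomial in K, which factors with (1 + K)⁴ G³.
    K³-normForm : K ^ 3 * normForm ≋ C ^ 5 * G ^ 3
    K³-normForm = cancel (^-regular (monic-regular 1-K-monic) 4) (begin
      h ^ 4 * (K ^ 3 * normForm)
        ≈⟨ P.*-congˡ (P.*-congˡ (replace 3 (λ { (a ∷ b ∷ c ∷ []) → a :^ 5 :+ b :^ 5 :+ c :^ 5 :- κ 5 :* (a :* b :* c :^ 3) :+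
            κ 5 :* (a :* a :* b :* b :* c) }) (A-K ∷ B-K ∷ C-K ∷ []))) ⟩
      _ ≈⟨ by 5 (λ k d u w h → let a = d :* (κ 1 :+ k); b = d :* u :* w :* (κ 1 :+ k); c = d :* u :^ 3 :* w :^ 2; m = u :^ 5 :* w :^ 2; v = w :* h in
            h :^ 4 :* (k :^ 3 :* (a :^ 5 :+ b :^ 5 :+ c :^ 5 :- κ 5 :* (a :* b :* c :^ 3) :+ κ 5 :* (a :* a :* b :* b :* c))) ,
            d :^ 5 :* k :^ 3 :* (h :^ 4 :* (κ 1 :+ k) :^ 5 :+ (κ 1 :+ k) :^ 5 :* m :* h :* v :^ 3 :+ m :^ 3 :* v :^ 4 :- κ 5 :* (κ 1 :+
                k) :^ 2 :* m :^ 2 :* h :* v :^ 3 :+ κ 5 :* (κ 1 :+ k) :^ 4 :* m :* h :^ 2 :* v :^ 2))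
            K δ U w h ⟩
      _ ≈⟨ replace 5 (λ { (k ∷ d ∷ m ∷ h ∷ v ∷ []) →
            d :^ 5 :* k :^ 3 :* (h :^ 4 :* (κ 1 :+ k) :^ 5 :+ (κ 1 :+ k) :^ 5 :* m :* h :* v :^ 3 :+ m :^ 3 :* v :^ 4 :- κ 5 :* (κ 1 :+
                k) :^ 2 :* m :^ 2 :* h :* v :^ 3 :+ κ 5 :* (κ 1 :+ k) :^ 4 :* m :* h :^ 2 :* v :^ 2) })
            (P.refl {K} ∷ P.refl {δ} ∷ P.sym K-eq ∷ P.refl {h} ∷ w-eq ∷ []) ⟩
      _ ≈⟨ by 2 (λ k d → let h = κ 1 :- k; v = κ 1 :+ k; m = k in
            d :^ 5 :* k :^ 3 :* (h :^ 4 :* (κ 1 :+ k) :^ 5 :+ (κ 1 :+ k) :^ 5 :* m :* h :* v :^ 3 :+ m :^ 3 :* v :^ 4 :- κ 5 :* (κ 1 :+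
                k) :^ 2 :* m :^ 2 :* h :* v :^ 3 :+ κ 5 :* (κ 1 :+ k) :^ 4 :* m :* h :^ 2 :* v :^ 2) ,
            d :^ 5 :* k :^ 3 :* (κ 1 :+ k) :^ 4 :* (κ 1 :+ k :- k :* k) :^ 3) K δ ⟩
      _ ≈⟨ replace 4 (λ { (k ∷ d ∷ m ∷ v ∷ []) → d :^ 5 :* m :^ 3 :* v :^ 4 :* (κ 1 :+ k :- k :* k) :^ 3 }) (P.refl {K} ∷ P.refl {δ} ∷ K-eq
          ∷ P.sym w-eq ∷ []) ⟩
      _ ≈⟨ by 5 (λ k d u w h → d :^ 5 :* (u :^ 5 :* w :^ 2) :^ 3 :* (w :* h) :^ 4 :* (κ 1 :+ k :- k :* k) :^ 3 ,
          h :^ 4 :* ((d :* u :^ 3 :* w :^ 2) :^ 5 :* (κ 1 :+ k :- k :* k) :^ 3))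
            K δ U w h ⟩
      _ ≈⟨ P.*-congˡ (P.*-congʳ (^-congˡ 5 (P.sym C-K))) ⟩
      h ^ 4 * (C ^ 5 * G ^ 3) ∎)
      where open PR

    -- Equates the norm of ψ computed from its classes with the norm computed from products.
    K³ : K ^ 3 ≋ (S * G) ^ 3
    K³ = cancel (*-regular (^-regular X-regular 3) (^-regular (monic-regular (monic-dilate 5 ψ-monic)) 6)) (begin
      X ^ 3 * ψ₅ ^ 6 * K ^ 3 ≈⟨ P.*-congʳ (P.*-congˡ (P.sym ψ-normForm)) ⟩
      X ^ 3 * (normForm * ψ₂₅) * K ^ 3 ≈⟨ by 4 (λ x n p k → x :^ 3 :* (n :* p) :* k :^ 3 , (k :^ 3 :* n) :* (x :^ 3 :* p)) X normForm ψ₂₅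
          K ⟩
      (K ^ 3 * normForm) * C ≈⟨ P.*-congʳ K³-normForm ⟩
      C ^ 5 * G ^ 3 * C ≈⟨ by 2 (λ c g → c :^ 5 :* g :^ 3 :* c , (c :* c) :^ 3 :* g :^ 3) C G ⟩
      (C * C) ^ 3 * G ^ 3 ≈⟨ P.*-congʳ (^-congˡ 3 C²) ⟩
      (X * (S * (ψ₅ * ψ₅))) ^ 3 * G ^ 3 ≈⟨ by 4 (λ x s p g → (x :* (s :* (p :* p))) :^ 3 :* g :^ 3 , x :^ 3 :* p :^ 6 :* (s :* g) :^ 3) X S
          ψ₅ G ⟩
      X ^ 3 * ψ₅ ^ 6 * (S * G) ^ 3 ∎)
      where open PR

    -- x³ = y³ forces x = y here because x² + x y + y² has leading coefficient 3.
    SG : S * G ≋ K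
    SG = P.sym (equal (quadratic-regular (P.trans (by 2 (λ x y → (x :* x :+ x :* y :+ y :* y) :* (x :- y) , x :^ 3 :- y :^ 3) K (S * G))
        (difference K³))))
      where
      k₁ = u * v * v
      s₅ = dilate 5 s₁ * G
      k₁-monic : Monic k₁
      k₁-monic = monic-* {u * v} {v} (monic-* {u} {v} u-monic v-monic) v-monic
      s₅-monic : Monic s₅
      s₅-monic = monic-* {dilate 5 s₁} {G} (monic-dilate 5 {s₁} s₁-monic) G-monic
      head₃ : (k₁ * k₁ + k₁ * s₅ + s₅ * s₅) 0 ≡ + 3
      head₃ = ≡.trans (⊕-at _ _ 0) (≡.cong₂ ℤ._+_ (≡.trans (⊕-at _ _ 0) (≡.cong₂ ℤ._+_ (monic-* {k₁} {k₁} k₁-monic k₁-monic)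
          (monic-* {k₁} {s₅} k₁-monic s₅-monic))) (monic-* {s₅} {s₅} s₅-monic s₅-monic))
      quadratic-regular : Regular (K * K + K * (S * G) + (S * G) * (S * G))
      quadratic-regular = ≋-regular (P.trans (by 5 (λ x u v s g →
          let k = u :* v :* v; t = s :* g; k′ = (x :* u) :* (x :^ 2 :* v) :* (x :^ 2 :* v); t′ = (x :^ 5 :* s) :* g in
          x :^ 10 :* (k :* k :+ k :* t :+ t :* t) , k′ :* k′ :+ k′ :* t′ :+ t′ :* t′) X u v (dilate 5 s₁) G)
        (replace 3 (λ { (k ∷ s ∷ g ∷ []) → k :* k :+ k :* (s :* g) :+ (s :* g) :* (s :* g) }) (P.refl {K} ∷ P.sym S-eq ∷ P.refl {G} ∷ [])))
        (*-regular (^-regular X-regular 10) (integer-regular (k₁ * k₁ + k₁ * s₅ + s₅ * s₅) head₃))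

    -- y = S ψ / C = q² ψ(q) ψ(q²⁵) / ψ(q⁵)². Its summands S, α and β are S C / C, S A / C and S B /
    -- C, the parts of y with exponents congruent to 0, 2 and 3 modulo 5.
    γ₁ α β y : Series
    γ₁ = recip G G-monic
    α = γ₁ * (U * U * (P.1# + K))
    β = γ₁ * (U ^ 3 * w * (P.1# + K))
    y = S + α + β

    -- Ramanujan's formula for R⁵ without denominators; it eliminates U⁵ in the computations below.
    Kh² : U ^ 5 * (P.1# + K) ^ 2 ≋ K * h ^ 2
    Kh² = P.trans (P.*-congˡ (^-congˡ 2 (P.sym w-eq))) (P.trans (by 3 (λ u w h → u :^ 5 :* (w :* h) :^ 2 , (u :^ 5 :* w :^ 2) :* h :^ 2) U w
        h) (P.*-congʳ (P.sym K-eq)))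

    αG : α * G ≋ U * U * (P.1# + K)
    αG = combine₁ (by 3 (λ i g n → (i :* n) :* g , n :+ n :* (g :* i :- κ 1)) γ₁ G (U * U * (P.1# + K))) (recip-inverse G G-monic)

    βGh : β * (G * h) ≋ U ^ 3 * (P.1# + K) ^ 2
    βGh = combine₂ (by 6 (λ i g u w k h → (i :* (u :^ 3 :* w :* (κ 1 :+ k))) :* (g :* h) , u :^ 3 :* (κ 1 :+ k) :^ 2 :+
        (u :^ 3 :* w :* (κ 1 :+ k) :* h) :* (g :* i :- κ 1) :+ (u :^ 3 :* (κ 1 :+ k)) :* (w :* h :- (κ 1 :+ k)))
      γ₁ G U w K h) (recip-inverse G G-monic) w-eq

    yGh : y * (G * h) ≋ K * h + U * U * (P.1# + K) * h + U ^ 3 * (P.1# + K) ^ 2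
    yGh = combine₃ (by 8 (λ s a b g h k m n → (s :+ a :+ b) :* (g :* h) , k :* h :+ m :* h :+ n :+ h :* (s :* g :- k) :+ h :* (a :* g :- m)
        :+ κ 1 :* (b :* (g :* h) :- n))
      S α β G h K (U * U * (P.1# + K)) (U ^ 3 * (P.1# + K) ^ 2)) SG αG βGh

    αC : α * C ≋ S * A
    αC = cancel (monic-regular G-monic) (P.trans (by 3 (λ a g c → g :* (a :* c) , (a :* g) :* c) α G C)
      (P.trans (P.*-cong αG C-K) (P.trans (by 4 (λ u k d w → (u :* u :* (κ 1 :+ k)) :* (d :* u :^ 3 :* w :^ 2) ,
          (u :^ 5 :* w :^ 2) :* (d :* (κ 1 :+ k))) U K δ w)
      (P.trans (P.*-cong (P.sym K-eq) (P.sym A-K)) (P.trans (P.*-congʳ (P.sym SG)) (by 3 (λ s g a → (s :* g) :* a , g :* (s :* a)) S G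
          A))))))

    βC : β * C ≋ S * B
    βC = cancel (monic-regular G-monic) (P.trans (combine₁ (by 4 (λ i n g c → g :* ((i :* n) :* c) , n :* c :+ (n :* c) :* (g :* i :- κ 1))
        γ₁ (U ^ 3 * w * (P.1# + K)) G C) (recip-inverse G G-monic))
      (P.trans (P.*-congˡ C-K) (P.trans (by 4 (λ u k d w → (u :^ 3 :* w :* (κ 1 :+ k)) :* (d :* u :^ 3 :* w :^ 2) ,
          (u :^ 5 :* w :^ 2) :* (d :* u :* w :* (κ 1 :+ k))) U K δ w)
      (P.trans (P.*-cong (P.sym K-eq) (P.sym B-K)) (P.trans (P.*-congʳ (P.sym SG)) (by 3 (λ s g a → (s :* g) :* a , g :* (s :* a)) S G
          B))))))

    yC : y * C ≋ S * ψ
    yC = P.trans (combine₂ (by 6 (λ s a b c A B → (s :+ a :+ b) :* c , s :* (A :+ B :+ c) :+ κ 1 :* (a :* c :- s :* A) :+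
        κ 1 :* (b :* c :- s :* B)) S α β C A B) αC βC)
      (P.*-congˡ (P.sym ψ-split))

    C-regular : Regular C
    C-regular = *-regular (^-regular X-regular 3) (monic-regular ψ₂₅-monic)

    y-regular : Regular y
    y-regular {f} p = *-regular S-regular (monic-regular ψ-monic) (P.trans (P.*-congʳ (P.sym yC)) (P.trans
      (by 3 (λ y c f → (y :* c) :* f , c :* (y :* f)) y C f) (P.trans (P.*-congˡ p) (P.zeroʳ _))))

    sy² : s * (y * y) ≋ S
    sy² = cancel (*-regular C-regular C-regular) (begin
      C * C * (s * (y * y)) ≈⟨ by 3 (λ c s y → c :* c :* (s :* (y :* y)) , s :* ((y :* c) :* (y :* c))) C s y ⟩
      s * ((y * C) * (y * C)) ≈⟨ P.*-congˡ (P.*-cong yC yC) ⟩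
      s * ((S * ψ) * (S * ψ)) ≈⟨ by 3 (λ S s y → s :* ((S :* y) :* (S :* y)) , (S :* S) :* (s :* (y :* y))) S s ψ ⟩
      S * S * (s * (ψ * ψ)) ≈⟨ P.*-congˡ s-ψ ⟩
      S * S * (X * (ψ₅ * ψ₅)) ≈⟨ by 3 (λ S x p → S :* S :* (x :* p) , x :* (S :* p) :* S) S X (ψ₅ * ψ₅) ⟩
      X * (S * (ψ₅ * ψ₅)) * S ≈⟨ P.*-congʳ (P.sym C²) ⟩
      C * C * S ∎)
      where open PR

    -- U⁵ occurs once and becomes K h² by `Kh²`; then (1 - K)(1 + K) = G - K yields S (1 - S).
    αβ : α * β ≋ S - S * S
    αβ = cancel (*-regular (^-regular (monic-regular G-monic) 2) (monic-regular 1-K-monic)) (begin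
      G ^ 2 * h * (α * β) ≈⟨ by 4 (λ g h a b → g :^ 2 :* h :* (a :* b) , (a :* g) :* (b :* (g :* h))) G h α β ⟩
      (α * G) * (β * (G * h)) ≈⟨ P.*-cong αG βGh ⟩
      _ ≈⟨ by 2 (λ u k → (u :* u :* (κ 1 :+ k)) :* (u :^ 3 :* (κ 1 :+ k) :^ 2) , (κ 1 :+ k) :* (u :^ 5 :* (κ 1 :+ k) :^ 2)) U K ⟩
      _ ≈⟨ P.*-congˡ Kh² ⟩
      _ ≈⟨ by 1 (λ k → (κ 1 :+ k) :* (k :* (κ 1 :- k) :^ 2) , (κ 1 :- k) :* (k :* (κ 1 :+ k :- k :* k :- k))) K ⟩
      h * (K * (G - K)) ≈⟨ P.*-congˡ (P.*-cong (P.sym SG) (P.+-congˡ (P.-‿cong (P.sym SG)))) ⟩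
      h * ((S * G) * (G - S * G)) ≈⟨ by 3 (λ h g s → h :* ((s :* g) :* (g :- s :* g)) , g :^ 2 :* h :* (s :- s :* s)) h G S ⟩
      G ^ 2 * h * (S - S * S) ∎)
      where open PR

    -- Both α⁵ and β⁵ are rational in K, and K ↦ -1/K exchanges them while it fixes S. This is why
    -- their sum depends on S alone.
    α⁵+β⁵ : α ^ 5 + β ^ 5 ≋ S ^ 2 * (P.1# - S) ^ 3 - const (+ 2) * S ^ 3 * (P.1# - S) ^ 2 + const (+ 8) * S ^ 4 * (P.1# - S)
    α⁵+β⁵ = cancel (*-regular (^-regular (monic-regular G-monic) 5) (^-regular (monic-regular 1-K-monic) 5)) (begin
      G ^ 5 * h ^ 5 * (α ^ 5 + β ^ 5) ≈⟨ by 4 (λ g h a b → g :^ 5 :* h :^ 5 :* (a :^ 5 :+ b :^ 5) , (a :* g) :^ 5 :* h :^ 5 :+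
          (b :* (g :* h)) :^ 5) G h α β ⟩
      _ ≈⟨ P.+-cong (P.*-congʳ (^-congˡ 5 αG)) (^-congˡ 5 βGh) ⟩
      -- The cofactor is the quotient of the difference by U⁵ (1 + K)² - K h², arranged in powers of
      -- U⁵.
      _ ≈⟨ combine₁ (by 2 (λ u k → let g = κ 1 :+ k :- k :* k; h = κ 1 :- k in
             (u :* u :* (κ 1 :+ k)) :^ 5 :* h :^ 5 :+ (u :^ 3 :* (κ 1 :+ k) :^ 2) :^ 5 ,
             (k :^ 2 :* (g :- k) :^ 3 :- κ 2 :* k :^ 3 :* (g :- k) :^ 2 :+ κ 8 :* k :^ 4 :* (g :- k)) :* h :^ 5
             :+ ((k :* (κ 1 :+ k :* (:- κ 5 :+
                 k :* (κ 14 :+ k :* (:- κ 18 :+ k :^ 2 :* (κ 20 :+ k :* (:- κ 14 :+ k :* (κ 2 :+ k :* (:- κ 1 :+ k :* (κ 1))))))))) :+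
                 u :^ 5 :* ((κ 1 :+ k :* (:- κ 1 :+
                 k :* (κ 2 :+ k :* (κ 10 :+ k :* (:- κ 4 :+ k :* (:- κ 16 :+ k :* (:- κ 2 :+ k :* (κ 6 :+ k :* (κ 3 :+ k :* (κ 1))))))))))
                 :+ u :^ 5 :* ((κ 1 :+ k :* (κ 8 :+
                 k :* (κ 28 :+ k :* (κ 56 :+ k :* (κ 70 :+ k :* (κ 56 :+ k :* (κ 28 :+ k :* (κ 8 :+ k :* (κ 1))))))))))))) :*
                 (u :^ 5 :* (κ 1 :+ k) :^ 2 :- k :* h :^ 2)) U K) Kh² ⟩
      _ ≈⟨ replace 3 (λ { (k ∷ g ∷ h ∷ []) → (k :^ 2 :* (g :- k) :^ 3 :- κ 2 :* k :^ 3 :* (g :- k) :^ 2 :+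
          κ 8 :* k :^ 4 :* (g :- k)) :* h :^ 5 }) (P.sym SG ∷ P.refl {G} ∷ P.refl {h} ∷ []) ⟩
      _ ≈⟨ by 3 (λ s g h → let k = s :* g in (k :^ 2 :* (g :- k) :^ 3 :- κ 2 :* k :^ 3 :* (g :- k) :^ 2 :+
          κ 8 :* k :^ 4 :* (g :- k)) :* h :^ 5 ,
             g :^ 5 :* h :^ 5 :* (s :^ 2 :* (κ 1 :- s) :^ 3 :- κ 2 :* s :^ 3 :* (κ 1 :- s) :^ 2 :+ κ 8 :* s :^ 4 :* (κ 1 :- s))) S G h ⟩
      G ^ 5 * h ^ 5 * _ ∎)
      where open PR

    1-U-U²-monic : Monic (P.1# - U - U * U)
    1-U-U²-monic = 1+X*-monic {g = - (u + u * U)} (by 2 (λ x u → κ 1 :- x :* u :- (x :* u) :* (x :* u) , κ 1 :+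
        x :* (:- (u :+ u :* (x :* u)))) X u)

    -- θ = q η(q²⁵) / η, because η = E₀ (1 - U - U²).
    θ : Series
    θ = U * recip (P.1# - U - U * U) 1-U-U²-monic

    θ-eq : θ * (P.1# - U - U * U) ≋ U
    θ-eq = combine₁ (by 3 (λ u d i → (u :* i) :* d , u :+ u :* (d :* i :- κ 1)) U (P.1# - U - U * U) (recip (P.1# - U - U * U)
        1-U-U²-monic)) (recip-inverse _ 1-U-U²-monic)

    -- S (1 - 5 S)² θ as a polynomial in y over ℤ[S]
    θ-poly : ∀ {n} → Polynomial n → Polynomial n → Polynomial n
    θ-poly s y = s :* s :* (κ 5 :- κ 25 :* s :+ κ 25 :* s :* s) :+ s :* (κ 5 :* s :- κ 2) :* (κ 1 :- κ 5 :* s) :* y :+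
        (κ 15 :* s :* s :- κ 5 :* s) :* y :* y
                 :+ (κ 1 :- κ 5 :* s) :* y :^ 3 :+ y :^ 4

    -- Both sides are rational in U and K. The factor (1 - 5 S)² is explained by the norm 1 - 11 U⁵
    -- - U¹⁰ of the denominator 1 - U - U², which equals G³ (1 - 5 S)² / (1 + K)⁴.
    θ-y : S * (P.1# - const (+ 5) * S) ^ 2 * θ ≋ value₂ θ-poly S y
    θ-y = cancel (*-regular (monic-regular 1-U-U²-monic) (^-regular (*-regular (monic-regular G-monic) (monic-regular 1-K-monic)) 4))
        (P.trans
      (combine₁ (by 6 (λ s t d g h u → d :* (g :* h) :^ 4 :* (s :* (κ 1 :- κ 5 :* s) :^ 2 :* t) ,
          (s :* g) :* g :* h :^ 4 :* (g :- κ 5 :* (s :* g)) :^ 2 :* u :+ ((g :* h) :^ 4 :* s :* (κ 1 :- κ 5 :* s) :^ 2) :* (t :* d :- u))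
        S θ (P.1# - U - U * U) G h U) θ-eq) (begin
      _ ≈⟨ replace 4 (λ { (k ∷ g ∷ h ∷ u ∷ []) → k :* g :* h :^ 4 :* (g :- κ 5 :* k) :^ 2 :* u }) (SG ∷ P.refl {G} ∷ P.refl {h} ∷ P.refl {U}
          ∷ []) ⟩
      -- Again a quotient by U⁵ (1 + K)² - K h², now in powers of U, with n standing for y G h.
      _ ≈⟨ combine₁ (by 2 (λ u k → let g = κ 1 :+ k :- k :* k; h = κ 1 :- k; n = k :* h :+ u :* u :* (κ 1 :+ k) :* h :+ u :^ 3 :* (κ 1 :+ k) :^ 2 in
            k :* g :* h :^ 4 :* (g :- κ 5 :* k) :^ 2 :* u ,
            (κ 1 :- u :- u :* u) :* scaled k g h n :+
                ((k :* (κ 3 :+ k :* (:- κ 14 :+ k :* (κ 13 :+ k :* (κ 12 :+ k :* (:- κ 19 :+ k :* (κ 2 :+ k :* (κ 3))))))) :+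
                u :* ((:- κ 1 :+ k :* (κ 6 :+ k :* (:- κ 6 :+
                k :* (:- κ 26 :+ k :* (κ 48 :+ k :* (:- κ 14 :+ k :* (:- κ 10 :+ k :* (κ 2 :+ k :* (κ 1))))))))) :+
                u :* ((:- κ 2 :+ k :* (κ 3 :+ k :* (κ 16 :+
                k :* (:- κ 27 :+ k :* (:- κ 10 :+ k :* (κ 29 :+ k :* (:- κ 4 :+ k :* (:- κ 5)))))))) :+
                u :* (k :* (:- κ 4 :+ k :* (κ 8 :+ k :* (κ 12 :+ k :* (:- κ 16 :+ k :* (:- κ 12 :+ k :* (κ 8 :+ k :* (κ 4))))))) :+
                u :* ((κ 2 :+ k :* (:- κ 4 :+ k :* (:- κ 6 :+ k :* (κ 8 :+ k :* (κ 6 :+ k :* (:- κ 4 :+ k :* (:- κ 2))))))) :+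
                u :* ((κ 3 :+ k :* (:- κ 8 :+ k :* (:- κ 15 :+
                k :* (κ 14 :+ k :* (κ 21 :+ k :* (:- κ 4 :+ k :* (:- κ 9 :+ k :* (:- κ 2)))))))) :+
                u :* ((κ 7 :+ k :* (:- κ 1 :+ k :* (:- κ 37 :+ k :* (:- κ 29 :+ k :* (κ 21 :+ k :* (κ 29 :+ k :* (κ 9 :+ k :* (κ 1))))))))
                :+ u :* ((κ 9 :+ k :* (κ 22 :+ k :* (:- κ 1 :+ k :* (:- κ 44 :+ k :* (:- κ 41 :+ k :* (:- κ 10 :+ k :* (κ 1))))))) :+
                u :* ((κ 5 :+ k :* (κ 22 :+ k :* (κ 35 :+ k :* (κ 20 :+ k :* (:- κ 5 :+ k :* (:- κ 10 :+ k :* (:- κ 3))))))) :+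
                u :* ((κ 1 :+ k :* (κ 6 :+ k :* (κ 15 :+ k :* (κ 20 :+ k :* (κ 15 :+ k :* (κ 6 :+ k :* (κ 1)))))))))))))))))) :*
                (u :^ 5 :* (κ 1 :+ k) :^ 2 :- k :* h :^ 2)) U K) Kh² ⟩
      _ ≈⟨ P.*-congˡ (replace 4 (λ { (k ∷ g ∷ h ∷ n ∷ []) → scaled k g h n }) (P.sym SG ∷ P.refl {G} ∷ P.refl {h} ∷ P.sym yGh ∷ [])) ⟩
      _ ≈⟨ by 5 (λ s y d g h → d :* scaled (s :* g) g h (y :* (g :* h)) , d :* (g :* h) :^ 4 :* θ-poly s y) S y (P.1# - U - U * U) G h ⟩
      (P.1# - U - U * U) * (G * h) ^ 4 * value₂ θ-poly S y ∎))
      where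
      open PR
      scaled : ∀ {n} → Polynomial n → Polynomial n → Polynomial n → Polynomial n → Polynomial n
      scaled k g h n = k :* k :* (κ 5 :* g :* g :- κ 25 :* k :* g :+ κ 25 :* k :* k) :* h :^ 4 :+
          k :* (κ 5 :* k :- κ 2 :* g) :* (g :- κ 5 :* k) :* n :* h :^ 3
        :+ (κ 15 :* k :* k :- κ 5 :* k :* g) :* n :* n :* h :* h :+ (g :- κ 5 :* k) :* n :^ 3 :* h :+ n :^ 4

    q₁ q₂ q₃ q₄ : ∀ {n} → Polynomial n → Polynomial n
    q₁ S = κ 25 :* S :^ 3 :- κ 5 :* S :^ 2 :- κ 25 :* S :^ 4
    q₂ S = κ 25 :* S :^ 3 :- κ 15 :* S :^ 2
    q₃ S = κ 5 :* S :- κ 15 :* S :^ 2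
    q₄ S = κ 5 :* S

    quinticPoly : ∀ {n} → Polynomial n → Polynomial n → Polynomial n
    quinticPoly S y = q₄ S :* y :^ 4 :+ q₃ S :* y :^ 3 :+ q₂ S :* y :^ 2 :+ q₁ S :* y :+ S :^ 2

    -- α⁵ + β⁵ is a polynomial in α β and e = α + β = y - S, namely e⁵ - 5 α β e³ + 5 (α β)² e; its
    -- known value is the equation.
    quintic : y ^ 5 ≋ value₂ quinticPoly S y
    quintic = combine₂ (by 3 (λ s a b → let y = s :+ a :+ b; e = a :+ b; m = s :- s :* s in
       y :^ 5 , quinticPoly s y
         :+ κ 1 :* ((a :^ 5 :+ b :^ 5) :- (s :^ 2 :* (κ 1 :- s) :^ 3 :- κ 2 :* s :^ 3 :* (κ 1 :- s) :^ 2 :+ κ 8 :* s :^ 4 :* (κ 1 :- s)))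
         :+ (κ 5 :* e :^ 3 :- κ 5 :* (a :* b :+ m) :* e) :* (a :* b :- m)) S α β) α⁵+β⁵ αβ

    modularPoly : ∀ {n} → Polynomial n → Polynomial n → Polynomial n
    modularPoly S s = (κ 55 :* S :- κ 300 :* S :^ 2 :+ κ 875 :* S :^ 3 :- κ 1250 :* S :^ 4 :+ κ 625 :* S :^ 5) :* s :^ 4
      :+ (:- (κ 60 :* S) :+ κ 175 :* S :^ 2 :- κ 250 :* S :^ 3 :+ κ 125 :* S :^ 4) :* s :^ 3
      :+ (κ 35 :* S :- κ 50 :* S :^ 2 :+ κ 25 :* S :^ 3) :* s :^ 2 :+ (:- (κ 10 :* S) :+ κ 5 :* S :^ 2) :* s :+ S

    -- s y ≋ S / y, so this is the modular equation of degree 5 between s(q) and s(q⁵).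
    modular : s ^ 5 ≋ value₂ modularPoly S s
    modular = cancel (^-regular S-regular 4) (P.trans (replace 2 lhs (P.refl {s} ∷ P.sym sy² ∷ [])) (P.trans
      -- The quintic reads o = e with o odd and e even in y. Hence o² = e² involves only y² = S / s
      -- and becomes the equation between s and S.
      (combine₁ (by 2 (λ s y → let S = s :* (y :* y); q₃ = κ 15 :* S :^ 2 :- κ 5 :* S; q₁ = κ 5 :* S :^ 2 :- κ 25 :* S :^ 3 :+ κ 25 :* S :^ 4; q₂ = κ 15 :* S :^ 2 :- κ 25 :* S :^ 3; o = y :* (y :^ 4 :+ q₃ :* y :^ 2 :+ q₁); e = κ 5 :* S :* y :^ 4 :- q₂ :* y :^ 2 :+ S :^ 2 in
          lhs (s ∷ S ∷ []) , rhs (s ∷ S ∷ []) :+ (:- (s :^ 5 :* (o :+ e))) :* (y :^ 5 :- quinticPoly S y)) s y)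
        (P.trans quintic (replace 2 (λ { (S ∷ y ∷ []) → quinticPoly S y }) (P.sym sy² ∷ P.refl {y} ∷ []))))
      (replace 2 rhs (P.refl {s} ∷ sy² ∷ []))))
      where
      lhs rhs : ∀ {n} → Vec (Polynomial n) 2 → Polynomial n
      lhs (s ∷ S ∷ []) = S :^ 4 :* s :^ 5
      rhs (s ∷ S ∷ []) = S :^ 4 :* modularPoly S s

    F Z : Series
    F = recip η η-monic * recip η₂ (monic-dilate 2 η-monic) ^ 2
    Z = X ^ 5 * (η₂₅ * (η₅₀ * η₅₀)) * F

    F-eq : η * (η₂ * η₂) * F ≋ P.1#
    F-eq = combine₂ (by 4 (λ e i f j → e :* (f :* f) :* (i :* j :^ 2) , κ 1 :+ (f :* j) :^ 2 :* (e :* i :- κ 1) :+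
        (f :* j :+ κ 1) :* (f :* j :- κ 1))
      η (recip η η-monic) η₂ (recip η₂ (monic-dilate 2 η-monic))) (recip-inverse η η-monic) (recip-inverse η₂ (monic-dilate 2 η-monic))

    Xη₂₅ : X * η₂₅ ≋ θ * η
    Xη₂₅ = P.trans (combine₂ (by 6 (λ x u n e t d → x :* n , t :* (e :* d) :+ x :* (n :- u :* e) :+ (:- e) :* (t :* d :- x :* u)) X u η₂₅ E₀
        θ (P.1# - U - U * U)) η₂₅-u θ-eq)
      (P.*-congˡ (P.sym η-U))

    -- By y C = S ψ and Gauss's identity at q and q²⁵ the factors of Z y pair up to S (q η(q²⁵) /
    -- η)².
    Zy : Z * y ≋ S * θ ^ 2
    Zy = cancel (*-regular C-regular (*-regular (monic-regular η-monic) (monic-regular η-monic))) (begin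
      C * (η * η) * (Z * y) ≈⟨ by 4 (λ c e z y → c :* (e :* e) :* (z :* y) , z :* (e :* e) :* (y :* c)) C η Z y ⟩
      Z * (η * η) * (y * C) ≈⟨ P.*-congˡ yC ⟩
      Z * (η * η) * (S * ψ) ≈⟨ by 7 (λ x a b f e s p → x :^ 5 :* (a :* (b :* b)) :* f :* (e :* e) :* (s :* p) ,
          s :* (x :^ 5 :* a :* (b :* b)) :* (e :* (p :* e) :* f)) X η₂₅ η₅₀ F η S ψ ⟩
      S * (X ^ 5 * η₂₅ * (η₅₀ * η₅₀)) * (η * (ψ * η) * F) ≈⟨ P.*-cong (P.*-congˡ (P.*-congˡ (P.sym gauss₂₅)))
          (P.trans (P.*-congʳ (P.*-congˡ Gauss.gauss)) F-eq) ⟩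
      S * (X ^ 5 * η₂₅ * (ψ₂₅ * η₂₅)) * P.1# ≈⟨ by 4 (λ s x n p → s :* (x :^ 5 :* n :* (p :* n)) :* κ 1 ,
          s :* (x :^ 3 :* p) :* ((x :* n) :* (x :* n))) S X η₂₅ ψ₂₅ ⟩
      S * C * ((X * η₂₅) * (X * η₂₅)) ≈⟨ P.*-congˡ (P.*-cong Xη₂₅ Xη₂₅) ⟩
      S * C * ((θ * η) * (θ * η)) ≈⟨ by 4 (λ s c t e → s :* c :* ((t :* e) :* (t :* e)) , c :* (e :* e) :* (s :* t :^ 2)) S C θ η ⟩
      C * (η * η) * (S * θ ^ 2) ∎)
      where open PR

    -- The square of `θ-poly`, reduced by the quintic and divided by S, is c₀ S + c₁ y + ... + c₄
    -- y⁴. Dividing by y then turns c₀ S into c₀ s y.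
    c₀ c₁ c₂ c₃ c₄ : ∀ {n} → Polynomial n → Polynomial n
    c₀ s = s :+ κ 40 :* s :^ 2 :- κ 275 :* s :^ 3 :+ κ 875 :* s :^ 4 :- κ 1250 :* s :^ 5 :+ κ 625 :* s :^ 6
    c₁ s = (κ 1 :- κ 5 :* s) :* (s :- κ 25 :* s :^ 2 :+ κ 90 :* s :^ 3 :- κ 175 :* s :^ 4 :+ κ 125 :* s :^ 5)
    c₂ s = s :- κ 80 :* s :^ 2 :+ κ 300 :* s :^ 3 :- κ 500 :* s :^ 4 :+ κ 375 :* s :^ 5
    c₃ s = (κ 1 :- κ 5 :* s) :* (κ 11 :* s :- κ 20 :* s :^ 2 :+ κ 25 :* s :^ 3)
    c₄ s = κ 1 :+ κ 15 :* s :- κ 25 :* s :^ 2 :+ κ 25 :* s :^ 3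

    Z-y : (P.1# - const (+ 5) * S) ^ 4 * Z ≋ value (c₀ 𝕧) S * s * y + value (c₁ 𝕧) S + value (c₂ 𝕧) S * y + value (c₃ 𝕧) S * y ^ 2 + value
        (c₄ 𝕧) S * y ^ 3
    Z-y = cancel (*-regular S-regular (*-regular S-regular y-regular)) (begin
      S * (S * y) * ((P.1# - const (+ 5) * S) ^ 4 * Z)
        ≈⟨ by 4 (λ s y z e → s :* (s :* y) :* (e :^ 4 :* z) , s :* s :* e :^ 4 :* (z :* y)) S y Z (P.1# - const (+ 5) * S) ⟩
      S * S * (P.1# - const (+ 5) * S) ^ 4 * (Z * y) ≈⟨ P.*-congˡ Zy ⟩
      S * S * (P.1# - const (+ 5) * S) ^ 4 * (S * θ ^ 2)
        ≈⟨ by 3 (λ s t e → s :* s :* e :^ 4 :* (s :* t :^ 2) , s :* (s :* e :^ 2 :* t) :^ 2) S θ (P.1# - const (+ 5) * S) ⟩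
      S * (S * (P.1# - const (+ 5) * S) ^ 2 * θ) ^ 2 ≈⟨ P.*-congˡ (^-congˡ 2 θ-y) ⟩
      S * value₂ θ-poly S y ^ 2
        ≈⟨ combine₁ (by 2 (λ s y → s :* θ-poly s y :^ 2 , s :* (s :* (c₀ s :* s :+ c₁ s :* y :+ c₂ s :* y :* y :+ c₃ s :* y :^ 3 :+
            c₄ s :* y :^ 4))
            :+ (s :* ((s :* (κ 1 :+ s :* (κ 15 :+ s :* (:- κ 25))) :+ y :* ((κ 1 :+ s :* (:- κ 5 :+ s :* (κ 15))) :+
                y :* ((κ 2 :+ s :* (:- κ 5)) :+ y :* ((κ 1))))))) :* (y :^ 5 :- (quinticPoly s y))) S y) quintic ⟩
      _ ≈⟨ combine₁ (by 3 (λ S y s → S :* (S :* (c₀ S :* S :+ c₁ S :* y :+ c₂ S :* y :* y :+ c₃ S :* y :^ 3 :+ c₄ S :* y :^ 4)) ,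
            S :* (S :* y) :* (c₀ S :* s :* y :+ c₁ S :+ c₂ S :* y :+ c₃ S :* y :^ 2 :+ c₄ S :* y :^ 3) :+
                (:- (S :* S :* c₀ S)) :* (s :* (y :* y) :- S)) S y s) sy² ⟩
      S * (S * y) * (value (c₀ 𝕧) S * s * y + value (c₁ 𝕧) S + value (c₂ 𝕧) S * y + value (c₃ 𝕧) S * y ^ 2 + value (c₄ 𝕧) S * y ^ 3) ∎)
      where open PR

-- The generating function of a₃

module PartitionSeries where
  open import Defs
  open ProductsAndEuler
  open TriangularSeries
  open P using (_+_; _*_; -_; _-_)

  Σ[_]< : (ℕ → ℕ) → ℕ → ℕ
  Σ[ f ]< n = sum (applyUpTo f n)

  Σ-cong : ∀ {f g} n → (∀ i → f i ≡ g i) → Σ[ f ]< n ≡ Σ[ g ]< n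
  Σ-cong zero    p = ≡.refl
  Σ-cong (suc n) p = ≡.cong₂ ℕ._+_ (p 0) (Σ-cong n (λ i → p (suc i)))

  Σ-zero : ∀ {f} n → (∀ i → f i ≡ 0) → Σ[ f ]< n ≡ 0
  Σ-zero zero    p = ≡.refl
  Σ-zero (suc n) p = ≡.cong₂ ℕ._+_ (p 0) (Σ-zero n (λ i → p (suc i)))

  Σ-truncate : ∀ {f} m n → m ℕ.≤ n → (∀ i → m ℕ.≤ i → f i ≡ 0) → Σ[ f ]< n ≡ Σ[ f ]< m
  Σ-truncate zero    n       _         p = Σ-zero n (λ i → p i z≤n)
  Σ-truncate (suc m) (suc n) (s≤s m≤n) p = ≡.cong (_ ℕ.+_) (Σ-truncate m n m≤n (λ i m≤i → p (suc i) (s≤s m≤i)))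

  module _ (t : ℕ) (ts : List ℕ) where
    part : ℕ → ℕ → ℕ
    part n m with n <? m ℕ.* t
    ... | yes _ = 0
    ... | no  _ = countMultisets ts (n ∸ m ℕ.* t)

    private
      -- The local function `term` of `countMultisets` cannot be named here; the existential lets
      -- unification supply it.
      summand : ∀ n → ∃ λ f → countMultisets (t ∷ ts) n ≡ sum (map f (upTo (suc n)))
      summand n = _ , ≡.refl

      summand≡part : ∀ n m → proj₁ (summand n) m ≡ part n m
      summand≡part n m with n <? m ℕ.* t
      ... | yes _ = ≡.refl
      ... | no  _ = ≡.refl

    countMultisets-∷ : ∀ n → countMultisets (t ∷ ts) n ≡ Σ[ part n ]< (suc n)
    countMultisets-∷ n = ≡.trans (proj₂ (summand n)) (≡.trans (≡.cong sum (map-upTo _ (suc n))) (Σ-cong (suc n) (summand≡part n)))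

    part-0 : ∀ n → part n 0 ≡ countMultisets ts n
    part-0 n with n <? 0
    ... | no _ = ≡.refl

    part-suc : ∀ n m → part (t ℕ.+ n) (suc m) ≡ part n m
    part-suc n m with (t ℕ.+ n) <? (t ℕ.+ m ℕ.* t) | n <? m ℕ.* t
    ... | yes _ | yes _ = ≡.refl
    ... | no  _ | no  _ = ≡.cong (countMultisets ts) (ℕₚ.[m+n]∸[m+o]≡n∸o t n (m ℕ.* t))
    ... | yes p | no ¬q = contradiction (ℕₚ.+-cancelˡ-< t n (m ℕ.* t) p) ¬q
    ... | no ¬p | yes q = contradiction (ℕₚ.+-monoʳ-< t q) ¬p

    part-big : ∀ n m → n ℕ.< m ℕ.* t → part n m ≡ 0
    part-big n m p with n <? m ℕ.* t
    ... | yes _ = ≡.refl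
    ... | no ¬p = contradiction p ¬p

    module _ .{{_ : NonZero t}} where
      countMultisets-small : ∀ n → n ℕ.< t → countMultisets (t ∷ ts) n ≡ countMultisets ts n
      countMultisets-small n n<t = ≡.trans (countMultisets-∷ n) (≡.trans (≡.cong₂ ℕ._+_ (part-0 n)
        (Σ-zero n (λ i → part-big n (suc i) (ℕₚ.<-≤-trans n<t (ℕₚ.m≤m+n t _))))) (ℕₚ.+-identityʳ _))

      -- Either t does not occur, or one copy of it is removed. This is the coefficient form of
      -- multiplication by 1 - qᵗ.
      countMultisets-shift : ∀ n → countMultisets (t ∷ ts) (t ℕ.+ n) ≡ countMultisets ts (t ℕ.+ n) ℕ.+ countMultisets (t ∷ ts) n
      countMultisets-shift n = ≡.trans (countMultisets-∷ (t ℕ.+ n)) (≡.cong₂ ℕ._+_ (part-0 (t ℕ.+ n))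
        (≡.trans (Σ-cong (t ℕ.+ n) (part-suc n)) (≡.trans (Σ-truncate (suc n) (t ℕ.+ n) (ℕₚ.+-monoˡ-≤ n (ℕ.>-nonZero⁻¹ t))
          (λ i n<i → part-big n i (ℕₚ.<-≤-trans n<i (ℕₚ.m≤m*n i t)))) (≡.sym (countMultisets-∷ n)))))

  multisets : List ℕ → Series
  multisets ts n = + countMultisets ts n

  multisets-[] : multisets [] ≋ P.1#
  multisets-[] = pointwise λ { zero → ≡.refl ; (suc n) → ≡.refl }

  multisets-∷ : ∀ t .{{_ : NonZero t}} ts → (1-X^ t) * multisets (t ∷ ts) ≋ multisets ts
  multisets-∷ t ts = P.trans (by 2 (λ x c → (κ 1 :- x) :* c , c :- x :* c) (X ^ t) (multisets (t ∷ ts)))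
    (P.trans (P.+-congʳ recurrence) (by 2 (λ m c → (m :+ c) :- c , m) (multisets ts) (X ^ t * multisets (t ∷ ts))))
    where
    at-split : ∀ n → (n ℕ.< t) ⊎ (∃ λ m → t ℕ.+ m ≡ n) → + countMultisets (t ∷ ts) n ≡ (multisets ts + X ^ t * multisets (t ∷ ts)) n
    at-split n (inj₁ n<t) = ≡.trans (≡.cong +_ (countMultisets-small t ts n n<t)) (≡.sym (≡.trans (⊕-at _ _ n)
      (≡.trans (≡.cong (ℤ._+_ (+ countMultisets ts n)) (≡.trans (agree-at (X^*-vanish t {t} (multisets (t ∷ ts)) ℕₚ.≤-refl) n n<t)
          (const-0-at n))) (ℤₚ.+-identityʳ _))))
    at-split _ (inj₂ (m , ≡.refl)) = ≡.trans (≡.cong +_ (countMultisets-shift t ts m)) (≡.sym (≡.trans (⊕-at _ _ (t ℕ.+ m))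
      (≡.cong (ℤ._+_ (+ countMultisets ts (t ℕ.+ m))) (X^*-at t (multisets (t ∷ ts)) m))))
    recurrence : multisets (t ∷ ts) ≋ multisets ts + X ^ t * multisets (t ∷ ts)
    recurrence = pointwise λ n → at-split n (case n)
      where
      case : ∀ n → (n ℕ.< t) ⊎ (∃ λ m → t ℕ.+ m ≡ n)
      case n with n <? t
      ... | yes n<t = inj₁ n<t
      ... | no  n≮t = inj₂ (ℕₚ.m≤n⇒∃[o]m+o≡n (ℕₚ.≮⇒≥ n≮t))

  multisets-replicate : ∀ c t .{{_ : NonZero t}} ts → (1-X^ t) ^ c * multisets (replicate c t ++ ts) ≋ multisets ts
  multisets-replicate zero    t ts = P.*-identityˡ _
  multisets-replicate (suc c) t ts = P.trans (by 3 (λ e p m → (e :* p) :* m , p :* (e :* m)) (1-X^ t) ((1-X^ t) ^ c)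
      (multisets (t ∷ (replicate c t ++ ts))))
    (P.trans (P.*-congˡ (multisets-∷ t _)) (multisets-replicate c t ts))

  weights : ℕ → Series
  weights = prod< (λ i → (1-X^ (suc i)) ^ colorsOf 3 (suc i))

  multisets-partTypes : ∀ n → weights n * multisets (partTypes 3 n) ≋ P.1#
  multisets-partTypes zero    = P.trans (P.*-identityˡ _) multisets-[]
  multisets-partTypes (suc n) = P.trans (P.*-assoc _ _ _) (P.trans (P.*-congˡ (multisets-replicate (colorsOf 3 (suc n)) (suc n)
      (partTypes 3 n))) (multisets-partTypes n))

  evenPart : ℕ → Series
  evenPart k with k % 2 ℕ.≟ 0
  ... | yes _ = 1-X^ k
  ... | no  _ = P.1#

  -- One of the three colours of an even part belongs to the product over all parts, the other two
  -- to the products over even parts.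
  weights-split : ∀ n → weights n ≋ pochhammer n * (prod< (λ i → evenPart (suc i)) n * prod< (λ i → evenPart (suc i)) n)
  weights-split zero    = by 0 (κ 1 , κ 1 :* (κ 1 :* κ 1))
  weights-split (suc n) = P.trans (P.*-cong (weights-split n) (step (suc n)))
    (by 4 (λ p e a b → (p :* (e :* e)) :* (a :* (b :* b)) , (p :* a) :* ((e :* b) :* (e :* b)))
      (pochhammer n) (prod< (λ i → evenPart (suc i)) n) (1-X^ (suc n)) (evenPart (suc n)))
    where
    step : ∀ k → (1-X^ k) ^ colorsOf 3 k ≋ (1-X^ k) * (evenPart k * evenPart k)
    step k with k % 2 ℕ.≟ 0
    ... | yes _ = by 1 (λ e → e :^ 3 , e :* (e :* e)) (1-X^ k)
    ... | no  _ = by 1 (λ e → e :^ 1 , e :* (κ 1 :* κ 1)) (1-X^ k)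

  evenPart-double : ∀ m → evenPart (2 ℕ.* m) ≋ 1-X^ (2 ℕ.* m)
  evenPart-double m with (2 ℕ.* m) % 2 ℕ.≟ 0
  ... | yes _ = P.refl
  ... | no ¬p = contradiction (≡.trans (≡.cong (_% 2) (ℕₚ.*-comm 2 m)) (m*n%n≡0 m 2)) ¬p

  evenPart-odd : ∀ m → evenPart (suc (2 ℕ.* m)) ≋ P.1#
  evenPart-odd m with suc (2 ℕ.* m) % 2 ℕ.≟ 0
  ... | no _  = P.refl
  ... | yes p = contradiction (≡.trans (≡.sym (≡.trans (≡.cong (λ t → suc t % 2) (ℕₚ.*-comm 2 m)) ([m+kn]%n≡m%n 1 m 2))) p) λ ()

  evenParts : ∀ m → prod< (λ i → evenPart (suc i)) (2 ℕ.* m) ≋ dilate 2 (pochhammer m)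
  evenParts zero    = P.sym (dilate-const 2 _)
  evenParts (suc m) = P.trans (P.reflexive (≡.cong (prod< (λ i → evenPart (suc i))) (e m)))
    (P.trans (P.*-cong (P.trans (P.*-cong (evenParts m) (evenPart-odd m)) (P.*-identityʳ _))
       (P.trans (P.reflexive (≡.cong evenPart (≡.sym (e m)))) (P.trans (evenPart-double (suc m)) (P.sym (Gauss.dilate-1-X^ (suc m))))))
     (P.sym (dilate-* 2 _ _)))
    where
    e : ∀ m → 2 ℕ.* suc m ≡ suc (suc (2 ℕ.* m))
    e = solve-∀

  evenPart-upto : ∀ k → evenPart (suc k) ≋ P.1# upto suc k
  evenPart-upto k with suc k % 2 ℕ.≟ 0
  ... | no _  = upto-refl
  ... | yes _ = upto-trans (upto-+ upto-refl (upto-neg (X^-vanish (suc k) ℕₚ.≤-refl))) (≋⇒upto (by 0 (κ 1 :- κ 0 , κ 1)))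

  evenParts-stable : ∀ n d → prod< (λ i → evenPart (suc i)) (n ℕ.+ d) ≋ prod< (λ i → evenPart (suc i)) n upto suc n
  evenParts-stable n zero    = ≋⇒upto (P.reflexive (≡.cong (prod< (λ i → evenPart (suc i))) (ℕₚ.+-identityʳ n)))
  evenParts-stable n (suc d) = upto-trans (≋⇒upto (P.reflexive (≡.cong (prod< (λ i → evenPart (suc i))) (ℕₚ.+-suc n d))))
    (upto-trans (upto-* (evenParts-stable n d) (upto-mono (s≤s (ℕₚ.m≤m+n n d)) (evenPart-upto (n ℕ.+ d)))) (≋⇒upto (P.*-identityʳ _)))

  weights-upto : ∀ n → weights n ≋ η * (dilate 2 η * dilate 2 η) upto suc n
  weights-upto n = upto-trans (≋⇒upto (weights-split n)) (upto-* (upto-sym (η-upto n)) (upto-* even even))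
    where
    -- `evenParts` covers even lengths, so the product is lengthened from n to 2n factors, which
    -- changes nothing modulo q^(n+1).
    even : prod< (λ i → evenPart (suc i)) n ≋ dilate 2 η upto suc n
    even = upto-trans (upto-sym (evenParts-stable n (n ℕ.+ 0))) (upto-trans (≋⇒upto (evenParts n)) (dilate-upto 2 (upto-sym (η-upto n))))

  partitions : Series
  partitions n = + a 3 n

  module _ (F : Series) (F-eq : η * (dilate 2 η * dilate 2 η) * F ≋ P.1#) where
    -- The value at n is counted with the parts up to n, so the list of parts changes with n. Each
    -- coefficient is compared separately modulo q^(n+1), where the finite product agrees with η
    -- η(q²)².
    partitions≋F : partitions ≋ F
    partitions≋F = pointwise λ n → agree-at (upto-trans (≋⇒upto (P.trans (P.sym (P.*-identityʳ _)) (P.*-congˡ (P.sym F-eq))))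
      (upto-trans (≋⇒upto (by 3 (λ m e f → m :* (e :* f) , (e :* m) :* f) (multisets (partTypes 3 n)) (η * (dilate 2 η * dilate 2 η)) F))
      (upto-trans (upto-* (upto-* (upto-sym (weights-upto n)) upto-refl) upto-refl)
      (≋⇒upto (P.trans (P.*-congʳ (multisets-partTypes n)) (P.*-identityˡ F)))))) n ℕₚ.≤-refl

-- The operator U on powers of y

module TracesOfPowers where
  open ProductsAndEuler
  open TriangularSeries
  open ClassEquations
  open Parametrisation
  open ModularEquations
  open P using (_+_; _*_; -_; _-_)
  open Classes
  open Parameters
  open Hauptmodul
  private module P₁ = Solver seriesRing const-hom

  value-dilate : ∀ p f → value p (dilate 5 f) ≋ dilate 5 (value p f)
  value-dilate (P₁.op P₁.[+] p q) f = P.trans (P.+-cong (value-dilate p f) (value-dilate q f)) (P.sym (dilate-+ 5 _ _))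
  value-dilate (P₁.op P₁.[*] p q) f = P.trans (P.*-cong (value-dilate p f) (value-dilate q f)) (P.sym (dilate-* 5 _ _))
  value-dilate (P₁.con c)         f = P.sym (dilate-const 5 c)
  value-dilate (P₁.var zero)      f = P.refl
  value-dilate (p P₁.:^ n)        f = P.trans (^-congˡ n (value-dilate p f)) (P.sym (dilate-^ 5 _ n))
  value-dilate (P₁.:- p)          f = P.trans (P.-‿cong (value-dilate p f)) (P.sym (dilate-neg 5 _))

  U₅ : Series → Series
  U₅ = section 0

  U-+ : ∀ {f g f′ g′} → U₅ f ≋ f′ → U₅ g ≋ g′ → U₅ (f + g) ≋ f′ + g′
  U-+ p q = P.trans (section-+ 0 _ _) (P.+-cong p q)

  U-dilate : ∀ g {f f′} → U₅ f ≋ f′ → U₅ (dilate 5 g * f) ≋ g * f′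
  U-dilate g {f} p = P.trans (section-dilate 0 g f) (P.*-congˡ p)

  -- The form in which `section-dilate` is used: a coefficient in ℤ[S] leaves U with S = s(q⁵)
  -- replaced by s.
  U-value : ∀ p {f f′} → U₅ f ≋ f′ → U₅ (value p S * f) ≋ value p s * f′
  U-value p q = P.trans (section-cong 0 (P.*-congʳ (value-dilate p s))) (U-dilate (value p s) q)

  U-1 : U₅ P.1# ≋ P.1#
  U-1 = P.trans (section-cong 0 (P.sym (P.trans (P.*-identityˡ _) (dilate-const 5 _)))) (section-same 0 P.1#)

  module Traces where
    private
      1/ψ₅ : Series
      1/ψ₅ = dilate 5 1/ψ

      ψ₂₅-inverse : dilate 5 1/ψ₅ * ψ₂₅ ≋ P.1#
      ψ₂₅-inverse = P.trans (P.*-comm _ _) (P.trans (P.sym (dilate-* 5 ψ₅ 1/ψ₅))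
          (P.trans (dilate-cong 5 (P.trans (P.sym (dilate-* 5 ψ 1/ψ)) (dilate-cong 5 (recip-inverse ψ ψ-monic))))
        (P.trans (dilate-cong 5 (dilate-const 5 _)) (dilate-const 5 _))))

      α′ β′ : Series
      α′ = s₁ * a * 1/ψ₅
      β′ = s₁ * b * 1/ψ₅

      split : ∀ f → dilate 5 (s₁ * f * 1/ψ₅) ≋ dilate 5 s₁ * dilate 5 f * dilate 5 1/ψ₅
      split f = P.trans (dilate-* 5 _ _) (P.*-congʳ (dilate-* 5 s₁ f))

    -- α = S A / C with A in class 0 and C in class 3 modulo 5, so its exponents are congruent to 2.
    -- Likewise those of β are congruent to 3.
    α-class : α ≋ X ^ 2 * dilate 5 α′
    α-class = cancel C-regular (P.trans (P.trans (P.*-comm C α) αC) (P.trans (P.*-congʳ S-eq)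
        (P.sym (P.trans (P.*-congˡ (P.*-congˡ (split a)))
      (combine₁ (by 5 (λ x p s A i → (x :^ 3 :* p) :* (x :^ 2 :* (s :* A :* i)) , x :^ 5 :* s :* A :+ x :^ 5 :* s :* A :* (i :* p :- κ 1)) X
          ψ₂₅ (dilate 5 s₁) A (dilate 5 1/ψ₅)) ψ₂₅-inverse)))))

    β-class : β ≋ X ^ 3 * dilate 5 β′
    β-class = cancel C-regular (P.trans (P.trans (P.*-comm C β) βC) (P.trans (P.*-congʳ S-eq)
        (P.sym (P.trans (P.*-congˡ (P.*-congˡ (split b)))
      (combine₁ (by 5 (λ x p s B i → (x :^ 3 :* p) :* (x :^ 3 :* (s :* B :* i)) , x :^ 5 :* s :* (x :* B) :+
          x :^ 6 :* s :* B :* (i :* p :- κ 1)) X ψ₂₅ (dilate 5 s₁) B′ (dilate 5 1/ψ₅)) ψ₂₅-inverse)))))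

    private
      vanish : ∀ {f} t {_ : True (t ℕ.<? 5)} {_ : False (t ℕ.≟ 0)} k g → f ≋ X ^ (t ℕ.+ 5 ℕ.* k) * dilate 5 g → U₅ f ≋ P.0#
      vanish t {t<5} {t≢0} k g p = P.trans
          (section-cong 0 (P.trans p (P.trans
          (P.*-congʳ (P.trans (^-homo-* X t _)
          (P.*-congˡ (P.sym (P.trans (dilate-^ 5 X k) (P.trans (^-congˡ k (dilate-X 5)) (^-assocʳ X 5 k)))))))
        (P.trans (P.*-assoc _ _ _) (P.*-congˡ (P.sym (dilate-* 5 _ _))))))) (section-other 0 t {t<5} {t≢0} _)

      power : ∀ {f g} m n → f ≋ X ^ m * dilate 5 g → f ^ n ≋ X ^ (m ℕ.* n) * dilate 5 (g ^ n)
      power m n p = P.trans (^-congˡ n p) (P.trans (^-distrib-* (X ^ m) _ n) (P.*-cong (^-assocʳ X m n) (P.sym (dilate-^ 5 _ n))))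

      α^ : ∀ n → α ^ n ≋ X ^ (2 ℕ.* n) * dilate 5 (α′ ^ n)
      α^ n = power 2 n α-class
      β^ : ∀ n → β ^ n ≋ X ^ (3 ℕ.* n) * dilate 5 (β′ ^ n)
      β^ n = power 3 n β-class
      -- None of 2, 4, 6, 8 and 3, 6, 9, 12 is divisible by 5, so U annihilates the powers of α and
      -- β below the fifth.
      sym-+ : U₅ (α + β) ≋ P.0#
      sym-+ = P.trans (U-+ (P.trans (section-cong 0 (P.sym (P.*-identityʳ α))) (vanish 2 0 _ (α^ 1)))
          (P.trans (section-cong 0 (P.sym (P.*-identityʳ β))) (vanish 3 0 _ (β^ 1)))) (P.+-identityˡ _)
      sym₂ : U₅ (α ^ 2 + β ^ 2) ≋ P.0#
      sym₂ = P.trans (U-+ (vanish 4 0 _ (α^ 2)) (vanish 1 1 _ (β^ 2))) (P.+-identityˡ _)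
      sym₃ : U₅ (α ^ 3 + β ^ 3) ≋ P.0#
      sym₃ = P.trans (U-+ (vanish 1 1 _ (α^ 3)) (vanish 4 1 _ (β^ 3))) (P.+-identityˡ _)
      sym₄ : U₅ (α ^ 4 + β ^ 4) ≋ P.0#
      sym₄ = P.trans (U-+ (vanish 3 1 _ (α^ 4)) (vanish 2 2 _ (β^ 4))) (P.+-identityˡ _)

      collect : ∀ {f} t p₁ p₂ p₃ p₄ → f ≋ value t S * P.1# + value p₁ S * (α + β) + value p₂ S * (α ^ 2 + β ^ 2) + value p₃ S
          * (α ^ 3 + β ^ 3) + value p₄ S * (α ^ 4 + β ^ 4) →
                U₅ f ≋ value t s
      collect t p₁ p₂ p₃ p₄ e = P.trans (section-cong 0 e)
          (P.trans (U-+ (U-+ (U-+ (U-+ (U-value t U-1) (U-value p₁ sym-+)) (U-value p₂ sym₂)) (U-value p₃ sym₃)) (U-value p₄ sym₄))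
        (by 5 (λ t a b c d → t :* κ 1 :+ a :* κ 0 :+ b :* κ 0 :+ c :* κ 0 :+ d :* κ 0 , t) (value t s) (value p₁ s) (value p₂ s)
            (value p₃ s) (value p₄ s)))

    -- The values of U on the powers of y. Up to the exponent 4 they follow from α β = S - S²,
    -- beyond it from the quintic; the exponent 9 is needed for y · y⁸ in the first odd row.
    t₀ t₁ t₂ t₃ t₄ t₅ t₆ t₇ t₈ t₉ : Polynomial 1
    t₀ = κ 1
    t₁ = 𝕧
    t₂ = κ 2 :* 𝕧 :- 𝕧 :^ 2
    t₃ = κ 6 :* 𝕧 :^ 2 :- κ 5 :* 𝕧 :^ 3
    t₄ = κ 6 :* 𝕧 :^ 2 :- κ 5 :* 𝕧 :^ 4
    t₅ = 𝕧 :^ 2 :+ κ 25 :* 𝕧 :^ 3 :- κ 25 :* 𝕧 :^ 4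
    t₆ = κ 26 :* 𝕧 :^ 3 :- κ 25 :* 𝕧 :^ 6
    t₇ = κ 7 :* 𝕧 :^ 3 :+ κ 119 :* 𝕧 :^ 4 :- κ 175 :* 𝕧 :^ 5 :+ κ 175 :* 𝕧 :^ 6 :- κ 125 :* 𝕧 :^ 7
    t₈ = κ 126 :* 𝕧 :^ 4 :- κ 125 :* 𝕧 :^ 8
    t₉ = κ 36 :* 𝕧 :^ 4 :+ κ 630 :* 𝕧 :^ 5 :- κ 1290 :* 𝕧 :^ 6 :+ κ 2250 :* 𝕧 :^ 7 :- κ 2250 :* 𝕧 :^ 8 :+ κ 625 :* 𝕧 :^ 9

    Trace : ℕ → Polynomial 1 → Set
    Trace k t = U₅ (y ^ k) ≋ value t s

    private
      m : ∀ {n} → Polynomial n → Polynomial n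
      m s = s :- s :* s

    trace₀ : Trace 0 t₀
    trace₀ = U-1

    trace₁ : Trace 1 t₁
    trace₁ = collect t₁ (κ 1) (κ 0) (κ 0) (κ 0) (by 3 (λ s a b → (s :+ a :+ b) :^ 1 ,
      s :* κ 1 :+ κ 1 :* (a :+ b) :+ κ 0 :* (a :^ 2 :+ b :^ 2) :+ κ 0 :* (a :^ 3 :+ b :^ 3) :+ κ 0 :* (a :^ 4 :+ b :^ 4)) S α β)

    trace₂ : Trace 2 t₂
    trace₂ = collect t₂ (κ 2 :* 𝕧) (κ 1) (κ 0) (κ 0) (combine₁ (by 3 (λ s a b → (s :+ a :+ b) :^ 2 ,
      (κ 2 :* s :- s :^ 2) :* κ 1 :+ (κ 2 :* s) :* (a :+ b) :+ κ 1 :* (a :^ 2 :+ b :^ 2) :+ κ 0 :* (a :^ 3 :+ b :^ 3) :+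
          κ 0 :* (a :^ 4 :+ b :^ 4)
      :+ κ 2 :* (a :* b :- m s)) S α β) αβ)

    trace₃ : Trace 3 t₃
    trace₃ = collect t₃ (κ 3 :* 𝕧 :^ 2 :+ κ 3 :* m 𝕧) (κ 3 :* 𝕧) (κ 1) (κ 0) (combine₁ (by 3 (λ s a b → (s :+ a :+ b) :^ 3 ,
      (κ 6 :* s :^ 2 :- κ 5 :* s :^ 3) :* κ 1 :+ (κ 3 :* s :^ 2 :+ κ 3 :* m s) :* (a :+ b) :+ (κ 3 :* s) :* (a :^ 2 :+ b :^ 2) :+
          κ 1 :* (a :^ 3 :+ b :^ 3) :+ κ 0 :* (a :^ 4 :+ b :^ 4)
      :+ (κ 6 :* s :+ κ 3 :* (a :+ b)) :* (a :* b :- m s)) S α β) αβ)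

    trace₄ : Trace 4 t₄
    trace₄ = collect t₄ (κ 4 :* 𝕧 :^ 3 :+ κ 12 :* 𝕧 :* m 𝕧) (κ 6 :* 𝕧 :^ 2 :+ κ 4 :* m 𝕧) (κ 4 :* 𝕧) (κ 1)
        (combine₁ (by 3 (λ s a b → (s :+ a :+ b) :^ 4 ,
      (κ 6 :* s :^ 2 :- κ 5 :* s :^ 4) :* κ 1 :+ (κ 4 :* s :^ 3 :+ κ 12 :* s :* m s) :* (a :+ b) :+ (κ 6 :* s :^ 2 :+ κ 4 :* m s) :* (a :^ 2
          :+ b :^ 2) :+ (κ 4 :* s) :* (a :^ 3 :+ b :^ 3) :+ κ 1 :* (a :^ 4 :+ b :^ 4)
      :+ (κ 12 :* s :^ 2 :+ κ 12 :* s :* (a :+ b) :+ κ 4 :* (a :^ 2 :+ b :^ 2) :+ κ 6 :* (a :* b :+ m s)) :* (a :* b :- m s)) S α β) αβ)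

    quinticRow : ∀ {n} → Polynomial n → (p₀ p₁ p₂ p₃ p₄ : Polynomial n) → Polynomial n
    quinticRow s p₀ p₁ p₂ p₃ p₄ = q₄ s :* p₄ :+ q₃ s :* p₃ :+ q₂ s :* p₂
      :+ q₁ s :* p₁ :+ (s :^ 2) :* p₀

    private
      step : ∀ k p₀ p₁ p₂ p₃ p₄ → Trace k p₀ → Trace (1 ℕ.+ k) p₁ → Trace (2 ℕ.+ k) p₂ → Trace (3 ℕ.+ k) p₃ → Trace (4 ℕ.+ k) p₄ →
          Trace (5 ℕ.+ k) (quinticRow 𝕧 p₀ p₁ p₂ p₃ p₄)
      step k p₀ p₁ p₂ p₃ p₄ r₀ r₁ r₂ r₃ r₄ = P.trans (section-cong 0 (combine₁ (by 3 (λ s y z → y :* (y :* (y :* (y :* (y :* z)))) ,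
           quinticRow s z (y :* z) (y :* (y :* z)) (y :* (y :* (y :* z))) (y :* (y :* (y :* (y :* z))))
           :+ z :* (y :^ 5 :- (quinticPoly s y))) S y (y ^ k)) quintic))
        (U-+ (U-+ (U-+ (U-+ (U-value (q₄ 𝕧) r₄) (U-value (q₃ 𝕧) r₃)) (U-value (q₂ 𝕧) r₂))
          (U-value (q₁ 𝕧) r₁)) (U-value (𝕧 :^ 2) r₀))

    trace₅ : Trace 5 t₅
    trace₅ = P.trans (step 0 t₀ t₁ t₂ t₃ t₄ trace₀ trace₁ trace₂ trace₃ trace₄) (by 1 (λ _ → quinticRow 𝕧 t₀ t₁ t₂ t₃ t₄ , t₅) s)
    trace₆ : Trace 6 t₆
    trace₆ = P.trans (step 1 t₁ t₂ t₃ t₄ t₅ trace₁ trace₂ trace₃ trace₄ trace₅) (by 1 (λ _ → quinticRow 𝕧 t₁ t₂ t₃ t₄ t₅ , t₆) s)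
    trace₇ : Trace 7 t₇
    trace₇ = P.trans (step 2 t₂ t₃ t₄ t₅ t₆ trace₂ trace₃ trace₄ trace₅ trace₆) (by 1 (λ _ → quinticRow 𝕧 t₂ t₃ t₄ t₅ t₆ , t₇) s)
    trace₈ : Trace 8 t₈
    trace₈ = P.trans (step 3 t₃ t₄ t₅ t₆ t₇ trace₃ trace₄ trace₅ trace₆ trace₇) (by 1 (λ _ → quinticRow 𝕧 t₃ t₄ t₅ t₆ t₇ , t₈) s)
    trace₉ : Trace 9 t₉
    trace₉ = P.trans (step 4 t₄ t₅ t₆ t₇ t₈ trace₄ trace₅ trace₆ trace₇ trace₈) (by 1 (λ _ → quinticRow 𝕧 t₄ t₅ t₆ t₇ t₈ , t₉) s)

    -- S s y = S² / y, so the quintic expresses it through lower powers of y.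
    Ssy : S * (s * y) ≋ y ^ 4 - value₂ (λ S y → q₄ S :* y :^ 3 :+ q₃ S :* y :^ 2 :+ q₂ S :* y :+ q₁ S) S y
    Ssy = cancel y-regular (combine₂ (by 3 (λ S s y → y :* (S :* (s :* y)) , y :* (y :^ 4 :- (q₄ S :* y :^ 3 :+ q₃ S :* y :^ 2 :+
        q₂ S :* y :+ q₁ S))
        :+ S :* (s :* (y :* y) :- S) :+ (:- κ 1) :* (y :^ 5 :- (quinticPoly S y)))
        S s y) sy² quintic)

    -- `Ssy` divided by y. Its last term becomes (25 S - 5 - 25 S²) S² / y, and S² / y = S s y.
    Ss : S * s ≋ y ^ 3 - (value₂ (λ S y → q₄ S :* y :^ 2 :+ q₃ S :* y :+ q₂ S) S y + value (κ 25 :* 𝕧 :- κ 5 :- κ 25 :* 𝕧 :^ 2) S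
        * (S * (s * y)))
    Ss = cancel y-regular (combine₂ (by 3 (λ S s y → y :* (S :* s) , y :* (y :^ 3 :- (q₄ S :* y :^ 2 :+ q₃ S :* y :+ q₂ S :+
        (κ 25 :* S :- κ 5 :- κ 25 :* S :^ 2) :* (S :* (s :* y))))
        :+ κ 1 :* (S :* (s :* y) :- (y :^ 4 :- (q₄ S :* y :^ 3 :+ q₃ S :* y :^ 2 :+ q₂ S :* y :+ q₁ S)))
        :+ (S :* (κ 25 :* S :- κ 5 :- κ 25 :* S :^ 2)) :* (s :* (y :* y) :- S)) S s y) Ssy sy²)

    tSsy tSs : Polynomial 1
    tSsy = 𝕧 :^ 2 :- κ 5 :* 𝕧 :^ 3 :+ κ 5 :* 𝕧 :^ 4
    tSs  = κ 11 :* 𝕧 :^ 2 :- κ 60 :* 𝕧 :^ 3 :+ κ 175 :* 𝕧 :^ 4 :- κ 250 :* 𝕧 :^ 5 :+ κ 125 :* 𝕧 :^ 6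

    private
      U-neg : ∀ {f f′} → U₅ f ≋ f′ → U₅ (- f) ≋ - f′
      U-neg p = P.trans (section-cong 0 (by 1 (λ f → :- f , (:- κ 1) :* f) _)) (P.trans (U-value (:- κ 1) p)
          (by 1 (λ f → (:- κ 1) :* f , :- f) _))
      y¹ : U₅ y ≋ value t₁ s
      y¹ = P.trans (section-cong 0 (P.sym (P.*-identityʳ y))) trace₁
      pure : ∀ p → U₅ (value p S) ≋ value p s
      pure p = P.trans (section-cong 0 (P.sym (P.*-identityʳ _))) (P.trans (U-value p U-1) (P.*-identityʳ _))

    trace-Ssy : U₅ (S * (s * y)) ≋ value tSsy s
    trace-Ssy = P.trans (section-cong 0 Ssy) (P.trans (U-+ trace₄ (U-neg (U-+ (U-+ (U-+ (U-value (q₄ 𝕧) trace₃) (U-value (q₃ 𝕧) trace₂))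
        (U-value (q₂ 𝕧) y¹)) (pure (q₁ 𝕧)))))
      (by 1 (λ _ → t₄ :- ((q₄ 𝕧) :* t₃ :+ (q₃ 𝕧) :* t₂ :+ (q₂ 𝕧) :* t₁ :+ (q₁ 𝕧)) , tSsy) s))

    trace-Ss : U₅ (S * s) ≋ value tSs s
    trace-Ss = P.trans (section-cong 0 Ss) (P.trans (U-+ trace₃ (U-neg (U-+ (U-+ (U-+ (U-value (q₄ 𝕧) trace₂) (U-value (q₃ 𝕧) y¹))
        (pure (q₂ 𝕧))) (U-value (κ 25 :* 𝕧 :- κ 5 :- κ 25 :* 𝕧 :^ 2) trace-Ssy))))
      (by 1 (λ _ → t₃ :- ((q₄ 𝕧) :* t₂ :+ (q₃ 𝕧) :* t₁ :+ (q₂ 𝕧) :+ (κ 25 :* 𝕧 :- κ 5 :- κ 25 :* 𝕧 :^ 2) :* tSsy) , tSs) s))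

-- 5-adic bounds for U on powers of s

module MatrixRows where
  open ProductsAndEuler
  open TriangularSeries
  open ClassEquations
  open Parametrisation
  open ModularEquations
  open TracesOfPowers
  open P using (_+_; _*_; -_; _-_)
  open Hauptmodul
  open Traces

  five : Series
  five = const (+ 5)

  infixl 6 _⊞_
  -- The ℤ-span of the 5ᵛ sʲ with `A v j`, given by derivations instead of coefficient lists, so
  -- that images are found by recursion down to the generators.
  data Span (A : ℕ → ℕ → Set) : Series → Set where
    gen  : ∀ c v j → A v j → Span A (const c * (five ^ v * s ^ j))
    none : Span A P.0#
    _⊞_  : ∀ {f g} → Span A f → Span A g → Span A (f + g)
    resp : ∀ {f g} → f ≋ g → Span A f → Span A g

  span-map : ∀ {A B} → (∀ {v j} → A v j → B v j) → ∀ {f} → Span A f → Span B f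
  span-map h (gen c v j a) = gen c v j (h a)
  span-map h none          = none
  span-map h (p ⊞ q)       = span-map h p ⊞ span-map h q
  span-map h (resp e p)    = resp e (span-map h p)

  span-* : ∀ {A B C : ℕ → ℕ → Set} → (∀ {v j v′ j′} → A v j → B v′ j′ → C (v ℕ.+ v′) (j ℕ.+ j′)) →
           ∀ {f g} → Span A f → Span B g → Span C (f * g)
  span-* h (gen c v j a) (gen d v′ j′ b) = resp (P.trans
      (P.*-cong (const-* c d) (P.*-cong (^-homo-* five v v′) (^-homo-* s j j′)))
      (by 6 (λ c d a b x y → (c :* d) :* ((a :* b) :* (x :* y)) , (c :* (a :* x)) :* (d :* (b :* y)))
        (const c) (const d) (five ^ v) (five ^ v′) (s ^ j) (s ^ j′)))
    (gen (c ℤ.* d) (v ℕ.+ v′) (j ℕ.+ j′) (h a b))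
  span-* h p@(gen _ _ _ _) none       = resp (P.sym (P.zeroʳ _)) none
  span-* h p@(gen _ _ _ _) (q ⊞ r)    = resp (P.sym (P.distribˡ _ _ _)) (span-* h p q ⊞ span-* h p r)
  span-* h p@(gen _ _ _ _) (resp e q) = resp (P.*-congˡ e) (span-* h p q)
  span-* h none       q = resp (P.sym (P.zeroˡ _)) none
  span-* h (p ⊞ p′)   q = resp (P.sym (P.distribʳ _ _ _)) (span-* h p q ⊞ span-* h p′ q)
  span-* h (resp e p) q = resp (P.*-congʳ e) (span-* h p q)

  -- The slope 6/5 is dictated by the modular equation: the terms of `a₀` to `a₄` below satisfy 5 j
  -- + k ≤ 6 v for the index k, with equality at j = v = k. The bounds add under multiplication.
  H : ℕ → ℕ → ℕ → ℕ → Set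
  H a b v j = 5 ℕ.* j ℕ.+ b ℕ.≤ 6 ℕ.* v ℕ.+ a

  H-* : ∀ a b c d {f g} → Span (H a b) f → Span (H c d) g → Span (H (a ℕ.+ c) (b ℕ.+ d)) (f * g)
  H-* a b c d = span-* λ {v} {j} {v′} {j′} p q → ≡.subst₂ ℕ._≤_ (l j j′ b d) (r v v′ a c) (ℕₚ.+-mono-≤ p q)
    where
    l : ∀ j j′ b d → (5 ℕ.* j ℕ.+ b) ℕ.+ (5 ℕ.* j′ ℕ.+ d) ≡ 5 ℕ.* (j ℕ.+ j′) ℕ.+ (b ℕ.+ d)
    l = solve-∀
    r : ∀ v v′ a c → (6 ℕ.* v ℕ.+ a) ℕ.+ (6 ℕ.* v′ ℕ.+ c) ≡ 6 ℕ.* (v ℕ.+ v′) ℕ.+ (a ℕ.+ c)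
    r = solve-∀

  H-weaken : ∀ {a b c d} k → a ℕ.+ d ℕ.+ k ≡ c ℕ.+ b → ∀ {f} → Span (H a b) f → Span (H c d) f
  H-weaken {a} {b} {c} {d} k e = span-map λ {v} {j} p → ℕₚ.+-cancelʳ-≤ b _ _ (≡.subst₂ ℕ._≤_ (l (5 ℕ.* j) b d) (r v)
      (ℕₚ.≤-trans (ℕₚ.+-monoˡ-≤ d p) (ℕₚ.m≤m+n _ k)))
    where
    l : ∀ j b d → j ℕ.+ b ℕ.+ d ≡ j ℕ.+ d ℕ.+ b
    l = solve-∀
    r : ∀ v → 6 ℕ.* v ℕ.+ a ℕ.+ d ℕ.+ k ≡ 6 ℕ.* v ℕ.+ c ℕ.+ b
    r v = ≡.trans (assoc (6 ℕ.* v) a d k) (≡.trans (≡.cong (6 ℕ.* v ℕ.+_) e) (≡.sym (ℕₚ.+-assoc (6 ℕ.* v) c b)))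
      where
      assoc : ∀ x a d k → x ℕ.+ a ℕ.+ d ℕ.+ k ≡ x ℕ.+ (a ℕ.+ d ℕ.+ k)
      assoc = solve-∀

  -- The list entry (c , v) in position j stands for c 5ᵛ sʲ.
  Terms : Set
  Terms = List (ℤ × ℕ)

  terms : ∀ {n} → Terms → ℕ → Polynomial n → Polynomial n
  terms []            j x = κ 0
  terms ((c , v) ∷ l) j x = con c :* (κ 5 :^ v :* x :^ j) :+ terms l (suc j) x

  allowed : (ℕ → ℕ → Bool) → Terms → ℕ → Bool
  allowed A []            j = true
  allowed A ((c , v) ∷ l) j = A v j ∧ allowed A l (suc j)

  span-terms : ∀ {A} (A? : ℕ → ℕ → Bool) → (∀ v j → Bool.T (A? v j) → A v j) → ∀ l j → Bool.T (allowed A? l j) →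
      Span A (value (terms l j 𝕧) s)
  span-terms A? sound []            j ok = resp (pointwise λ { zero → ≡.refl ; (suc n) → ≡.refl }) none
  span-terms A? sound ((c , v) ∷ l) j ok = gen c v j (sound v j (proj₁ both)) ⊞ span-terms A? sound l (suc j) (proj₂ both)
    where both = Equivalence.to T-∧ ok

  series : Terms → Series
  series l = value (terms l 0 𝕧) s

  H? : ℕ → ℕ → ℕ → ℕ → Bool
  H? a b v j = 5 ℕ.* j ℕ.+ b ℕ.≤ᵇ 6 ℕ.* v ℕ.+ a

  H-terms : ∀ a b l → Bool.T (allowed (H? a b) l 0) → Span (H a b) (series l)
  H-terms a b l = span-terms (H? a b) (λ v j → ℕₚ.≤ᵇ⇒≤ _ _) l 0

  pattern neg n = ℤ.-[1+_] n

  -- The coefficients of s⁰ to s⁴ in the modular equation, divided by S.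
  a₀ a₁ a₂ a₃ a₄ : Terms
  a₀ = (+ 1 , 0) ∷ []
  a₁ = (neg 1 , 1) ∷ (+ 1 , 1) ∷ []
  a₂ = (+ 7 , 1) ∷ (neg 1 , 2) ∷ (+ 1 , 2) ∷ []
  a₃ = (neg 11 , 1) ∷ (+ 7 , 2) ∷ (neg 1 , 3) ∷ (+ 1 , 3) ∷ []
  a₄ = (+ 11 , 1) ∷ (neg 11 , 2) ∷ (+ 7 , 3) ∷ (neg 1 , 4) ∷ (+ 1 , 4) ∷ []

  -- x i is S⁴ s^(i-4).
  x : ℕ → Series
  x 0 = y ^ 8
  x 1 = S * y ^ 6
  x 2 = S ^ 2 * y ^ 4
  x 3 = S ^ 3 * y ^ 2
  x (suc (suc (suc (suc i)))) = S ^ 4 * s ^ i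

  x-suc : ∀ i → s * x i ≋ x (suc i)
  x-suc 0 = combine₁ (by 3 (λ S s y → s :* y :^ 8 , S :* y :^ 6 :+ y :^ 6 :* (s :* (y :* y) :- S)) S s y) sy²
  x-suc 1 = combine₁ (by 3 (λ S s y → s :* (S :* y :^ 6) , S :^ 2 :* y :^ 4 :+ (S :* y :^ 4) :* (s :* (y :* y) :- S)) S s y) sy²
  x-suc 2 = combine₁ (by 3 (λ S s y → s :* (S :^ 2 :* y :^ 4) , S :^ 3 :* y :^ 2 :+ (S :^ 2 :* y :^ 2) :* (s :* (y :* y) :- S)) S s y) sy²
  x-suc 3 = combine₁ (by 3 (λ S s y → s :* (S :^ 3 :* y :^ 2) , S :^ 4 :* κ 1 :+ (S :^ 3) :* (s :* (y :* y) :- S)) S s y) sy²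
  x-suc (suc (suc (suc (suc i)))) = by 3 (λ S s r → s :* (S :^ 4 :* r) , S :^ 4 :* (s :* r)) S s (s ^ i)

  x-recurrence : ∀ i → x (5 ℕ.+ i) ≋ value (𝕧 :* terms a₀ 0 𝕧) S * x i + value (𝕧 :* terms a₁ 0 𝕧) S * x (1 ℕ.+ i) + value
      (𝕧 :* terms a₂ 0 𝕧) S * x (2 ℕ.+ i)
                                       + value (𝕧 :* terms a₃ 0 𝕧) S * x (3 ℕ.+ i) + value (𝕧 :* terms a₄ 0 𝕧) S * x (4 ℕ.+ i)
  x-recurrence i = P.trans (P.sym (e₅)) (P.trans
    (combine₁ (by 3 (λ S s r → s :* (s :* (s :* (s :* (s :* r)))) ,
        ((S :* terms a₀ 0 S) :* r :+ (S :* terms a₁ 0 S) :* (s :* r) :+ (S :* terms a₂ 0 S) :* (s :* (s :* r)) :+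
            (S :* terms a₃ 0 S) :* (s :* (s :* (s :* r))) :+ (S :* terms a₄ 0 S) :* (s :* (s :* (s :* (s :* r)))))
        :+ r :* (s :^ 5 :- modularPoly S s)) S s (x i)) modular)
    (P.+-cong (P.+-cong (P.+-cong (P.+-congˡ (P.*-congˡ e₁)) (P.*-congˡ e₂)) (P.*-congˡ e₃)) (P.*-congˡ e₄)))
    where
    e₁ = x-suc i
    e₂ = P.trans (P.*-congˡ e₁) (x-suc (1 ℕ.+ i))
    e₃ = P.trans (P.*-congˡ e₂) (x-suc (2 ℕ.+ i))
    e₄ = P.trans (P.*-congˡ e₃) (x-suc (3 ℕ.+ i))
    e₅ = P.trans (P.*-congˡ e₄) (x-suc (4 ℕ.+ i))

  1-s : Series
  1-s = P.1# - s

  module RowsOf (g : Series) (b : ℕ) where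
    -- Since x i = S⁴ s^(i-4), this says U (g s^(i-4) (1 - s)) = (1 - s) Γ without negative powers.
    -- The bound relaxes by one with each further power of s.
    Row : ℕ → Set
    Row i = ∃ λ Γ → Span (H i b) Γ × U₅ (g * x i * 1-s) ≋ s ^ 4 * (1-s * Γ)

    -- Keeps the factor s that comes from the common factor S of the coefficients of the recurrence.
    Row⁺ : ℕ → Set
    Row⁺ i = ∃ λ Γ → Span (H i b) Γ × U₅ (g * x (5 ℕ.+ i) * 1-s) ≋ s ^ 4 * (1-s * (s * Γ))

    private
      bound : ∀ k l i {Γ} → Bool.T (allowed (H? 0 k) l 0) → Span (H (k ℕ.+ i) b) Γ → Span (H i b) (series l * Γ)
      bound k l i ok p = H-weaken 0 (e k i b) (H-* 0 k (k ℕ.+ i) b (H-terms 0 k l ok) p)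
        where
        e : ∀ k i b → 0 ℕ.+ (k ℕ.+ i) ℕ.+ b ℕ.+ 0 ≡ i ℕ.+ (k ℕ.+ b)
        e = solve-∀

    -- The coefficient of index k satisfies `H 0 k`, which offsets the weaker bound `H (k + i) b` of
    -- the row k places further; so all five summands meet the bound of row i.
    next : ∀ i → Row i → Row (1 ℕ.+ i) → Row (2 ℕ.+ i) → Row (3 ℕ.+ i) → Row (4 ℕ.+ i) → Row⁺ i
    next i (Γ₀ , p₀ , r₀) (Γ₁ , p₁ , r₁) (Γ₂ , p₂ , r₂) (Γ₃ , p₃ , r₃) (Γ₄ , p₄ , r₄) =
      series a₀ * Γ₀ + series a₁ * Γ₁ + series a₂ * Γ₂ + series a₃ * Γ₃ + series a₄ * Γ₄ ,
      (bound 0 a₀ i _ p₀ ⊞ bound 1 a₁ i _ p₁ ⊞ bound 2 a₂ i _ p₂ ⊞ bound 3 a₃ i _ p₃ ⊞ bound 4 a₄ i _ p₄) ,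
      P.trans (section-cong 0 (P.trans (P.*-congʳ (P.*-congˡ (x-recurrence i)))
          (by 12 (λ g e a₀ a₁ a₂ a₃ a₄ x₀ x₁ x₂ x₃ x₄ → g :* (a₀ :* x₀ :+ a₁ :* x₁ :+ a₂ :* x₂ :+ a₃ :* x₃ :+ a₄ :* x₄) :* e ,
              a₀ :* (g :* x₀ :* e) :+ a₁ :* (g :* x₁ :* e) :+ a₂ :* (g :* x₂ :* e) :+ a₃ :* (g :* x₃ :* e) :+ a₄ :* (g :* x₄ :* e))
            g 1-s (value (𝕧 :* terms a₀ 0 𝕧) S) (value (𝕧 :* terms a₁ 0 𝕧) S) (value (𝕧 :* terms a₂ 0 𝕧) S) (value (𝕧 :* terms a₃ 0 𝕧) S)
                (value (𝕧 :* terms a₄ 0 𝕧) S) (x i) (x (1 ℕ.+ i)) (x (2 ℕ.+ i)) (x (3 ℕ.+ i)) (x (4 ℕ.+ i)))))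
       (P.trans (U-+ (U-+ (U-+ (U-+ (U-value (𝕧 :* terms a₀ 0 𝕧) r₀) (U-value (𝕧 :* terms a₁ 0 𝕧) r₁)) (U-value (𝕧 :* terms a₂ 0 𝕧) r₂))
           (U-value (𝕧 :* terms a₃ 0 𝕧) r₃)) (U-value (𝕧 :* terms a₄ 0 𝕧) r₄))
          (by 12 (λ s e a₀ a₁ a₂ a₃ a₄ x₀ x₁ x₂ x₃ x₄ → (s :* a₀) :* (s :^ 4 :* (e :* x₀)) :+ (s :* a₁) :* (s :^ 4 :* (e :* x₁)) :+
              (s :* a₂) :* (s :^ 4 :* (e :* x₂)) :+ (s :* a₃) :* (s :^ 4 :* (e :* x₃)) :+ (s :* a₄) :* (s :^ 4 :* (e :* x₄)) ,
              s :^ 4 :* (e :* (s :* (a₀ :* x₀ :+ a₁ :* x₁ :+ a₂ :* x₂ :+ a₃ :* x₃ :+ a₄ :* x₄))))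
            s 1-s (series a₀) (series a₁) (series a₂) (series a₃) (series a₄) Γ₀ Γ₁ Γ₂ Γ₃ Γ₄))

    -- A factor s costs 5 in the bound, exactly the shift of the index from i to i + 5.
    s-span : ∀ i {Γ} → Span (H i b) Γ → Span (H (5 ℕ.+ i) b) (s * Γ)
    s-span i p = H-* 5 0 i b (resp (P.trans (P.*-identityˡ _) (P.trans (P.*-identityˡ _) (P.*-identityʳ s))) (gen (+ 1) 0 1 ℕₚ.≤-refl)) p

    forget : ∀ i → Row⁺ i → Row (5 ℕ.+ i)
    forget i (Γ , p , r) = s * Γ , s-span i p , r

    Window : ℕ → Set
    Window i = Row i × Row (1 ℕ.+ i) × Row (2 ℕ.+ i) × Row (3 ℕ.+ i) × Row (4 ℕ.+ i)

    advance⁺ : ∀ i → Window i → Row⁺ i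
    advance⁺ i (q₀ , q₁ , q₂ , q₃ , q₄) = next i q₀ q₁ q₂ q₃ q₄

    advance : ∀ i → Window i → Window (suc i)
    advance i (q₀ , q₁ , q₂ , q₃ , q₄) = q₁ , q₂ , q₃ , q₄ , forget i (next i q₀ q₁ q₂ q₃ q₄)

    module _ (r₀ : Row 0) (r₁ : Row 1) (r₂ : Row 2) (r₃ : Row 3) (r₄ : Row 4) where
      window : ∀ i → Window i
      window zero    = r₀ , r₁ , r₂ , r₃ , r₄
      window (suc i) = advance i (window i)

      row⁺ : ∀ i → Row⁺ i
      row⁺ i = advance⁺ i (window i)

      private
        -- x (4 + i) = S⁴ sⁱ, and S⁴ leaves U as the regular factor s⁴.
        descend : ∀ i {Γ} → U₅ (g * x (4 ℕ.+ i) * 1-s) ≋ s ^ 4 * Γ → U₅ (g * s ^ i * 1-s) ≋ Γ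
        descend i {Γ} r = cancel (^-regular s-regular 4) (P.trans (P.sym (U-value (𝕧 :^ 4) P.refl)) (P.trans (section-cong 0
          (by 4 (λ S g r e → S :^ 4 :* (g :* r :* e) , g :* (S :^ 4 :* r) :* e) S g (s ^ i) 1-s)) r))

      image⁺ : ∀ i → ∃ λ Γ → Span (H i b) Γ × U₅ (g * s ^ suc i * 1-s) ≋ 1-s * (s * Γ)
      image⁺ i = let (Γ , p , r) = row⁺ i in Γ , p , descend (suc i) r

      image : ∀ i → ∃ λ Γ → Span (H (4 ℕ.+ i) b) Γ × U₅ (g * s ^ i * 1-s) ≋ 1-s * Γ
      image i = let (_ , _ , _ , _ , Γ , p , r) = window i in Γ , p , descend i r

  module BaseRows where
    open Traces
    private
      -- As s y² = S, the product of an initial x i with 1 - s is a difference of two monomials in S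
      -- and y, whose traces are known.
      low : ∀ {f} i k l {t t′} (Γ : Terms) → f ≋ S ^ i * y ^ k - S ^ suc i * y ^ l → Trace k t → Trace l t′ →
            value (𝕧 :^ i :* t :- 𝕧 :^ suc i :* t′) s ≋ s ^ 4 * (1-s * series Γ) → U₅ f ≋ s ^ 4 * (1-s * series Γ)
      low i k l {t} {t′} Γ e p q r = P.trans (section-cong 0 (P.trans e (by 2 (λ a b → a :- b , a :+ (:- κ 1) :* b) (S ^ i * y ^ k)
          (S ^ suc i * y ^ l))))
        (P.trans (U-+ (U-value (𝕧 :^ i) p) (U-value (:- κ 1) (U-value (𝕧 :^ suc i) q)))
        (P.trans (by 2 (λ a b → a :+ (:- κ 1) :* b , a :- b) (s ^ i * value t s) (s ^ suc i * value t′ s)) r))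

    -- The offset 2, available in the absence of y, is what later forces a factor 5; with y the
    -- offset is 0.
    module Even = RowsOf P.1# 2
    module Odd = RowsOf y 0

    -- The traces of the initial rows divided by s⁴ (1 - s). A coefficient 0 carries the filler
    -- exponent 9, large enough for the bounds checked here.
    X₀ X₁ X₂ X₃ X₄ Y₀ Y₁ Y₂ Y₃ Y₄ : Terms
    X₀ = (+ 4 , 2) ∷ (+ 4 , 2) ∷ (+ 4 , 2) ∷ (+ 1 , 3) ∷ []
    X₁ = (+ 4 , 1) ∷ (+ 4 , 1) ∷ (+ 1 , 2) ∷ []
    X₂ = (+ 4 , 0) ∷ (+ 1 , 1) ∷ []
    X₃ = (+ 1 , 0) ∷ []
    X₄ = (+ 1 , 0) ∷ (neg 1 , 1) ∷ (+ 2 , 2) ∷ (neg 0 , 3) ∷ (+ 1 , 3) ∷ []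
    Y₀ = (+ 29 , 0) ∷ (+ 108 , 1) ∷ (neg 22 , 2) ∷ (+ 12 , 3) ∷ (neg 0 , 4) ∷ []
    Y₁ = (+ 6 , 0) ∷ (+ 4 , 2) ∷ (neg 1 , 2) ∷ (+ 1 , 3) ∷ []
    Y₂ = (+ 1 , 0) ∷ (+ 4 , 1) ∷ []
    Y₃ = (+ 0 , 9) ∷ (+ 1 , 1) ∷ []
    Y₄ = (+ 0 , 9) ∷ (+ 0 , 9) ∷ (+ 1 , 1) ∷ []

    private
      target : Terms → Polynomial 1
      target l = 𝕧 :^ 4 :* ((κ 1 :- 𝕧) :* terms l 0 𝕧)

    even₀ : Even.Row 0
    even₀ = series X₀ , H-terms 0 2 X₀ _ , low 0 8 6 {t₈} {t₆} X₀ (combine₁ (by 3 (λ S s y → κ 1 :* y :^ 8 :* (κ 1 :- s) ,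
      κ 1 :* y :^ 8 :- (S :^ 1) :* y :^ 6 :+ (:- (y :^ 6)) :* (s :* (y :* y) :- S)) S s y) sy²) trace₈ trace₆
          (by 1 (λ _ → κ 1 :* t₈ :- 𝕧 :^ 1 :* t₆ , target X₀) s)
    even₁ : Even.Row 1
    even₁ = series X₁ , H-terms 1 2 X₁ _ , low 1 6 4 {t₆} {t₄} X₁ (combine₁ (by 3 (λ S s y → κ 1 :* (S :* y :^ 6) :* (κ 1 :- s) ,
      S :^ 1 :* y :^ 6 :- (S :^ 2) :* y :^ 4 :+ (:- (S :* y :^ 4)) :* (s :* (y :* y) :- S)) S s y) sy²) trace₆ trace₄
          (by 1 (λ _ → 𝕧 :^ 1 :* t₆ :- 𝕧 :^ 2 :* t₄ , target X₁) s)
    even₂ : Even.Row 2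
    even₂ = series X₂ , H-terms 2 2 X₂ _ , low 2 4 2 {t₄} {t₂} X₂ (combine₁ (by 3 (λ S s y → κ 1 :* (S :^ 2 :* y :^ 4) :* (κ 1 :- s) ,
      S :^ 2 :* y :^ 4 :- (S :^ 3) :* y :^ 2 :+ (:- (S :^ 2 :* y :^ 2)) :* (s :* (y :* y) :- S)) S s y) sy²) trace₄ trace₂
          (by 1 (λ _ → 𝕧 :^ 2 :* t₄ :- 𝕧 :^ 3 :* t₂ , target X₂) s)
    even₃ : Even.Row 3
    even₃ = series X₃ , H-terms 3 2 X₃ _ , low 3 2 0 {t₂} {t₀} X₃ (combine₁ (by 3 (λ S s y → κ 1 :* (S :^ 3 :* y :^ 2) :* (κ 1 :- s) ,
      S :^ 3 :* y :^ 2 :- (S :^ 4) :* κ 1 :+ (:- (S :^ 3)) :* (s :* (y :* y) :- S)) S s y) sy²) trace₂ trace₀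
          (by 1 (λ _ → 𝕧 :^ 3 :* t₂ :- 𝕧 :^ 4 :* t₀ , target X₃) s)
    -- Here s itself occurs, not a power of y over ℤ[S], and its trace comes from `trace-Ss`.
    even₄ : Even.Row 4
    even₄ = series X₄ , H-terms 4 2 X₄ _ , P.trans (section-cong 0 (by 2 (λ S s → κ 1 :* (S :^ 4 :* κ 1) :* (κ 1 :- s) , S :^ 4 :* κ 1 :+
        (:- (S :^ 3)) :* (S :* s)) S s))
      (P.trans (U-+ (U-value (𝕧 :^ 4) U-1) (U-value (:- (𝕧 :^ 3)) trace-Ss)) (by 1 (λ _ → 𝕧 :^ 4 :* κ 1 :+ (:- (𝕧 :^ 3)) :* tSs , target X₄)
          s))

    odd₀ : Odd.Row 0
    odd₀ = series Y₀ , H-terms 0 0 Y₀ _ , low 0 9 7 {t₉} {t₇} Y₀ (combine₁ (by 3 (λ S s y → y :* y :^ 8 :* (κ 1 :- s) ,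
      κ 1 :* y :^ 9 :- (S :^ 1) :* y :^ 7 :+ (:- (y :^ 7)) :* (s :* (y :* y) :- S)) S s y) sy²) trace₉ trace₇
          (by 1 (λ _ → κ 1 :* t₉ :- 𝕧 :^ 1 :* t₇ , target Y₀) s)
    odd₁ : Odd.Row 1
    odd₁ = series Y₁ , H-terms 1 0 Y₁ _ , low 1 7 5 {t₇} {t₅} Y₁ (combine₁ (by 3 (λ S s y → y :* (S :* y :^ 6) :* (κ 1 :- s) ,
      S :^ 1 :* y :^ 7 :- (S :^ 2) :* y :^ 5 :+ (:- (S :* y :^ 5)) :* (s :* (y :* y) :- S)) S s y) sy²) trace₇ trace₅
          (by 1 (λ _ → 𝕧 :^ 1 :* t₇ :- 𝕧 :^ 2 :* t₅ , target Y₁) s)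
    odd₂ : Odd.Row 2
    odd₂ = series Y₂ , H-terms 2 0 Y₂ _ , low 2 5 3 {t₅} {t₃} Y₂ (combine₁ (by 3 (λ S s y → y :* (S :^ 2 :* y :^ 4) :* (κ 1 :- s) ,
      S :^ 2 :* y :^ 5 :- (S :^ 3) :* y :^ 3 :+ (:- (S :^ 2 :* y :^ 3)) :* (s :* (y :* y) :- S)) S s y) sy²) trace₅ trace₃
          (by 1 (λ _ → 𝕧 :^ 2 :* t₅ :- 𝕧 :^ 3 :* t₃ , target Y₂) s)
    odd₃ : Odd.Row 3
    odd₃ = series Y₃ , H-terms 3 0 Y₃ _ , low 3 3 1 {t₃} {t₁} Y₃ (combine₁ (by 3 (λ S s y → y :* (S :^ 3 :* y :^ 2) :* (κ 1 :- s) ,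
      S :^ 3 :* y :^ 3 :- (S :^ 4) :* y :^ 1 :+ (:- (S :^ 3 :* y)) :* (s :* (y :* y) :- S)) S s y) sy²) trace₃ trace₁
          (by 1 (λ _ → 𝕧 :^ 3 :* t₃ :- 𝕧 :^ 4 :* t₁ , target Y₃) s)
    odd₄ : Odd.Row 4
    odd₄ = series Y₄ , H-terms 4 0 Y₄ _ , P.trans (section-cong 0 (by 3 (λ S s y → y :* (S :^ 4 :* κ 1) :* (κ 1 :- s) , S :^ 4 :* y :^ 1 :+
        (:- (S :^ 3)) :* (S :* (s :* y))) S s y))
      (P.trans (U-+ (U-value (𝕧 :^ 4) trace₁) (U-value (:- (𝕧 :^ 3)) trace-Ssy)) (by 1 (λ _ → 𝕧 :^ 4 :* t₁ :+ (:- (𝕧 :^ 3)) :* tSsy ,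
          target Y₄) s))

    evenImage⁺ = Even.image⁺ even₀ even₁ even₂ even₃ even₄
    evenImage  = Even.image even₀ even₁ even₂ even₃ even₄
    oddImage⁺  = Odd.image⁺ odd₀ odd₁ odd₂ odd₃ odd₄
    oddImage   = Odd.image odd₀ odd₁ odd₂ odd₃ odd₄

-- The alternating lattices and the progression of γ

module Descent where
  open import Defs
  open ProductsAndEuler
  open TriangularSeries
  open ClassEquations
  open Parametrisation
  open ModularEquations
  open TracesOfPowers
  open MatrixRows
  open PartitionSeries
  open P using (_+_; _*_; -_; _-_)
  open Hauptmodul
  open Traces
  open BaseRows

  M₀ M₁ : ℕ → ℕ → Set
  M₀ v j = j ℕ.≤ 3 ℕ.* v ℕ.+ 2
  M₁ v j = j ℕ.≤ 3 ℕ.* v ℕ.+ 1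

  module _ where
    open ℕₚ.≤-Reasoning

    -- The hypotheses combine to 5 j′ + 2 ≤ 6 (v + v′) + 1. The offset 2 excludes v + v′ = 0, so one
    -- factor 5 can be split off; what remains, 5 j′ ≤ 6 u + 5, lies within the slope 3.
    divide-bound : ∀ v v′ j j′ → j ℕ.≤ 3 ℕ.* v ℕ.+ 1 → 5 ℕ.* j′ ℕ.+ 2 ℕ.≤ 6 ℕ.* v′ ℕ.+ j → ∃ λ u → v ℕ.+ v′ ≡ suc u × j′ ℕ.≤ 3 ℕ.* u ℕ.+ 2
    divide-bound v v′ j j′ p q = go (v ℕ.+ v′) ≡.refl
      where
      e₁ : ∀ v v′ → 6 ℕ.* v′ ℕ.+ (3 ℕ.* v ℕ.+ 1) ℕ.+ 3 ℕ.* v ≡ 6 ℕ.* (v ℕ.+ v′) ℕ.+ 1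
      e₁ = solve-∀
      total : 5 ℕ.* j′ ℕ.+ 2 ℕ.≤ 6 ℕ.* (v ℕ.+ v′) ℕ.+ 1
      total = begin
        5 ℕ.* j′ ℕ.+ 2                        ≤⟨ q ⟩
        6 ℕ.* v′ ℕ.+ j                        ≤⟨ ℕₚ.+-monoʳ-≤ (6 ℕ.* v′) p ⟩
        6 ℕ.* v′ ℕ.+ (3 ℕ.* v ℕ.+ 1)          ≤⟨ ℕₚ.m≤m+n _ (3 ℕ.* v) ⟩
        6 ℕ.* v′ ℕ.+ (3 ℕ.* v ℕ.+ 1) ℕ.+ 3 ℕ.* v ≡⟨ e₁ v v′ ⟩
        6 ℕ.* (v ℕ.+ v′) ℕ.+ 1 ∎
      e₂ : ∀ u → 6 ℕ.* suc u ℕ.+ 1 ℕ.+ 9 ℕ.* u ≡ 5 ℕ.* (3 ℕ.* u) ℕ.+ 7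
      e₂ = solve-∀
      e₃ : ∀ u → 5 ℕ.* (3 ℕ.* u ℕ.+ 3) ℕ.+ 2 ≡ 5 ℕ.* (3 ℕ.* u) ℕ.+ 7 ℕ.+ 10
      e₃ = solve-∀
      e₄ : ∀ u → suc (3 ℕ.* u ℕ.+ 2) ≡ 3 ℕ.* u ℕ.+ 3
      e₄ = solve-∀
      go : ∀ t → v ℕ.+ v′ ≡ t → ∃ λ u → v ℕ.+ v′ ≡ suc u × j′ ℕ.≤ 3 ℕ.* u ℕ.+ 2
      go zero    e = contradiction (≡.subst (λ t → 5 ℕ.* j′ ℕ.+ 2 ℕ.≤ 6 ℕ.* t ℕ.+ 1) e total) (ℕₚ.<⇒≱ (ℕₚ.m≤n+m 2 (5 ℕ.* j′)))
      go (suc u) e = u , e , ℕₚ.≮⇒≥ λ big → ℕₚ.<-irrefl ≡.refl (begin-strict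
        5 ℕ.* (3 ℕ.* u) ℕ.+ 7            <⟨ ℕₚ.m<m+n _ (s≤s z≤n) ⟩
        5 ℕ.* (3 ℕ.* u) ℕ.+ 7 ℕ.+ 10     ≡⟨ e₃ u ⟨
        5 ℕ.* (3 ℕ.* u ℕ.+ 3) ℕ.+ 2      ≤⟨ ℕₚ.+-monoˡ-≤ 2 (ℕₚ.*-monoʳ-≤ 5 (ℕₚ.≤-trans (ℕₚ.≤-reflexive (≡.sym (e₄ u))) big)) ⟩
        5 ℕ.* j′ ℕ.+ 2                   ≤⟨ ≡.subst (λ t → 5 ℕ.* j′ ℕ.+ 2 ℕ.≤ 6 ℕ.* t ℕ.+ 1) e total ⟩
        6 ℕ.* suc u ℕ.+ 1                ≤⟨ ℕₚ.m≤m+n _ (9 ℕ.* u) ⟩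
        6 ℕ.* suc u ℕ.+ 1 ℕ.+ 9 ℕ.* u    ≡⟨ e₂ u ⟩
        5 ℕ.* (3 ℕ.* u) ℕ.+ 7 ∎)

    -- 5 j′ ≤ 6 v′ + 3 v + 9 < 5 (3 (v + v′) + 2). The constant 9 just stays below 10, which is how
    -- + 2 improves to + 1.
    keep-bound : ∀ v v′ j j′ → j ℕ.≤ 3 ℕ.* v ℕ.+ 2 → 5 ℕ.* j′ ℕ.+ 0 ℕ.≤ 6 ℕ.* v′ ℕ.+ (7 ℕ.+ j) → j′ ℕ.≤ 3 ℕ.* (v ℕ.+ v′) ℕ.+ 1
    keep-bound v v′ j j′ p q = ℕₚ.≮⇒≥ λ big → ℕₚ.<-irrefl ≡.refl (begin-strict
        15 ℕ.* (v ℕ.+ v′) ℕ.+ 9                             <⟨ ℕₚ.≤-reflexive (e₃ (v ℕ.+ v′)) ⟩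
        5 ℕ.* suc (3 ℕ.* (v ℕ.+ v′) ℕ.+ 1) ℕ.+ 0            ≤⟨ ℕₚ.+-monoˡ-≤ 0 (ℕₚ.*-monoʳ-≤ 5 big) ⟩
        5 ℕ.* j′ ℕ.+ 0                                      ≤⟨ q ⟩
        6 ℕ.* v′ ℕ.+ (7 ℕ.+ j)                              ≤⟨ ℕₚ.+-monoʳ-≤ (6 ℕ.* v′) (ℕₚ.+-monoʳ-≤ 7 p) ⟩
        6 ℕ.* v′ ℕ.+ (7 ℕ.+ (3 ℕ.* v ℕ.+ 2))                ≤⟨ ℕₚ.m≤m+n _ (12 ℕ.* v ℕ.+ 9 ℕ.* v′) ⟩
        6 ℕ.* v′ ℕ.+ (7 ℕ.+ (3 ℕ.* v ℕ.+ 2)) ℕ.+ (12 ℕ.* v ℕ.+ 9 ℕ.* v′) ≡⟨ e₁ v v′ ⟩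
        15 ℕ.* (v ℕ.+ v′) ℕ.+ 9 ∎)
      where
      e₁ : ∀ v v′ → 6 ℕ.* v′ ℕ.+ (7 ℕ.+ (3 ℕ.* v ℕ.+ 2)) ℕ.+ (12 ℕ.* v ℕ.+ 9 ℕ.* v′) ≡ 15 ℕ.* (v ℕ.+ v′) ℕ.+ 9
      e₁ = solve-∀
      e₃ : ∀ u → suc (15 ℕ.* u ℕ.+ 9) ≡ 5 ℕ.* suc (3 ℕ.* u ℕ.+ 1) ℕ.+ 0
      e₃ = solve-∀

  const-5^ : ∀ v → const (+ (5 ℕ.^ v)) ≋ five ^ v
  const-5^ zero    = P.refl
  const-5^ (suc v) = P.trans (const-cong (ℤₚ.pos-* 5 (5 ℕ.^ v))) (P.trans (const-* (+ 5) (+ (5 ℕ.^ v))) (P.*-congˡ (const-5^ v)))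

  scaled-gen : ∀ u d v′ j′ → five ^ u * (const d * (five ^ v′ * s ^ j′)) ≋ const d * (five ^ (u ℕ.+ v′) * s ^ j′)
  scaled-gen u d v′ j′ = P.trans (by 4 (λ f d g s → f :* (d :* (g :* s)) , d :* ((f :* g) :* s)) (five ^ u) (const d) (five ^ v′) (s ^ j′))
    (P.*-congˡ (P.*-congʳ (P.sym (^-homo-* five u v′))))

  divide : ∀ v j → M₁ v j → ∀ {Γ} → Span (H j 2) Γ → ∃ λ g → Span M₀ g × five ^ v * Γ ≋ five * g
  divide v j m (gen d v′ j′ h) with divide-bound v v′ j j′ m h
  ... | u , e , b = const d * (five ^ u * s ^ j′) , gen d u j′ b , P.trans (scaled-gen v d v′ j′)
      (P.trans (P.*-congˡ (P.*-congʳ (P.reflexive (≡.cong (five ^_) e))))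
    (by 4 (λ f d g s → d :* ((f :* g) :* s) , f :* (d :* (g :* s))) five (const d) (five ^ u) (s ^ j′)))
  divide v j m none = P.0# , none , P.trans (P.zeroʳ _) (P.sym (P.zeroʳ _))
  divide v j m (p ⊞ q) = let (g , sg , eg) = divide v j m p ; (h , sh , eh) = divide v j m q in
    g + h , sg ⊞ sh , P.trans (P.distribˡ _ _ _) (P.trans (P.+-cong eg eh) (P.sym (P.distribˡ _ _ _)))
  divide v j m (resp e p) = let (g , sg , eg) = divide v j m p in g , sg , P.trans (P.*-congˡ (P.sym e)) eg

  keep : ∀ v j → M₀ v j → ∀ {Γ} → Span (H (7 ℕ.+ j) 0) Γ → Span M₁ (five ^ v * Γ)
  keep v j m (gen d v′ j′ h) = resp (P.sym (scaled-gen v d v′ j′)) (gen d (v ℕ.+ v′) j′ (keep-bound v v′ j j′ m h))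
  keep v j m none            = resp (P.sym (P.zeroʳ _)) none
  keep v j m (p ⊞ q)         = resp (P.sym (P.distribˡ _ _ _)) (keep v j m p ⊞ keep v j m q)
  keep v j m (resp e p)      = resp (P.*-congˡ e) (keep v j m p)

  span-const : ∀ {A} c {g} → Span A g → Span A (const c * g)
  span-const {A} c p = span-* {B = A} (λ { (≡.refl , ≡.refl) a → a }) (resp (P.trans (P.*-congˡ (P.*-identityˡ _)) (P.*-identityʳ _))
      (gen {A = λ v j → v ≡ 0 × j ≡ 0} c 0 0 (≡.refl , ≡.refl))) p

  U-step : ∀ {g} → Span M₁ g → ∃ λ g′ → Span M₀ g′ × U₅ (1-s * (s * g)) ≋ five * (1-s * (s * g′))
  U-step (gen c v j m) =
    let (Γ , p , r) = evenImage⁺ j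
        (g , sg , eg) = divide v j m p
    in const c * g , span-const c sg , P.trans
      (section-cong 0 (by 5 (λ e s c f r → e :* (s :* (c :* (f :* r))) , (c :* f) :* (κ 1 :* (s :* r) :* e)) 1-s s (const c) (five ^ v)
          (s ^ j)))
      (P.trans (U-value (con c :* κ 5 :^ v) r) (P.trans
        (by 5 (λ e s c f r → (c :* f) :* (e :* (s :* r)) , c :* (e :* (s :* (f :* r)))) 1-s s (const c) (five ^ v) Γ)
        (P.trans (P.*-congˡ (P.*-congˡ (P.*-congˡ eg)))
        (by 4 (λ e s c g → c :* (e :* (s :* (κ 5 :* g))) , κ 5 :* (e :* (s :* (c :* g)))) 1-s s (const c) g))))
  U-step none = P.0# , none , P.trans (section-cong 0 (by 2 (λ e s → e :* (s :* κ 0) , κ 0) 1-s s)) (P.trans (section-0 0)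
    (by 2 (λ e s → κ 0 , κ 5 :* (e :* (s :* κ 0))) 1-s s))
  U-step (_⊞_ {f} {h} p q) =
    let (g , sg , eg) = U-step p ; (k , sk , ek) = U-step q in
    g + k , sg ⊞ sk , P.trans (section-cong 0 (by 4 (λ e s f h → e :* (s :* (f :+ h)) , e :* (s :* f) :+ e :* (s :* h)) 1-s s f h))
      (P.trans (U-+ eg ek) (by 4 (λ e s f h → κ 5 :* (e :* (s :* f)) :+ κ 5 :* (e :* (s :* h)) , κ 5 :* (e :* (s :* (f :+ h)))) 1-s s g k))
  U-step (resp e p) = let (g , sg , eg) = U-step p in g , sg , P.trans (section-cong 0 (P.*-congˡ (P.*-congˡ (P.sym e)))) eg

  -- C₀, C₁, C₂ are c₀, c₁, c₂ divided by S, but C₃ and C₄ are c₃ and c₄ themselves, as the factor S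
  -- then comes from s y² = S. Λ is the quotient of (1 - 5 s)⁴ U Z by s (1 - s).
  C₀ C₁ C₂ C₃ C₄ Λ : Terms
  C₀ = (+ 1 , 0) ∷ (+ 8 , 1) ∷ (neg 10 , 2) ∷ (+ 7 , 3) ∷ (neg 1 , 4) ∷ (+ 1 , 4) ∷ []
  C₁ = (+ 1 , 0) ∷ (neg 5 , 1) ∷ (+ 43 , 1) ∷ (neg 0 , 4) ∷ (+ 8 , 3) ∷ (neg 0 , 4) ∷ []
  C₂ = (+ 1 , 0) ∷ (neg 15 , 1) ∷ (+ 12 , 2) ∷ (neg 3 , 3) ∷ (+ 3 , 3) ∷ []
  C₃ = (+ 0 , 9) ∷ (+ 11 , 0) ∷ (neg 2 , 2) ∷ (+ 1 , 3) ∷ (neg 0 , 3) ∷ []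
  C₄ = (+ 1 , 0) ∷ (+ 3 , 1) ∷ (neg 0 , 2) ∷ (+ 1 , 2) ∷ []
  Λ = (+ 1 , 0) ∷ (+ 1 , 0) ∷ (+ 19 , 1) ∷ (neg 23 , 2) ∷ (+ 18 , 3) ∷ (neg 7 , 4) ∷ (+ 2 , 5) ∷ (neg 0 , 5) ∷ []

  ε : Series
  ε = P.1# - five * s

  εᵖ : Polynomial 1
  εᵖ = κ 1 :- κ 5 :* 𝕧

  -- Moved inside U, the factor (1 - 5 s)⁴ becomes (1 - 5 S)⁴ and makes Z a polynomial in y. The
  -- five products that arise are even or odd images, and each coefficient list is small enough to
  -- meet the common bound `H (7 + j) 0`.
  Z-row : ∀ j → ∃ λ Γ → Span (H (7 ℕ.+ j) 0) Γ × ε ^ 4 * U₅ (Z * (s ^ suc j * 1-s)) ≋ 1-s * (s * Γ)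
  Z-row j =
    let (Γ₀ , p₀ , r₀) = oddImage (2 ℕ.+ j)
        (Γ₁ , p₁ , r₁) = evenImage (1 ℕ.+ j)
        (Γ₂ , p₂ , r₂) = oddImage (1 ℕ.+ j)
        (Γ₃ , p₃ , r₃) = evenImage j
        (Γ₄ , p₄ , r₄) = oddImage j
    in series C₀ * Γ₀ + series C₁ * Γ₁ + series C₂ * Γ₂ + series C₃ * Γ₃ + series C₄ * Γ₄ ,
       (H-weaken 0 (e₀ j) (H-* 1 0 (6 ℕ.+ j) 0 (H-terms 1 0 C₀ _) p₀) ⊞ H-weaken 0 (e₁ j) (H-* 4 0 (5 ℕ.+ j) 2 (H-terms 4 0 C₁ _) p₁)
         ⊞ H-weaken 0 (e₂ j) (H-* 2 0 (5 ℕ.+ j) 0 (H-terms 2 0 C₂ _) p₂) ⊞ H-weaken 0 (e₃ j) (H-* 5 0 (4 ℕ.+ j) 2 (H-terms 5 0 C₃ _) p₃)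
         ⊞ H-weaken 0 (e₄ j) (H-* 3 0 (4 ℕ.+ j) 0 (H-terms 3 0 C₄ _) p₄)) ,
       P.trans (P.sym (U-value (εᵖ :^ 4) P.refl)) (P.trans (section-cong 0
         (combine₂ (by 5 (λ S s y z r → let e = κ 1 :- s in
            (κ 1 :- κ 5 :* S) :^ 4 :* (z :* ((s :* r) :* e)) ,
            ((S :* terms C₀ 0 S) :* (y :* (s :* (s :* r)) :* e) :+ (S :* terms C₁ 0 S) :* (κ 1 :* (s :* r) :* e) :+
                (S :* terms C₂ 0 S) :* (y :* (s :* r) :* e)
             :+ (S :* terms C₃ 0 S) :* (κ 1 :* r :* e) :+ (S :* terms C₄ 0 S) :* (y :* r :* e))
            :+ (s :* r :* e) :* ((κ 1 :- κ 5 :* S) :^ 4 :* z :- (c₀ S :* s :* y :+ c₁ S :+ c₂ S :* y :+ c₃ S :* y :^ 2 :+ c₄ S :* y :^ 3))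
            :+ ((c₃ S :+ c₄ S :* y) :* r :* e) :* (s :* (y :* y) :- S)) S s y Z (s ^ j)) Z-y sy²))
       (P.trans (U-+ (U-+ (U-+ (U-+ (U-value (𝕧 :* terms C₀ 0 𝕧) r₀) (U-value (𝕧 :* terms C₁ 0 𝕧) r₁)) (U-value (𝕧 :* terms C₂ 0 𝕧) r₂))
           (U-value (𝕧 :* terms C₃ 0 𝕧) r₃)) (U-value (𝕧 :* terms C₄ 0 𝕧) r₄))
         (by 12 (λ s e a₀ a₁ a₂ a₃ a₄ x₀ x₁ x₂ x₃ x₄ → (s :* a₀) :* (e :* x₀) :+ (s :* a₁) :* (e :* x₁) :+ (s :* a₂) :* (e :* x₂) :+
             (s :* a₃) :* (e :* x₃) :+ (s :* a₄) :* (e :* x₄) ,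
              e :* (s :* (a₀ :* x₀ :+ a₁ :* x₁ :+ a₂ :* x₂ :+ a₃ :* x₃ :+ a₄ :* x₄)))
            s 1-s (series C₀) (series C₁) (series C₂) (series C₃) (series C₄) Γ₀ Γ₁ Γ₂ Γ₃ Γ₄)))
    where
    e₀ : ∀ j → 1 ℕ.+ (6 ℕ.+ j) ℕ.+ 0 ℕ.+ 0 ≡ 7 ℕ.+ j ℕ.+ (0 ℕ.+ 0)
    e₀ = solve-∀
    e₁ : ∀ j → 4 ℕ.+ (5 ℕ.+ j) ℕ.+ 0 ℕ.+ 0 ≡ 7 ℕ.+ j ℕ.+ (0 ℕ.+ 2)
    e₁ = solve-∀
    e₂ : ∀ j → 2 ℕ.+ (5 ℕ.+ j) ℕ.+ 0 ℕ.+ 0 ≡ 7 ℕ.+ j ℕ.+ (0 ℕ.+ 0)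
    e₂ = solve-∀
    e₃ : ∀ j → 5 ℕ.+ (4 ℕ.+ j) ℕ.+ 0 ℕ.+ 0 ≡ 7 ℕ.+ j ℕ.+ (0 ℕ.+ 2)
    e₃ = solve-∀
    e₄ : ∀ j → 3 ℕ.+ (4 ℕ.+ j) ℕ.+ 0 ℕ.+ 0 ≡ 7 ℕ.+ j ℕ.+ (0 ℕ.+ 0)
    e₄ = solve-∀

  UZ-step : ∀ {g} → Span M₀ g → ∃ λ g′ → Span M₁ g′ × ε ^ 4 * U₅ (Z * (1-s * (s * g))) ≋ 1-s * (s * g′)
  UZ-step (gen c v j m) =
    let (Γ , p , r) = Z-row j in
    const c * (five ^ v * Γ) , span-const c (keep v j m p) , P.trans (P.*-congˡ (P.trans
      (section-cong 0 (by 6 (λ e s c f r z → z :* (e :* (s :* (c :* (f :* r)))) , (c :* f) :* (z :* ((s :* r) :* e))) 1-s s (const c)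
          (five ^ v) (s ^ j) Z))
      (U-value (con c :* κ 5 :^ v) P.refl)))
      (P.trans (by 4 (λ e c f u → e :^ 4 :* ((c :* f) :* u) , (c :* f) :* (e :^ 4 :* u)) ε (const c) (five ^ v)
          (U₅ (Z * (s ^ suc j * 1-s))))
      (P.trans (P.*-congˡ r) (by 5 (λ e s c f g → (c :* f) :* (e :* (s :* g)) , e :* (s :* (c :* (f :* g)))) 1-s s (const c) (five ^ v) Γ)))
  UZ-step none = P.0# , none , P.trans (P.*-congˡ (P.trans (section-cong 0 (by 3 (λ z e s → z :* (e :* (s :* κ 0)) , κ 0) Z 1-s s))
      (section-0 0)))
    (by 3 (λ z e s → z :^ 4 :* κ 0 , e :* (s :* κ 0)) ε 1-s s)
  UZ-step (_⊞_ {f} {h} p q) =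
    let (g , sg , eg) = UZ-step p ; (k , sk , ek) = UZ-step q in
    g + k , sg ⊞ sk , P.trans (P.*-congˡ (P.trans (section-cong 0 (by 5 (λ e s f h z → z :* (e :* (s :* (f :+ h))) , z :* (e :* (s :* f)) :+
        z :* (e :* (s :* h))) 1-s s f h Z))
      (section-+ 0 _ _))) (P.trans (P.distribˡ _ _ _) (P.trans (P.+-cong eg ek)
      (by 4 (λ e s f h → e :* (s :* f) :+ e :* (s :* h) , e :* (s :* (f :+ h))) 1-s s g k)))
  UZ-step (resp e p) = let (g , sg , eg) = UZ-step p in g , sg ,
      P.trans (P.*-congˡ (section-cong 0 (P.*-congˡ (P.*-congˡ (P.*-congˡ (P.sym e)))))) eg

  -- The first argument of U is Z without a factor s (1 - s), so its image is computed from the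
  -- traces; an extra factor S makes `trace-Ssy` applicable.
  UZ-start : ε ^ 4 * U₅ Z ≋ 1-s * (s * series Λ)
  UZ-start = cancel s-regular (P.trans (P.trans (P.sym (P.*-assoc _ _ _)) (P.sym (U-value (𝕧 :* εᵖ :^ 4) P.refl))) (P.trans (section-cong 0
      (combine₁ (by 4 (λ S s y z → (S :* (κ 1 :- κ 5 :* S) :^ 4) :* z ,
        (c₀ S :* (S :* (s :* y)) :+ (S :* c₁ S) :* y :^ 0 :+ (S :* c₂ S) :* y :^ 1 :+ (S :* c₃ S) :* y :^ 2 :+ (S :* c₄ S) :* y :^ 3)
        :+ S :* ((κ 1 :- κ 5 :* S) :^ 4 :* z :- (c₀ S :* s :* y :+ c₁ S :+ c₂ S :* y :+ c₃ S :* y :^ 2 :+ c₄ S :* y :^ 3))) S s y Z) Z-y))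
    (P.trans (U-+ (U-+ (U-+ (U-+ (U-value (c₀ 𝕧) trace-Ssy) (U-value (𝕧 :* c₁ 𝕧) trace₀)) (U-value (𝕧 :* c₂ 𝕧) trace₁))
        (U-value (𝕧 :* c₃ 𝕧) trace₂)) (U-value (𝕧 :* c₄ 𝕧) trace₃))
      (by 1 (λ _ → c₀ 𝕧 :* tSsy :+ (𝕧 :* c₁ 𝕧) :* t₀ :+ (𝕧 :* c₂ 𝕧) :* t₁ :+ (𝕧 :* c₃ 𝕧) :* t₂ :+ (𝕧 :* c₄ 𝕧) :* t₃ ,
          𝕧 :* ((κ 1 :- 𝕧) :* (𝕧 :* terms Λ 0 𝕧))) s))))

  Λ-span : Span M₁ (series Λ)
  Λ-span = span-terms (λ v j → j ℕ.≤ᵇ 3 ℕ.* v ℕ.+ 1) (λ v j → ℕₚ.≤ᵇ⇒≤ _ _) Λ 0 _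

  -- The truncated inverse of 1 - 5 s. Its terms 5ⁿ sⁿ satisfy j ≤ v, so multiplication by it
  -- respects the slope 3.
  geometric : ℕ → Series
  geometric zero    = P.0#
  geometric (suc n) = geometric n + (five * s) ^ n

  geometric-ε : ∀ n → ε * geometric n ≋ P.1# upto n
  geometric-ε n = upto-trans (≋⇒upto (closed n)) (upto-trans (upto-+ upto-refl (upto-neg (small n))) (≋⇒upto (by 0 (κ 1 :- κ 0 , κ 1))))
    where
    closed : ∀ n → ε * geometric n ≋ P.1# - (five * s) ^ n
    closed zero    = by 1 (λ e → e :* κ 0 , κ 1 :- κ 1) ε
    closed (suc n) = P.trans (P.distribˡ _ _ _) (P.trans (P.+-congʳ (closed n)) (by 2 (λ q r → (κ 1 :- r) :+ (κ 1 :- q) :* r ,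
        κ 1 :- q :* r) (five * s) ((five * s) ^ n)))
    small : ∀ n → (five * s) ^ n ≋ P.0# upto n
    small n = upto-trans (≋⇒upto (P.trans (^-congˡ n (by 3 (λ f x t → f :* (x :* t) , x :* (f :* t)) five X s₁)) (^-distrib-* X (five * s₁)
        n))) (X^*-vanish n _ ℕₚ.≤-refl)

  geometric-span : ∀ n → Span (λ v j → j ℕ.≤ v) (geometric n)
  geometric-span zero    = none
  geometric-span (suc n) = geometric-span n ⊞ resp (P.trans (P.*-identityˡ _) (P.sym (^-distrib-* five s n))) (gen (+ 1) n n ℕₚ.≤-refl)

  M₁-geometric : ∀ {g} n → Span M₁ g → Span M₁ (geometric n * g)
  M₁-geometric n p = span-* (λ {v} {j} {v′} {j′} a b → ℕₚ.≤-trans (ℕₚ.+-mono-≤ a b) (ℕₚ.≤-trans (ℕₚ.m≤m+n _ (2 ℕ.* v))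
      (ℕₚ.≤-reflexive (e v v′)))) (geometric-span n) p
    where
    e : ∀ v v′ → v ℕ.+ (3 ℕ.* v′ ℕ.+ 1) ℕ.+ 2 ℕ.* v ≡ 3 ℕ.* (v ℕ.+ v′) ℕ.+ 1
    e = solve-∀

  -- Membership in the q-adic closure: there is an approximation at every precision, and no
  -- compatibility between them is asked.
  record InLattice (A : ℕ → ℕ → Set) (k : ℕ) (f : Series) : Set where
    constructor lattice
    field approximate : ∀ N → ∃ λ g → Span A g × f ≋ five ^ k * (1-s * (s * g)) upto N
  open InLattice

  -- The step that leaves the polynomials in s: the inverse of ε⁴ is replaced by a truncation.
  divide-ε : ∀ {f g} → Span M₁ g → ε ^ 4 * f ≋ 1-s * (s * g) → ∀ N → ∃ λ h → Span M₁ h × f ≋ 1-s * (s * h) upto N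
  divide-ε {f} {g} p e N = r * (r * (r * (r * g))) , M₁-geometric N (M₁-geometric N (M₁-geometric N (M₁-geometric N p))) ,
    upto-trans (≋⇒upto (by 1 (λ f → f , κ 1 :^ 4 :* f) f))
    (upto-trans (upto-* (upto-sym (upto-^ 4 (geometric-ε N))) upto-refl)
    (≋⇒upto (P.trans (by 3 (λ e r f → (e :* r) :^ 4 :* f , r :^ 4 :* (e :^ 4 :* f)) ε r f)
      (P.trans (P.*-congˡ e) (by 4 (λ r e s g → r :^ 4 :* (e :* (s :* g)) , e :* (s :* (r :* (r :* (r :* (r :* g)))))) r 1-s s g)))))
    where r = geometric N

  U-lattice : ∀ {k f} → InLattice M₁ k f → InLattice M₀ (suc k) (U₅ f)
  U-lattice {k} {f} m = lattice λ N →
    -- Coefficient n of U f is coefficient 5n of f, so precision N requires precision 5N.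
    let (g , p , e) = approximate m (N ℕ.* 5) ; (h , q , r) = U-step p in
    h , q , upto-trans (section-upto 0 e) (≋⇒upto (P.trans (U-value (κ 5 :^ k) r) (by 3 (λ a b c → a :* (b :* c) , (b :* a) :* c) (five ^ k)
        five (1-s * (s * h)))))

  UZ-lattice : ∀ {k f} → InLattice M₀ k f → InLattice M₁ k (U₅ (Z * f))
  UZ-lattice {k} {f} m = lattice λ N →
    let (g , p , e) = approximate m (N ℕ.* 5) ; (h , q , r) = UZ-step p ; (h′ , q′ , r′) = divide-ε q r N in
    h′ , q′ , upto-trans (section-upto 0 (upto-* upto-refl e)) (upto-trans
      (≋⇒upto (P.trans (section-cong 0 (by 3 (λ z f t → z :* (f :* t) , f :* (z :* t)) Z (five ^ k) (1-s * (s * g))))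
          (U-value (κ 5 :^ k) P.refl)))
      (upto-* upto-refl r′))

  UZ-lattice₀ : InLattice M₁ 0 (U₅ Z)
  UZ-lattice₀ = lattice λ N → let (h , q , r) = divide-ε Λ-span UZ-start N in h , q , upto-trans r (≋⇒upto (P.sym (P.*-identityˡ _)))

  lattice-resp : ∀ {A k f g} → f ≋ g → InLattice A k f → InLattice A k g
  lattice-resp e m = lattice λ N → let (h , p , r) = approximate m N in h , p , upto-trans (≋⇒upto (P.sym e)) r

  opaque
    unfolding section
    -- A factor q shifts the residue: 5 (n + 1) is one more than 5n + 4.
    U-X : ∀ f → U₅ (X * f) ≋ X * section 4 f
    U-X f = pointwise λ
      { zero    → ≡.trans (X-⊛-zero f) (≡.sym (X-⊛-zero (section 4 f)))
      ; (suc n) → ≡.trans (X-⊛-suc f (4 ℕ.+ (n ℕ.* 5 ℕ.+ 0))) (≡.trans (≡.cong f (shift n)) (≡.sym (X-⊛-suc (section 4 f) n))) }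
      where
      shift : ∀ n → 4 ℕ.+ (n ℕ.* 5 ℕ.+ 0) ≡ n ℕ.* 5 ℕ.+ 4
      shift = solve-∀

    section₄-X : ∀ f → section 4 (X * f) ≋ section 3 f
    section₄-X f = pointwise λ n → ≡.trans (≡.cong (X * f) (shift n)) (≡.trans (X-⊛-suc f (3 ℕ.+ n ℕ.* 5))
        (≡.cong f (ℕₚ.+-comm 3 (n ℕ.* 5))))
      where
      shift : ∀ n → n ℕ.* 5 ℕ.+ 4 ≡ suc (3 ℕ.+ n ℕ.* 5)
      shift = solve-∀

  E : Series
  E = η * (η₂ * η₂)

  E-dilate : dilate 5 E ≋ η₅ * (η₁₀ * η₁₀)
  E-dilate = P.trans (dilate-* 5 _ _) (P.*-congˡ (dilate-* 5 _ _))

  XE-dilate² : dilate 5 (X * dilate 5 E) ≋ X ^ 5 * (η₂₅ * (η₅₀ * η₅₀))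
  XE-dilate² = P.trans (dilate-* 5 _ _) (P.*-cong (dilate-X 5) (P.trans (dilate-cong 5 E-dilate) (P.trans (dilate-* 5 _ _)
      (P.*-congˡ (dilate-* 5 _ _)))))

  -- Z = q⁵ E(q²⁵) F with E F = 1, so multiplication by Z exchanges E for a series in q⁵, which
  -- leaves U.
  U-Z : ∀ D → U₅ (Z * (X * (E * D))) ≋ X * (dilate 5 E * U₅ (X * D))
  U-Z D = P.trans (section-cong 0 (combine₁ (by 5 (λ q f x e d → (q :* f) :* (x :* (e :* d)) , q :* (x :* d) :+
      (q :* x :* d) :* (e :* f :- κ 1))
      (X ^ 5 * (η₂₅ * (η₅₀ * η₅₀))) F X E D) F-eq))
    (P.trans (section-cong 0 (P.*-congʳ (P.sym XE-dilate²))) (P.trans (U-dilate (X * dilate 5 E) P.refl) (P.*-assoc _ _ _)))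

  U-E : ∀ f → U₅ (X * (dilate 5 E * f)) ≋ X * (E * section 4 f)
  U-E f = P.trans (section-cong 0 (by 3 (λ x e f → x :* (e :* f) , e :* (x :* f)) X (dilate 5 E) f))
    (P.trans (U-dilate E (U-X f)) (by 3 (λ x e f → e :* (x :* f) , x :* (e :* f)) X E (section 4 f)))

  -- The prefactor q changes the residues to 4 and 3; the new index 5 (5n + 3) + 4 = 25n + 19 is the
  -- origin of the 19 in γ.
  lattice-step : ∀ {k D} → InLattice M₀ k (X * (E * D)) → InLattice M₀ (suc k) (X * (E * section 3 (section 4 D)))
  lattice-step {k} {D} m = lattice-resp
    (P.trans (section-cong 0 (P.trans (U-Z D) (P.*-congˡ (P.*-congˡ (U-X D))))) (P.trans (U-E _) (P.*-congˡ (P.*-congˡ (section₄-X _)))))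
    (U-lattice (UZ-lattice m))

  -- The first application of U meets no prefactor q, so the index is 5 (5n + 4) = 25n + 20, the
  -- origin of the 20 in γ.
  lattice-start : InLattice M₀ 1 (X * (E * section 4 (section 0 F)))
  lattice-start = lattice-resp (P.trans (section-cong 0 start) (U-E _)) (U-lattice UZ-lattice₀)
    where
    start : U₅ Z ≋ X * (dilate 5 E * U₅ F)
    start = P.trans (section-cong 0 (P.*-congʳ (P.sym XE-dilate²))) (P.trans (U-dilate (X * dilate 5 E) P.refl) (P.*-assoc _ _ _))

  -- Multiplication by F removes E. Coefficient n of D is coefficient n + 1 of q D, whence the
  -- precision n + 2.
  lattice-divides : ∀ {k D} → InLattice M₀ k (X * (E * D)) → ∀ n → ∃ λ z → D n ≡ (+ (5 ℕ.^ k)) ℤ.* z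
  lattice-divides {k} {D} m n =
    let (g , _ , e) = approximate m (2 ℕ.+ n) in
    (1-s * (s * g) * F) (suc n) , ≡.trans (≡.sym (X-⊛-suc D n)) (≡.trans
      (agree-at (upto-trans (≋⇒upto (combine₁ (by 4 (λ x e d f → x :* d , (x :* (e :* d)) :* f :+ (:- (x :* d)) :* (e :* f :- κ 1)) X E D F)
          F-eq))
        (upto-trans (upto-* e upto-refl) (≋⇒upto (P.trans (P.*-assoc _ _ _) (P.*-congʳ (P.sym (const-5^ k))))))) (suc n) ℕₚ.≤-refl)
      (const-⊛ (+ (5 ℕ.^ k)) (1-s * (s * g) * F) (suc n)))

  -- (25ⁿ - 1) / 24 as a sum of powers, so that the exact division in γ is dealt with once.
  repunit : ℕ → ℕ
  repunit zero    = 0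
  repunit (suc n) = repunit n ℕ.+ 25 ℕ.^ n

  25^-repunit : ∀ n → 25 ℕ.^ n ≡ suc (24 ℕ.* repunit n)
  25^-repunit zero    = ≡.refl
  25^-repunit (suc n) = ≡.trans (e₁ (25 ℕ.^ n)) (≡.trans (≡.cong (ℕ._+ 24 ℕ.* 25 ℕ.^ n) (25^-repunit n)) (e₂ (repunit n) (25 ℕ.^ n)))
    where
    e₁ : ∀ p → 25 ℕ.* p ≡ p ℕ.+ 24 ℕ.* p
    e₁ = solve-∀
    e₂ : ∀ r p → suc (24 ℕ.* r) ℕ.+ 24 ℕ.* p ≡ suc (24 ℕ.* (r ℕ.+ p))
    e₂ = solve-∀

  γ-repunit : ∀ n → γ (suc n) ≡ 20 ℕ.+ 475 ℕ.* repunit n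
  γ-repunit n = ≡.cong (20 ℕ.+_) (≡.trans (≡.cong (λ p → 475 ℕ.* (p ∸ 1) ℕ./ 24) (25^-repunit n))
    (≡.trans (≡.cong (ℕ._/ 24) (e (repunit n))) (m*n/n≡m (475 ℕ.* repunit n) 24)))
    where
    e : ∀ r → 475 ℕ.* (24 ℕ.* r) ≡ 475 ℕ.* r ℕ.* 24
    e = solve-∀

  5^-double : ∀ n → 5 ℕ.^ (2 ℕ.* n) ≡ 25 ℕ.^ n
  5^-double n = ≡.sym (ℕₚ.^-*-assoc 5 2 n)

  progression : ℕ → Series
  progression α n = + a 3 (5 ℕ.^ (2 ℕ.* α) ℕ.* n ℕ.+ γ α)

  progression-1 : section 4 (section 0 F) ≋ progression 1
  progression-1 = P.trans (section-cong 4 (section-cong 0 (P.sym (partitions≋F F F-eq)))) (pointwise λ n →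
    ≡.trans (section-at 4 _ n) (≡.trans (section-at 0 _ _) (≡.cong (λ m → + a 3 m) (e n))))
    where
    e : ∀ n → (n ℕ.* 5 ℕ.+ 4) ℕ.* 5 ℕ.+ 0 ≡ 25 ℕ.* n ℕ.+ 20
    e = solve-∀

  -- 25^(α+1) (25n + 19) accounts for the increase of γ by 19 · 25^(α+1).
  progression-suc : ∀ α → section 3 (section 4 (progression (suc α))) ≋ progression (2 ℕ.+ α)
  progression-suc α = pointwise λ n → ≡.trans (section-at 3 _ n) (≡.trans (section-at 4 _ _) (≡.cong (λ m → + a 3 m) (index n)))
    where
    e : ∀ p r n → 25 ℕ.* p ℕ.* ((n ℕ.* 5 ℕ.+ 3) ℕ.* 5 ℕ.+ 4) ℕ.+ (20 ℕ.+ 475 ℕ.* r) ≡ 25 ℕ.* (25 ℕ.* p) ℕ.* n ℕ.+ (20 ℕ.+ 475 ℕ.* (r ℕ.+ p))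
    e = solve-∀
    index : ∀ n → 5 ℕ.^ (2 ℕ.* suc α) ℕ.* ((n ℕ.* 5 ℕ.+ 3) ℕ.* 5 ℕ.+ 4) ℕ.+ γ (suc α) ≡ 5 ℕ.^ (2 ℕ.* (2 ℕ.+ α)) ℕ.* n ℕ.+ γ (2 ℕ.+ α)
    index n = ≡.trans (≡.cong₂ (λ p g → p ℕ.* ((n ℕ.* 5 ℕ.+ 3) ℕ.* 5 ℕ.+ 4) ℕ.+ g) (5^-double (suc α)) (γ-repunit α))
      (≡.trans (e (25 ℕ.^ α) (repunit α) n) (≡.sym (≡.cong₂ (λ p g → p ℕ.* n ℕ.+ g) (5^-double (2 ℕ.+ α)) (γ-repunit (suc α)))))

  progression-lattice : ∀ α → InLattice M₀ (suc α) (X * (E * progression (suc α)))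
  progression-lattice zero    = lattice-resp (P.*-congˡ (P.*-congˡ progression-1)) lattice-start
  progression-lattice (suc α) = lattice-resp (P.*-congˡ (P.*-congˡ (progression-suc α))) (lattice-step (progression-lattice α))

open import Defs
open import Data.Nat using (ℕ; _+_; _*_; _^_; _≤_)
open import Data.Nat.Divisibility using (_∣_)
open Descent using (progression-lattice; lattice-divides)

theorem1p1 : (α n : ℕ) → 1 ≤ α →
    5 ^ α ∣ a 3 (5 ^ (2 * α) * n + γ α)
theorem1p1 (suc α) n _ =
  let (z , e) = lattice-divides (progression-lattice α) n
  in divides ℤ.∣ z ∣ (≡.trans (≡.cong ℤ.∣_∣ e)
       (≡.trans (ℤₚ.abs-* (+ (5 ^ suc α)) z) (ℕₚ.*-comm (5 ^ suc α) ℤ.∣ z ∣)))
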